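{- Let $\lambda$ be a partition of $n$. If $n$ is odd, then $\mathrm{alt}(\lambda)=\mathrm{ralt}(\lambda)=s_\lambda[E,0,-E,0,E,0,-E,\dots]$. If $n$ is even, then $\mathrm{alt}(\lambda)=s_\lambda[E,-1,-E,1,E,-1,-E,1,\dots]$ and $\mathrm{ralt}(\lambda)=s_\lambda[E,1,-E,-1,E,1,-E,-1,\dots]$, evaluated umbrally.
   Context: For a standard Young tableau (SYT) $T$ with $n$ entries, its descent set is $D(T)=\{i: i+1 \text{ appears in a lower row than } i\}$. $T$ is alternating if $D(T)=\{1,3,5,\dots\}\cap[n-1]$ and reverse alternating if $D(T)=\{2,4,6,\dots\}\cap[n-1]$. $\mathrm{alt}(\lambda)$ and $\mathrm{ralt}(\lambda)$ denote the numbers of alternating and reverse alternating SYT of shape $\lambda$. $s_\lambda$ is the Schur function. Euler numbers $E_n$: $\sum_{n\ge0}E_nx^n/n!=\sec x+\tan x$. Substitution notation: $f[a_1,a_2,\dots]$ means write the symmetric function $f$ as a polynomial in the power sums $p_1,p_2,\dots$ and set $p_i=a_i$; $[E,0,-E,0,\dots]$ means $p_{2j+1}=(-1)^jE$, $p_{2j}=0$; $[E,-1,-E,1,\dots]$ means $p_{2j+1}=(-1)^jE$, $p_{2j}=(-1)^j$; $[E,1,-E,-1,\dots]$ means $p_{2j+1}=(-1)^jE$, $p_{2j}=(-1)^{j+1}$. Umbral evaluation: expand the resulting polynomial in the indeterminate $E$ in powers of $E$ and then, as the last step, replace each $E^k$ by $E_k$. -}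

module Defs where

open import Data.Bool using (Bool; true; false; _∧_; _∨_; not; if_then_else_)
open import Data.Nat as ℕ using (ℕ; zero; suc; _∸_; _%_; _≡ᵇ_; _<ᵇ_; _≤ᵇ_)
open import Data.Nat.Combinatorics using (_C_)
open import Data.Integer as ℤ using (ℤ; +_)
open import Data.Rational as ℚ using (ℚ; 0ℚ; 1ℚ; _/_)
open import Data.Fin using (Fin; toℕ; fromℕ<)
open import Data.List as List using (List; []; _∷_; map; length; foldr; concat; upTo; allFin; zip; _++_)
open import Data.Nat.ListAction using (sum)
open import Data.Bool.ListAction using (all; any)
open import Relation.Binary.PropositionalEquality using (_≡_)
open import Relation.Nullary.Decidable using (does)
open import Relation.Nullary using (Dec; yes; no)
open import Data.Product using (Σ; _×_; _,_)

filterᵇ : {A : Set} → (A → Bool) → List A → List A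
filterᵇ p [] = []
filterᵇ p (a ∷ l) = if p a then a ∷ filterᵇ p l else filterᵇ p l

_⇔ᵇ_ : Bool → Bool → Bool
true ⇔ᵇ b = b
false ⇔ᵇ b = not b

weaklyDecreasing : List ℕ → Bool
weaklyDecreasing [] = true
weaklyDecreasing (a ∷ []) = true
weaklyDecreasing (a ∷ b ∷ l) = (b ≤ᵇ a) ∧ weaklyDecreasing (b ∷ l)

IsPartition : List ℕ → ℕ → Set
IsPartition λ' n = (sum λ' ≡ n) × (weaklyDecreasing λ' ≡ true) × (all (λ a → 1 ≤ᵇ a) λ' ≡ true)

-- Fillings of a Young diagram (English notation): a filling of shape λ
-- is a list of rows, row r having λ_r entries. Row 0 is the top row;
-- "lower row" = larger row index.

words : ℕ → ℕ → List (List ℕ)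
words zero m = [] ∷ []
words (suc k) m = concat (map (λ a → map (a ∷_) (words k m)) (map suc (upTo m)))

fillings : List ℕ → ℕ → List (List (List ℕ))
fillings [] m = [] ∷ []
fillings (k ∷ λ') m = concat (map (λ r → map (r ∷_) (fillings λ' m)) (words k m))

strictlyIncreasing : List ℕ → Bool
strictlyIncreasing [] = true
strictlyIncreasing (a ∷ []) = true
strictlyIncreasing (a ∷ b ∷ l) = (a <ᵇ b) ∧ strictlyIncreasing (b ∷ l)

weaklyIncreasing : List ℕ → Bool
weaklyIncreasing [] = true
weaklyIncreasing (a ∷ []) = true
weaklyIncreasing (a ∷ b ∷ l) = (a ≤ᵇ b) ∧ weaklyIncreasing (b ∷ l)

-- entrywise strict increase from an upper row to the row below it
-- (the lower row is no longer than the upper one for partition shapes)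
colStrict : List ℕ → List ℕ → Bool
colStrict (a ∷ u) (b ∷ l) = (a <ᵇ b) ∧ colStrict u l
colStrict _ _ = true

columnsStrict : List (List ℕ) → Bool
columnsStrict [] = true
columnsStrict (r ∷ []) = true
columnsStrict (r ∷ s ∷ t) = colStrict r s ∧ columnsStrict (s ∷ t)

count : ℕ → List ℕ → ℕ
count i l = length (filterᵇ (λ a → a ≡ᵇ i) l)

isSYT : ℕ → List (List ℕ) → Bool
isSYT n T = all strictlyIncreasing T ∧ columnsStrict T
            ∧ all (λ i → count (suc i) (concat T) ≡ᵇ 1) (upTo n)

isSSYT : List (List ℕ) → Bool
isSSYT T = all weaklyIncreasing T ∧ columnsStrict T

rowOf : ℕ → List (List ℕ) → ℕ
rowOf i [] = 0
rowOf i (r ∷ T) = if any (λ a → a ≡ᵇ i) r then 0 else suc (rowOf i T)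

isDescent : List (List ℕ) → ℕ → Bool
isDescent T i = rowOf i T <ᵇ rowOf (suc i) T

isOdd : ℕ → Bool
isOdd i = i % 2 ≡ᵇ 1

isAlternating : ℕ → List (List ℕ) → Bool
isAlternating n T = all (λ j → isDescent T (suc j) ⇔ᵇ isOdd (suc j)) (upTo (n ∸ 1))

isReverseAlternating : ℕ → List (List ℕ) → Bool
isReverseAlternating n T = all (λ j → isDescent T (suc j) ⇔ᵇ not (isOdd (suc j))) (upTo (n ∸ 1))

SYTs : List ℕ → List (List (List ℕ))
SYTs λ' = filterᵇ (isSYT (sum λ')) (fillings λ' (sum λ'))

alt : List ℕ → ℕ
alt λ' = length (filterᵇ (isAlternating (sum λ')) (SYTs λ'))

ralt : List ℕ → ℕ
ralt λ' = length (filterᵇ (isReverseAlternating (sum λ')) (SYTs λ'))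

ℚsum : List ℚ → ℚ
ℚsum = foldr ℚ._+_ 0ℚ

ℚprod : List ℚ → ℚ
ℚprod = foldr ℚ._*_ 1ℚ

-- x_a for a ∈ {1,…,m} (index a-1 of the vector); 0 out of range (never used)
xAt : {m : ℕ} → (Fin m → ℚ) → ℕ → ℚ
xAt {m} x zero = 0ℚ
xAt {m} x (suc a) with a ℕ.<? m
... | yes a<m = x (fromℕ< a<m)
... | no _ = 0ℚ

schur : List ℕ → (m : ℕ) → (Fin m → ℚ) → ℚ
schur λ' m x = ℚsum (map (λ T → ℚprod (map (xAt x) (concat T)))
                          (filterᵇ isSSYT (fillings λ' m)))

powℚ : ℚ → ℕ → ℚ
powℚ q zero = 1ℚ
powℚ q (suc k) = q ℚ.* powℚ q k

powerSum : ℕ → (m : ℕ) → (Fin m → ℚ) → ℚ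
powerSum k m x = ℚsum (map (λ i → powℚ (x i) k) (allFin m))

-- Polynomials (with ℚ coefficients) in v variables, as expressions.
-- Variable i : Fin v stands for the power sum p_{i+1}.

data Poly (v : ℕ) : Set where
  con  : ℚ → Poly v
  var  : Fin v → Poly v
  _⊕_  : Poly v → Poly v → Poly v
  _⊗_  : Poly v → Poly v → Poly v

evalℚ : {v : ℕ} → (Fin v → ℚ) → Poly v → ℚ
evalℚ ρ (con c) = c
evalℚ ρ (var i) = ρ i
evalℚ ρ (P ⊕ Q) = evalℚ ρ P ℚ.+ evalℚ ρ Q
evalℚ ρ (P ⊗ Q) = evalℚ ρ P ℚ.* evalℚ ρ Q

-- P expresses s_λ in the power sums p_1,…,p_n (n = |λ|): as polynomials
-- in n variables x_1,…,x_n, s_λ(x) = P(p_1(x),…,p_n(x)).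
-- (Equality of polynomial functions on ℚ^n, ℚ infinite, is polynomial
-- equality; p_1,…,p_n are algebraically independent in n variables,
-- so such P is unique as a polynomial.)
Represents : (λ' : List ℕ) → Poly (sum λ') → Set
Represents λ' P = (x : Fin (sum λ') → ℚ) →
  evalℚ (λ i → powerSum (suc (toℕ i)) (sum λ') x) P ≡ schur λ' (sum λ') x

-- Polynomials in the indeterminate E with ℚ coefficients, as coefficient
-- lists (index k = coefficient of E^k).

PolyE : Set
PolyE = List ℚ

addE : PolyE → PolyE → PolyE
addE [] q = q
addE (a ∷ p) [] = a ∷ p
addE (a ∷ p) (b ∷ q) = (a ℚ.+ b) ∷ addE p q

scaleE : ℚ → PolyE → PolyE
scaleE c = map (c ℚ.*_)

mulE : PolyE → PolyE → PolyE
mulE [] q = []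
mulE (a ∷ p) q = addE (scaleE a q) (0ℚ ∷ mulE p q)

substP : {v : ℕ} → (ℕ → PolyE) → Poly v → PolyE
substP a (con c) = c ∷ []
substP a (var i) = a (suc (toℕ i))
substP a (P ⊕ Q) = addE (substP a P) (substP a Q)
substP a (P ⊗ Q) = mulE (substP a P) (substP a Q)

signℚ : ℕ → ℚ
signℚ zero = 1ℚ
signℚ (suc j) = ℚ.- signℚ j

-- The three specializations; argument k is the power-sum index.
-- p_{2j+1} = (-1)^j E in all three; p_{2j} = 0, (-1)^j, (-1)^{j+1} resp.
half : ℕ → ℕ
half k = k ℕ./ 2

specOdd : ℕ → PolyE
specOdd k = if isOdd k then 0ℚ ∷ signℚ (half k) ∷ [] else []

specAlt : ℕ → PolyE
specAlt k = if isOdd k then 0ℚ ∷ signℚ (half k) ∷ [] else signℚ (half k) ∷ []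

specRalt : ℕ → PolyE
specRalt k = if isOdd k then 0ℚ ∷ signℚ (half k) ∷ [] else signℚ (suc (half k)) ∷ []

-- Euler numbers: Σ E_n x^n/n! = sec x + tan x, i.e. (multiplying by cos x)
-- (Σ E_n x^n/n!)·cos x = 1 + sin x. Comparing coefficients of x^n/n!:
--   Σ_{k ≤ n} C(n,k) E_k c_{n-k} = [n=0] + s_n,
-- where cos x = Σ c_m x^m/m!, sin x = Σ s_m x^m/m!. Since c_0 = 1 this
-- determines E_n from E_0,…,E_{n-1}.

signℤ : ℕ → ℤ
signℤ zero = + 1
signℤ (suc j) = ℤ.- signℤ j

cosC : ℕ → ℤ
cosC m = if isOdd m then + 0 else signℤ (half m)

sinC : ℕ → ℤ
sinC m = if isOdd m then signℤ (half m) else + 0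

δ0 : ℕ → ℤ
δ0 zero = + 1
δ0 (suc _) = + 0

ℤsum : List ℤ → ℤ
ℤsum = foldr ℤ._+_ (+ 0)

nextEuler : ℕ → List ℤ → ℤ
nextEuler n es = (δ0 n ℤ.+ sinC n) ℤ.-
  ℤsum (map (λ { (k , e) → (+ (n C k)) ℤ.* e ℤ.* cosC (n ∸ k) }) (zip (upTo n) es))

eulers : ℕ → List ℤ
eulers zero = []
eulers (suc n) = eulers n ++ (nextEuler n (eulers n) ∷ [])

euler : ℕ → ℤ
euler n = nextEuler n (eulers n)

umbral : PolyE → ℚ
umbral p = ℚsum (map (λ { (k , c) → c ℚ.* (euler k / 1) }) (zip (upTo (length p)) p))

ℕtoℚ : ℕ → ℚ
ℕtoℚ n = + n / 1

{-# OPTIONS --safe #-}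

-- s_λ is the Jacobi–Trudi determinant in the h_k, and h_k is a polynomial in the power sums by Newton's
-- identities. Adding t^k to every power sum p_k turns s_λ into Σ_μ t^|λ/μ| s_μ, summed over the horizontal
-- strips λ/μ; applied to one variable after the other this recovers the tableau definition of s_λ.
--
-- For t = i the same operation translates E by i, and the three specializations are linked by
-- [E,1,−E,−1,…] ↦ [E+i,0,−(E+i),0,…] and [E,0,−E,0,…] ↦ [E+i,−1,−(E+i),1,…]. Umbrally, the translation acts by
-- e^{ix} sec x = 1 + i tan x and e^{ix} tan x = i sec x − i e^{ix}. On the other side, removing horizontal strips
-- with weight i per box from standard tableaux with alternating descents telescopes, box by box, to the same
-- equations, which determine the counts recursively.
--
-- The value does not depend on the chosen expression P: if F(p_1(x),…,p_n(x)) = 0 for all x with distinct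
-- coordinates, then the gradient of F vanishes there as well by Vandermonde, and F = 0 by induction on the degree.

module Submission where

open import Defs
open import Algebra.Bundles using (CommutativeRing)
open import Algebra.Solver.Ring.AlmostCommutativeRing using (AlmostCommutativeRing; _-Raw-AlmostCommutative⟶_)
import Algebra.Solver.Ring as RingSolver
open import Algebra.Structures using (IsCommutativeSemiring)
open import Algebra.Structures.Biased using (isCommutativeSemiringˡ)
open import Data.Bool using (Bool; true; false; if_then_else_; _∧_; _∨_; not; _xor_)
open import Data.Bool.ListAction using (all; any)
open import Data.Bool.Properties using (∧-comm; ∧-assoc; ∧-zeroʳ; ∧-identityʳ)
open import Data.Empty using (⊥-elim)
open import Data.Fin as Fin using (Fin; zero; suc; toℕ; fromℕ<)
import Data.Fin.Properties as Finₚ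
open import Data.Integer as ℤ using (ℤ)
import Data.Integer.Properties as ℤₚ
open import Data.List using (List; []; _∷_; map; length; _++_; _∷ʳ_; concat; upTo; applyUpTo; zip; tabulate; allFin)
open import Data.List.Properties using (length-map; length-++; length-tabulate; map-++; map-∘; map-cong; map-tabulate; ++-assoc; ++-identityʳ; upTo-∷ʳ)
open import Data.List.Relation.Binary.Pointwise as PW using (Pointwise; []; _∷_)
open import Data.List.Relation.Unary.All as All using (All; []; _∷_)
import Data.List.Relation.Unary.All.Properties as Allₚ
open import Data.List.Relation.Unary.AllPairs using (AllPairs; []; _∷_)
import Data.List.Relation.Unary.AllPairs.Properties as AllPairsₚ
open import Data.Maybe using (Maybe; just; nothing)
open import Data.Nat as ℕ using (ℕ; zero; suc; _≤_; _<_; z≤n; s≤s; _≤ᵇ_; _<ᵇ_; _≡ᵇ_; _∸_; _%_)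
open import Data.Nat.Combinatorics using (_C_; nCn≡1; nCk+nC[k+1]≡[n+1]C[k+1]; k>n⇒nCk≡0)
open import Data.Nat.Coprimality using (1-coprimeTo) renaming (sym to coprime-sym)
open import Data.Nat.DivMod using (m/n≡1+[m∸n]/n)
open import Data.Nat.Induction using (<-rec)
open import Data.Nat.ListAction using (sum)
import Data.Nat.Properties as ℕₚ
open import Data.Product using (Σ; _×_; _,_; proj₁; proj₂; ∃)
open import Data.Rational as ℚ using (ℚ; 0ℚ; 1ℚ; mkℚ)
import Data.Rational.Properties as ℚₚ
open import Data.Unit using (⊤; tt)
open import Function using (_∘_; const)
open import Relation.Binary using (tri<; tri≈; tri>)
open import Relation.Binary.PropositionalEquality
open import Relation.Nullary using (yes; no; ¬_)
open import Relation.Nullary.Reflects using (ofʸ; ofⁿ)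
open ≡-Reasoning

-- Commutative ℚ-algebras

-- Umbral evaluation is linear in the powers of E but not multiplicative, so identities between
-- Schur functions cannot be applied after it. They are proved with E replaced by a rational number
-- r; coefficient lists that agree at every r agree under every linear functional, in particular
-- under the umbral one. Coefficient lists and polynomial expressions obey the ring laws only up to
-- trailing zeros or normal form. Hence the determinant is defined over bare operations (`Ops`),
-- laws are required only in a `ℚAlgebra`, and evaluation maps connect the two. The recursion closes
-- by parity. In each specialization s_λ has the parity of |λ| as a polynomial in E, so sec
-- contributes to even sizes only and tan to odd sizes only. The function compared with the counts
-- is thus known on one parity class and its strip sum on the other, and the strip operator is
-- unitriangular. The weight i serves twice: its powers follow the sign pattern of the
-- specializations, and i² = -1 is the cancellation in the telescoping sum.

record Ops : Set₁ where
  infixl 7 _*_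
  infixl 6 _+_
  field
    Carrier : Set
    _+_ _*_ : Carrier → Carrier → Carrier
    ι     : ℚ → Carrier

  0# 1# : Carrier
  0# = ι 0ℚ
  1# = ι 1ℚ

  infix 8 -_
  infixl 6 _-_
  -- Negation is multiplication by the scalar -1, so every `Hom` respects it by `φ-*` and `φ-ι`.
  -- This is why ring identities below spell a negated term as `:con (ℚ.- 1ℚ) :*`.
  -_ : Carrier → Carrier
  - x = ι (ℚ.- 1ℚ) * x

  _-_ : Carrier → Carrier → Carrier
  x - y = x + - y

  infixr 8 _^_
  _^_ : Carrier → ℕ → Carrier
  x ^ zero = 1#
  x ^ suc k = x * x ^ k

record ℚAlgebra : Set₁ where
  field
    ops : Ops
  open Ops ops public
  field
    +-assoc     : ∀ x y z → (x + y) + z ≡ x + (y + z)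
    +-comm      : ∀ x y → x + y ≡ y + x
    +-identityˡ : ∀ x → 0# + x ≡ x
    *-assoc     : ∀ x y z → (x * y) * z ≡ x * (y * z)
    *-comm      : ∀ x y → x * y ≡ y * x
    *-identityˡ : ∀ x → 1# * x ≡ x
    distribʳ    : ∀ x y z → (y + z) * x ≡ y * x + z * x
    zeroˡ       : ∀ x → 0# * x ≡ 0#
    ι-+       : ∀ a b → ι (a ℚ.+ b) ≡ ι a + ι b
    ι-*       : ∀ a b → ι (a ℚ.* b) ≡ ι a * ι b

  ι-neg : ∀ q → ι (ℚ.- q) ≡ - ι q
  ι-neg q = trans (cong ι (trans (cong ℚ.-_ (sym (ℚₚ.*-identityˡ q))) (ℚₚ.neg-distribˡ-* 1ℚ q))) (ι-* _ q)

  private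
    -‿distrib : ∀ x y → - x * y ≡ - (x * y)
    -‿distrib x y = *-assoc _ x y

    distribˡ : ∀ x y z → x * (y + z) ≡ x * y + x * z
    distribˡ x y z = trans (*-comm x _) (trans (distribʳ x y z) (cong₂ _+_ (*-comm y x) (*-comm z x)))

    isCSR : IsCommutativeSemiring _≡_ _+_ _*_ 0# 1#
    isCSR = isCommutativeSemiringˡ record
      { +-isCommutativeMonoid = record
          { isMonoid = record
              { isSemigroup = record
                  { isMagma = record { isEquivalence = isEquivalence ; ∙-cong = cong₂ _+_ }
                  ; assoc = +-assoc }
              ; identity = +-identityˡ , λ x → trans (+-comm x _) (+-identityˡ x) }
          ; comm = +-comm }
      ; *-isCommutativeMonoid = record
          { isMonoid = record
              { isSemigroup = record
                  { isMagma = record { isEquivalence = isEquivalence ; ∙-cong = cong₂ _*_ }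
                  ; assoc = *-assoc }
              ; identity = *-identityˡ , λ x → trans (*-comm x _) (*-identityˡ x) }
          ; comm = *-comm }
      ; distribʳ = distribʳ
      ; zeroˡ = zeroˡ
      }

    acr : AlmostCommutativeRing _ _
    acr = record
      { isAlmostCommutativeRing = record
          { isCommutativeSemiring = isCSR
          ; -‿cong = λ { refl → refl }
          ; -‿*-distribˡ = -‿distrib
          ; -‿+-comm = λ x y → sym (distribˡ _ x y) } }

    morphism : CommutativeRing.rawRing ℚₚ.+-*-commutativeRing -Raw-AlmostCommutative⟶ acr
    morphism = record
      { ⟦_⟧ = ι
      ; +-homo = ι-+
      ; *-homo = ι-*
      ; -‿homo = ι-neg
      ; 0-homo = refl
      ; 1-homo = refl }

    coeff≟ : ∀ a b → Maybe (ι a ≡ ι b)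
    coeff≟ a b with a ℚₚ.≟ b
    ... | yes p = just (cong ι p)
    ... | no _ = nothing

  module Solver = RingSolver (CommutativeRing.rawRing ℚₚ.+-*-commutativeRing) acr morphism coeff≟
    renaming (con to :con)

  +-identityʳ : ∀ x → x + 0# ≡ x
  +-identityʳ x = trans (+-comm x _) (+-identityˡ x)

  *-identityʳ : ∀ x → x * 1# ≡ x
  *-identityʳ x = trans (*-comm x _) (*-identityˡ x)

  zeroʳ : ∀ x → x * 0# ≡ 0#
  zeroʳ x = trans (*-comm x _) (zeroˡ x)

  open Solver

  x-x≡0 : ∀ x → x - x ≡ 0#
  x-x≡0 = solve 1 (λ x → x :- x := :con 0ℚ) refl

  x-y≡0⇒x≡y : ∀ {x y} → x - y ≡ 0# → x ≡ y
  x-y≡0⇒x≡y {x} {y} e = trans (solve 2 (λ x y → x := (x :- y) :+ y) refl x y) (trans (cong (_+ y) e) (+-identityˡ y))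


ℚ-ops : Ops
ℚ-ops = record { Carrier = ℚ ; _+_ = ℚ._+_ ; _*_ = ℚ._*_ ; ι = λ q → q }

ℚ-algebra : ℚAlgebra
ℚ-algebra = record
  { ops = ℚ-ops
  ; +-assoc = ℚₚ.+-assoc
  ; +-comm = ℚₚ.+-comm
  ; +-identityˡ = ℚₚ.+-identityˡ
  ; *-assoc = ℚₚ.*-assoc
  ; *-comm = ℚₚ.*-comm
  ; *-identityˡ = ℚₚ.*-identityˡ
  ; distribʳ = ℚₚ.*-distribʳ-+
  ; zeroˡ = ℚₚ.*-zeroˡ
  ; ι-+ = λ _ _ → refl
  ; ι-* = λ _ _ → refl
  }

-- ℚ[θ]/(θ² − d): the Gaussian rationals for d = −1, the dual numbers for d = 0.
record Quad (d : ℚ) : Set where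
  constructor _+θ_
  field
    re im : ℚ
open Quad public

module _ (d : ℚ) where
  private
    module Q = ℚAlgebra ℚ-algebra
    open Q.Solver
    open import Data.Rational using (_+_; _*_)

  quad-ops : Ops
  quad-ops = record
    { Carrier = Quad d
    ; _+_ = λ x y → (re x + re y) +θ (im x + im y)
    ; _*_ = λ x y → (re x * re y + d * (im x * im y)) +θ (re x * im y + im x * re y)
    ; ι = λ q → q +θ 0ℚ }

  quad-algebra : ℚAlgebra
  quad-algebra = record
    { ops = quad-ops
    ; +-assoc = λ x y z → cong₂ _+θ_ (ℚₚ.+-assoc (re x) (re y) (re z)) (ℚₚ.+-assoc (im x) (im y) (im z))
    ; +-comm = λ x y → cong₂ _+θ_ (ℚₚ.+-comm (re x) (re y)) (ℚₚ.+-comm (im x) (im y))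
    ; +-identityˡ = λ x → cong₂ _+θ_ (ℚₚ.+-identityˡ (re x)) (ℚₚ.+-identityˡ (im x))
    ; *-assoc = λ x y z → cong₂ _+θ_
        (solve 7 (λ a b c e f g d → (a :* c :+ d :* (b :* e)) :* f :+ d :* ((a :* e :+ b :* c) :* g)
            := a :* (c :* f :+ d :* (e :* g)) :+ d :* (b :* (c :* g :+ e :* f))) refl
          (re x) (im x) (re y) (im y) (re z) (im z) d)
        (solve 7 (λ a b c e f g d → (a :* c :+ d :* (b :* e)) :* g :+ (a :* e :+ b :* c) :* f
            := a :* (c :* g :+ e :* f) :+ b :* (c :* f :+ d :* (e :* g))) refl
          (re x) (im x) (re y) (im y) (re z) (im z) d)
    ; *-comm = λ x y → cong₂ _+θ_
        (solve 5 (λ a b c e d → a :* c :+ d :* (b :* e) := c :* a :+ d :* (e :* b)) refl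
          (re x) (im x) (re y) (im y) d)
        (solve 4 (λ a b c e → a :* e :+ b :* c := c :* b :+ e :* a) refl
          (re x) (im x) (re y) (im y))
    ; *-identityˡ = λ x → cong₂ _+θ_
        (solve 3 (λ a b d → :con 1ℚ :* a :+ d :* (:con 0ℚ :* b) := a) refl (re x) (im x) d)
        (solve 2 (λ a b → :con 1ℚ :* b :+ :con 0ℚ :* a := b) refl (re x) (im x))
    ; distribʳ = λ x y z → cong₂ _+θ_
        (solve 7 (λ a b c e f g d → (c :+ f) :* a :+ d :* ((e :+ g) :* b)
            := (c :* a :+ d :* (e :* b)) :+ (f :* a :+ d :* (g :* b))) refl
          (re x) (im x) (re y) (im y) (re z) (im z) d)
        (solve 6 (λ a b c e f g → (c :+ f) :* b :+ (e :+ g) :* a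
            := (c :* b :+ e :* a) :+ (f :* b :+ g :* a)) refl
          (re x) (im x) (re y) (im y) (re z) (im z))
    ; zeroˡ = λ x → cong₂ _+θ_
        (solve 3 (λ a b d → :con 0ℚ :* a :+ d :* (:con 0ℚ :* b) := :con 0ℚ) refl (re x) (im x) d)
        (solve 2 (λ a b → :con 0ℚ :* b :+ :con 0ℚ :* a := :con 0ℚ) refl (re x) (im x))
    ; ι-+ = λ a b → refl
    ; ι-* = λ a b → cong₂ _+θ_
        (solve 3 (λ a b d → a :* b := a :* b :+ d :* (:con 0ℚ :* :con 0ℚ)) refl a b d)
        (solve 2 (λ a b → :con 0ℚ := a :* :con 0ℚ :+ :con 0ℚ :* b) refl a b)
    }

-- Jacobi–Trudi determinants

-- Built directly in normal form: `z / 1` passes through a gcd and does not reduce for a variable z,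
-- whereas here the numerator is visible, so `natℚ (suc k)` is nonzero by computation and can be
-- inverted.
intℚ : ℤ → ℚ
intℚ z = mkℚ z 0 (coprime-sym (1-coprimeTo _))

/1≡intℚ : ∀ z → z ℚ./ 1 ≡ intℚ z
/1≡intℚ z = ℚₚ.↥p/↧p≡p (intℚ z)

intℚ-+ : ∀ a b → intℚ (a ℤ.+ b) ≡ intℚ a ℚ.+ intℚ b
intℚ-+ a b = trans (sym (/1≡intℚ _)) (cong (ℚ._/ 1) (sym (cong₂ ℤ._+_ (ℤₚ.*-identityʳ a) (ℤₚ.*-identityʳ b))))

intℚ-* : ∀ a b → intℚ (a ℤ.* b) ≡ intℚ a ℚ.* intℚ b
intℚ-* a b = sym (/1≡intℚ _)

natℚ : ℕ → ℚ
natℚ n = intℚ (ℤ.+ n)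

natℚ-suc : ∀ n → natℚ (suc n) ≡ 1ℚ ℚ.+ natℚ n
natℚ-suc n = intℚ-+ (ℤ.+ 1) (ℤ.+ n)

natℚ-inv : ∀ k → natℚ (suc k) ℚ.* (ℚ.1/ natℚ (suc k)) ≡ 1ℚ
natℚ-inv k = ℚₚ.*-inverseʳ (natℚ (suc k))

data Positive : List ℕ → Set where
  []  : Positive []
  _∷_ : ∀ {k la} → 1 ≤ k → Positive la → Positive (k ∷ la)

length≤sum : ∀ {la} → Positive la → length la ≤ sum la
length≤sum [] = z≤n
length≤sum (p ∷ ps) = ℕₚ.+-mono-≤ p (length≤sum ps)

module JacobiTrudi (O : Ops) where
  open Ops O

  Row : Set
  Row = ℕ → Carrier

  shift : Row → Row
  shift f k = f (suc k)

  -- In continuation style: `κ` receives the rows that remain after one is deleted, so the lemmas on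
  -- expansions go by induction on the rows for arbitrary `κ`. The sign (-1)^(number of rows below)
  -- is the cofactor sign of the last column.
  expand : List Row → (List Row → Carrier) → Carrier
  expand [] κ = 0#
  expand (f ∷ fs) κ = ι (signℚ (length fs)) * f 0 * κ fs + expand fs (λ gs → κ (f ∷ gs))

  -- Expansion along the last column, which has index 0; the columns are numbered from right to left.
  det : ℕ → List Row → Carrier
  det zero [] = 1#
  det zero (_ ∷ _) = 0#
  det (suc n) fs = expand fs (λ gs → det n (map shift gs))

  -- The entry at k is h_{a-k}, with h of a negative index equal to 0; truncated subtraction would
  -- produce h_0 there. With columns numbered from the right, `rows` is the Jacobi-Trudi matrix
  -- (h_{λ_i - i + j}), and `shift` of a row with index a + 1 computes to the row with index a.
  row : (ℕ → Carrier) → ℕ → Row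
  row h a zero = h a
  row h zero (suc k) = 0#
  row h (suc a) (suc k) = row h a k

  rows : (ℕ → Carrier) → List ℕ → List Row
  rows h [] = []
  rows h (k ∷ la) = row h (k ℕ.+ length la) ∷ rows h la

  dot : (ℕ → Carrier) → ℕ → List Carrier → Carrier
  dot a j [] = 0#
  dot a j (h ∷ hs) = a j * h + dot a (suc j) hs

  -- Newton's identity k h_k = Σ_{1≤j≤k} p_j h_{k-j}, read as a recursion for h in terms of the power sums a.
  homs : (ℕ → Carrier) → ℕ → List Carrier
  hom : (ℕ → Carrier) → ℕ → Carrier
  homs a zero = hom a zero ∷ []
  homs a (suc k) = hom a (suc k) ∷ homs a k
  hom a zero = 1#
  hom a (suc k) = ι (ℚ.1/ natℚ (suc k)) * dot a 1 (homs a k)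

  -- This is s_λ[a 1, a 2, ...], the Schur function with p_k replaced by `a k`.
  S : (ℕ → Carrier) → List ℕ → Carrier
  S a la = det (length la) (rows (hom a) la)

  expand-cong : ∀ {fs gs κ κ′} → Pointwise _≗_ fs gs →
                (∀ {l l′} → Pointwise _≗_ l l′ → κ l ≡ κ′ l′) → expand fs κ ≡ expand gs κ′
  expand-cong [] κ≡ = refl
  expand-cong (_∷_ {xs = fs} {ys = gs} p ps) κ≡ = cong₂ _+_
    (cong₂ _*_ (cong₂ _*_ (cong (ι ∘ signℚ) (PW.Pointwise-length ps)) (p 0)) (κ≡ ps))
    (expand-cong ps (λ q → κ≡ (p ∷ q)))

  det-cong : ∀ n {fs gs} → Pointwise _≗_ fs gs → det n fs ≡ det n gs
  det-cong zero [] = refl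
  det-cong zero (_ ∷ _) = refl
  det-cong (suc n) ps = expand-cong ps (λ q → det-cong n (PW.map⁺ _ _ (PW.map (λ e k → e (suc k)) q)))

  ≗-refl : ∀ {fs : List Row} → Pointwise _≗_ fs fs
  ≗-refl = PW.refl (λ _ → refl)

  row-cong : ∀ {h h′ N} → (∀ k → k ≤ N → h k ≡ h′ k) → ∀ a → a ≤ N → row h a ≗ row h′ a
  row-cong e a a≤N zero = e a a≤N
  row-cong e zero a≤N (suc k) = refl
  row-cong e (suc a) a≤N (suc k) = row-cong e a (ℕₚ.≤-trans (ℕₚ.n≤1+n a) a≤N) k

  dot-cong : ∀ {a b N} → (∀ k → 1 ≤ k → k ≤ N → a k ≡ b k) → ∀ j l → 1 ≤ j → j ℕ.+ length l ≤ suc N → dot a j l ≡ dot b j l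
  dot-cong e j [] _ _ = refl
  dot-cong {N = N} e j (h ∷ l) 1≤j le = cong₂ _+_ (cong (_* h) (e j 1≤j (ℕₚ.≤-trans (ℕₚ.m≤m+n j (length l)) (ℕₚ.≤-pred le′))))
    (dot-cong e (suc j) l (s≤s z≤n) le′)
    where
    le′ : suc j ℕ.+ length l ≤ suc N
    le′ = subst (_≤ suc N) (ℕₚ.+-suc j (length l)) le

  length-homs : ∀ a k → length (homs a k) ≡ suc k
  length-homs a zero = refl
  length-homs a (suc k) = cong suc (length-homs a k)

  homs-cong : ∀ {a b N} → (∀ k → 1 ≤ k → k ≤ N → a k ≡ b k) → ∀ k → k ≤ N → homs a k ≡ homs b k
  hom-cong : ∀ {a b N} → (∀ k → 1 ≤ k → k ≤ N → a k ≡ b k) → ∀ k → k ≤ N → hom a k ≡ hom b k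
  homs-cong e zero _ = refl
  homs-cong e (suc k) le = cong₂ _∷_ (hom-cong e (suc k) le) (homs-cong e k (ℕₚ.≤-trans (ℕₚ.n≤1+n k) le))
  hom-cong e zero _ = refl
  hom-cong {a} {b} e (suc k) le = cong (_ *_) (trans
    (dot-cong e 1 (homs a k) (s≤s z≤n) (s≤s (subst (_≤ _) (sym (length-homs a k)) le)))
    (cong (dot b 1) (homs-cong e k (ℕₚ.≤-trans (ℕₚ.n≤1+n k) le))))

  S-cong : ∀ {a b} → (∀ k → a k ≡ b k) → ∀ la → S a la ≡ S b la
  S-cong e la = det-cong (length la) (go la)
    where
    go : ∀ la → Pointwise _≗_ (rows (hom _) la) (rows (hom _) la)
    go [] = []
    go (k ∷ la) = row-cong {N = k ℕ.+ length la} (λ j _ → hom-cong {N = j} (λ i _ _ → e i) j ℕₚ.≤-refl) _ ℕₚ.≤-refl ∷ go la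

  -- The largest index in the row of a part k is k plus the number of parts below it. Each of those
  -- is at least 1, so the index is at most |λ|, and h up to that index involves only p_1, ...,
  -- p_|λ|.
  S-local : ∀ {a b} la → Positive la → (∀ k → 1 ≤ k → k ≤ sum la → a k ≡ b k) → S a la ≡ S b la
  S-local {a} {b} la pos e = det-cong (length la) (go la pos ℕₚ.≤-refl)
    where
    go : ∀ μ → Positive μ → sum μ ≤ sum la → Pointwise _≗_ (rows (hom a) μ) (rows (hom b) μ)
    go [] _ _ = []
    go (k ∷ μ) (p ∷ ps) le =
      row-cong (hom-cong e) _ (ℕₚ.≤-trans (ℕₚ.+-monoʳ-≤ k (length≤sum ps)) le)
      ∷ go μ ps (ℕₚ.≤-trans (ℕₚ.m≤n+m (sum μ) k) le)

-- Naturality of Jacobi-Trudi under homomorphisms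

record Hom (O P : Ops) : Set where
  private
    module O = Ops O
    module P = Ops P
  field
    φ   : O.Carrier → P.Carrier
    φ-+ : ∀ x y → φ (x O.+ y) ≡ φ x P.+ φ y
    φ-* : ∀ x y → φ (x O.* y) ≡ φ x P.* φ y
    φ-ι : ∀ q → φ (O.ι q) ≡ P.ι q

module HomS {O P : Ops} (H : Hom O P) where
  open Hom H
  private
    module O = Ops O
    module P = Ops P
    module JO = JacobiTrudi O
    module JP = JacobiTrudi P

  φ-^ : ∀ x k → φ (x O.^ k) ≡ φ x P.^ k
  φ-^ x zero = φ-ι _
  φ-^ x (suc k) = trans (φ-* _ _) (cong (φ x P.*_) (φ-^ x k))

  expand-hom : ∀ fs {κ κ′} → (∀ gs → φ (κ gs) ≡ κ′ (map (φ ∘_) gs)) →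
               φ (JO.expand fs κ) ≡ JP.expand (map (φ ∘_) fs) κ′
  expand-hom [] e = φ-ι _
  expand-hom (f ∷ fs) e = trans (φ-+ _ _) (cong₂ P._+_
    (trans (φ-* _ _) (cong₂ P._*_
      (trans (φ-* _ _) (cong (P._* φ (f 0)) (trans (φ-ι _) (cong (P.ι ∘ signℚ) (sym (length-map _ fs))))))
      (e fs)))
    (expand-hom fs (λ gs → e (f ∷ gs))))

  det-hom : ∀ n fs → φ (JO.det n fs) ≡ JP.det n (map (φ ∘_) fs)
  det-hom zero [] = φ-ι _
  det-hom zero (_ ∷ _) = φ-ι _
  det-hom (suc n) fs = expand-hom fs λ gs → trans (det-hom n (map JO.shift gs))
    (cong (JP.det n) (trans (sym (map-∘ gs)) (map-∘ gs)))

  dot-hom : ∀ {a} j l → φ (JO.dot a j l) ≡ JP.dot (φ ∘ a) j (map φ l)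
  dot-hom j [] = φ-ι _
  dot-hom j (h ∷ l) = trans (φ-+ _ _) (cong₂ P._+_ (φ-* _ _) (dot-hom (suc j) l))

  homs-hom : ∀ a k → map φ (JO.homs a k) ≡ JP.homs (φ ∘ a) k
  hom-hom : ∀ a k → φ (JO.hom a k) ≡ JP.hom (φ ∘ a) k
  homs-hom a zero = cong (_∷ []) (φ-ι _)
  homs-hom a (suc k) = cong₂ _∷_ (hom-hom a (suc k)) (homs-hom a k)
  hom-hom a zero = φ-ι _
  hom-hom a (suc k) = trans (φ-* _ _) (cong₂ P._*_ (φ-ι _)
    (trans (dot-hom 1 (JO.homs a k)) (cong (JP.dot _ 1) (homs-hom a k))))

  row-hom : ∀ {h h′} → (∀ k → φ (h k) ≡ h′ k) → ∀ a k → φ (JO.row h a k) ≡ JP.row h′ a k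
  row-hom e a zero = e a
  row-hom e zero (suc k) = φ-ι _
  row-hom e (suc a) (suc k) = row-hom e a k

  S-hom : ∀ a la → φ (JO.S a la) ≡ JP.S (φ ∘ a) la
  S-hom a la = trans (det-hom (length la) _) (JP.det-cong (length la) (go la))
    where
    go : ∀ la → Pointwise _≗_ (map (φ ∘_) (JO.rows (JO.hom a) la)) (JP.rows (JP.hom (φ ∘ a)) la)
    go [] = []
    go (k ∷ la) = row-hom (hom-hom a) _ ∷ go la

-- Partitions and horizontal strips

hd : List ℕ → ℕ
hd [] = 0
hd (k ∷ _) = k

-- The bound makes tails inductive: `Dec k post` says that `post` may stand below a row of length k.
-- Parts equal to 0 are allowed, because removing boxes keeps the number of rows fixed.
Dec : ℕ → List ℕ → Set
Dec b [] = ⊤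
Dec b (k ∷ la) = k ≤ b × Dec k la

Dec-hd : ∀ {b c} la → Dec b la → hd la ≤ c → Dec c la
Dec-hd [] _ _ = tt
Dec-hd (k ∷ la) (_ , d) le = le , d

Dec⇒hd : ∀ {b} la → Dec b la → hd la ≤ b
Dec⇒hd [] _ = z≤n
Dec⇒hd (k ∷ la) (le , _) = le

-- Σ t^|λ/μ| f(μ) over the horizontal strips λ/μ, removing one box at a time, upper rows first.
module Strip {M : Set} (_+_ : M → M → M) (t· : M → M) (0m : M) where

  Z : (List ℕ → M) → List ℕ → M
  Zrow : (List ℕ → M) → List ℕ → ℕ → M
  Z f [] = f []
  Z f (k ∷ post) = Zrow f post k
  Zrow f post zero = Z (λ μ → f (0 ∷ μ)) post
  Zrow f post (suc k) = Z (λ μ → f (suc k ∷ μ)) post + (if hd post ≤ᵇ k then t· (Zrow f post k) else 0m)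

  -- Records which μ a strip sum reaches, as the inductions on size require. Rows are treated from
  -- the top, so each row is compared with the untouched row of λ below it: the strip condition μ_j
  -- ≥ λ_{j+1}. It keeps every μ decreasing.
  Z-cong : ∀ {f g b} la → Dec b la →
           (∀ μ → Dec b μ → length μ ≡ length la → sum μ ≤ sum la → f μ ≡ g μ) → Z f la ≡ Z g la
  Z-cong [] d e = e [] tt refl z≤n
  Z-cong {f} {g} {b} (k ∷ post) (k≤b , d) e = go k k≤b d e
    where
    go : ∀ k → k ≤ b → Dec k post →
         (∀ μ → Dec b μ → length μ ≡ suc (length post) → sum μ ≤ k ℕ.+ sum post → f μ ≡ g μ) →
         Zrow f post k ≡ Zrow g post k
    go zero le d e = Z-cong post d (λ μ dμ l s → e (0 ∷ μ) (le , dμ) (cong suc l) s)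
    go (suc k) le d e with hd post ≤ᵇ k | ℕₚ.≤ᵇ-reflects-≤ (hd post) k
    ... | true | ofʸ p = cong₂ _+_
      (Z-cong post d (λ μ dμ l s → e (suc k ∷ μ) (le , dμ) (cong suc l) (ℕₚ.+-monoʳ-≤ (suc k) s)))
      (cong t· (go k (ℕₚ.≤-trans (ℕₚ.n≤1+n k) le) (Dec-hd post d p)
        (λ μ dμ l s → e μ dμ l (ℕₚ.≤-trans s (ℕₚ.n≤1+n _)))))
    ... | false | _ = cong (_+ 0m)
      (Z-cong post d (λ μ dμ l s → e (suc k ∷ μ) (le , dμ) (cong suc l) (ℕₚ.+-monoʳ-≤ (suc k) s)))

module StripHom {M N : Set} {_+_ : M → M → M} {t· : M → M} {0m : M}
                {_+′_ : N → N → N} {t·′ : N → N} {0m′ : N} (φ : M → N)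
                (φ-+ : ∀ x y → φ (x + y) ≡ φ x +′ φ y) (φ-t : ∀ x → φ (t· x) ≡ t·′ (φ x)) (φ-0 : φ 0m ≡ 0m′) where
  private
    module M = Strip _+_ t· 0m
    module N = Strip _+′_ t·′ 0m′

  Z-hom : ∀ f la → φ (M.Z f la) ≡ N.Z (φ ∘ f) la
  Zrow-hom : ∀ f post k → φ (M.Zrow f post k) ≡ N.Zrow (φ ∘ f) post k
  Z-hom f [] = refl
  Z-hom f (k ∷ post) = Zrow-hom f post k
  Zrow-hom f post zero = Z-hom _ post
  Zrow-hom f post (suc k) with hd post ≤ᵇ k
  ... | true = trans (φ-+ _ _) (cong₂ _+′_ (Z-hom _ post) (trans (φ-t _) (cong t·′ (Zrow-hom f post k))))
  ... | false = trans (φ-+ _ _) (cong₂ _+′_ (Z-hom _ post) φ-0)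

-- Determinants and Newton's identities over a commutative ℚ-algebra

signℚ-+ : ∀ m n → signℚ (m ℕ.+ n) ≡ signℚ m ℚ.* signℚ n
signℚ-+ zero n = sym (ℚₚ.*-identityˡ _)
signℚ-+ (suc m) n = trans (cong ℚ.-_ (signℚ-+ m n)) (ℚₚ.neg-distribˡ-* (signℚ m) (signℚ n))

signℚ-square : ∀ n → signℚ n ℚ.* signℚ n ≡ 1ℚ
signℚ-square zero = refl
signℚ-square (suc n) = trans (solve 1 (λ s → :- s :* :- s := s :* s) refl (signℚ n)) (signℚ-square n)
  where open import Data.Rational.Solver
        open +-*-Solver

module JTLaws (𝔸 : ℚAlgebra) where
  open ℚAlgebra 𝔸
  open JacobiTrudi ops
  open Solver

  private
    *-congʳ : ∀ {x y z} → x ≡ y → x * z ≡ y * z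
    *-congʳ refl = refl

  sg : ℕ → Carrier
  sg k = ι (signℚ k)

  sg-suc : ∀ k → sg (suc k) ≡ - sg k
  sg-suc k = ι-neg (signℚ k)

  sg-+ : ∀ m n → sg (m ℕ.+ n) ≡ sg m * sg n
  sg-+ m n = trans (cong ι (signℚ-+ m n)) (ι-* _ _)

  sg-square : ∀ n → sg n * sg n ≡ 1#
  sg-square n = trans (sym (ι-* _ _)) (cong ι (signℚ-square n))

  ι-nat-suc : ∀ n → ι (natℚ (suc n)) ≡ 1# + ι (natℚ n)
  ι-nat-suc n = trans (cong ι (natℚ-suc n)) (ι-+ _ _)

  private
    length-mid : ∀ (fs : List Row) {f g gs} → length (fs ++ f ∷ gs) ≡ length (fs ++ g ∷ gs)
    length-mid [] = refl
    length-mid (_ ∷ fs) = cong suc (length-mid fs)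

  expand-lin : ∀ gs {κ₁ κ₂ κ₃ c} → (∀ l → κ₁ l ≡ κ₂ l + c * κ₃ l) →
               expand gs κ₁ ≡ expand gs κ₂ + c * expand gs κ₃
  expand-lin [] {c = c} e = solve 1 (λ c → :con 0ℚ := :con 0ℚ :+ c :* :con 0ℚ) refl c
  expand-lin (f ∷ fs) {κ₁} {κ₂} {κ₃} {c} e = trans
    (cong₂ _+_ (cong₂ _*_ refl (e fs)) (expand-lin fs (λ l → e (f ∷ l))))
    (solve 6 (λ s a b c x y → s :* (a :+ c :* b) :+ (x :+ c :* y) := (s :* a :+ x) :+ c :* (s :* b :+ y)) refl
       _ _ _ c _ _)

  expand-zero : ∀ gs {κ} → (∀ l → κ l ≡ 0#) → expand gs κ ≡ 0#
  expand-zero [] e = refl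
  expand-zero (f ∷ fs) e = trans (cong₂ _+_ (trans (cong₂ _*_ refl (e fs)) (zeroʳ _)) (expand-zero fs (λ l → e (f ∷ l)))) (+-identityˡ _)

  det-linear : ∀ n {f g h c} → (∀ k → f k ≡ g k + c * h k) → ∀ fs gs →
               det n (fs ++ f ∷ gs) ≡ det n (fs ++ g ∷ gs) + c * det n (fs ++ h ∷ gs)
  det-linear zero {c = c} e fs gs = trans (z fs) (sym (trans (cong₂ (λ x y → x + c * y) (z fs) (z fs))
      (solve 1 (λ c → :con 0ℚ :+ c :* :con 0ℚ := :con 0ℚ) refl c)))
    where
    z : ∀ fs {f gs} → det zero (fs ++ f ∷ gs) ≡ 0#
    z [] = refl
    z (_ ∷ _) = refl
  det-linear (suc n) {f} {g} {h} {c} e fs gs = go fs lin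
    where
    lin : ∀ fs gs → det n (map shift (fs ++ f ∷ gs)) ≡
          det n (map shift (fs ++ g ∷ gs)) + c * det n (map shift (fs ++ h ∷ gs))
    lin fs gs
      rewrite map-++ shift fs (f ∷ gs) | map-++ shift fs (g ∷ gs) | map-++ shift fs (h ∷ gs)
      = det-linear n (λ k → e (suc k)) (map shift fs) (map shift gs)
    go : ∀ fs {κ} → (∀ fs gs → κ (fs ++ f ∷ gs) ≡ κ (fs ++ g ∷ gs) + c * κ (fs ++ h ∷ gs)) →
         expand (fs ++ f ∷ gs) κ ≡ expand (fs ++ g ∷ gs) κ + c * expand (fs ++ h ∷ gs) κ
    go [] {κ} lin = trans
      (cong₂ _+_ (cong (λ x → _ * x * κ gs) (e 0)) (expand-lin gs (lin [])))
      (solve 7 (λ s x c y k p q → s :* (x :+ c :* y) :* k :+ (p :+ c :* q)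
          := (s :* x :* k :+ p) :+ c :* (s :* y :* k :+ q)) refl
        _ _ c _ _ _ _)
    go (x ∷ fs) {κ} lin = trans
      (cong₂ _+_ (cong₂ _*_ refl (lin fs gs)) (go fs (λ fs gs → lin (x ∷ fs) gs)))
      (trans
        (solve 6 (λ s a b c x y → s :* (a :+ c :* b) :+ (x :+ c :* y) := (s :* a :+ x) :+ c :* (s :* b :+ y)) refl
          _ _ _ c _ _)
        (cong₂ (λ m m′ → (sg m * x 0 * κ (fs ++ g ∷ gs) + expand (fs ++ g ∷ gs) (λ l → κ (x ∷ l)))
                   + c * (sg m′ * x 0 * κ (fs ++ h ∷ gs) + expand (fs ++ h ∷ gs) (λ l → κ (x ∷ l))))
          (length-mid fs) (length-mid fs)))

  -- Deleting either of the two equal rows leaves the same matrix, with opposite signs; every other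
  -- term still contains both rows and vanishes by induction.
  det-alternating : ∀ n {f} fs gs → det n (fs ++ f ∷ f ∷ gs) ≡ 0#
  det-alternating zero [] gs = refl
  det-alternating zero (_ ∷ _) gs = refl
  det-alternating (suc n) {f} fs gs = go fs alternates
    where
    alternates : ∀ fs gs → det n (map shift (fs ++ f ∷ f ∷ gs)) ≡ 0#
    alternates fs gs rewrite map-++ shift fs (f ∷ f ∷ gs) = det-alternating n (map shift fs) (map shift gs)
    go : ∀ fs {κ} → (∀ fs gs → κ (fs ++ f ∷ f ∷ gs) ≡ 0#) → expand (fs ++ f ∷ f ∷ gs) κ ≡ 0#
    go [] {κ} alternates = trans
      (cong₂ (λ x y → x * f 0 * κ (f ∷ gs) + (sg (length gs) * f 0 * κ (f ∷ gs) + y))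
        (sg-suc (length gs)) (expand-zero gs (alternates [])))
      (solve 3 (λ s x k → (:con (ℚ.- 1ℚ) :* s) :* x :* k :+ (s :* x :* k :+ :con 0ℚ) := :con 0ℚ) refl _ _ _)
    go (x ∷ fs) alternates = trans
      (cong₂ _+_ (trans (cong₂ _*_ refl (alternates fs gs)) (zeroʳ _)) (go fs (λ fs gs → alternates (x ∷ fs) gs)))
      (+-identityˡ _)

  det-zero-row : ∀ n f gs → (∀ k → k < n → f k ≡ 0#) → det n (f ∷ gs) ≡ 0#
  det-zero-row zero f gs e = refl
  det-zero-row (suc n) f gs e = trans
    (cong₂ (λ x y → _ * x * _ + y) (e 0 (s≤s z≤n))
      (expand-zero gs (λ l → det-zero-row n (f ∘ suc) (map shift l) (λ k k<n → e (suc k) (s≤s k<n)))))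
    (solve 2 (λ s k → s :* :con 0ℚ :* k :+ :con 0ℚ := :con 0ℚ) refl _ _)

  module _ (h : ℕ → Carrier) (h0 : h 0 ≡ 1#) (hsuc : ∀ k → h (suc k) ≡ 0#) where
    private
      -- `R 0 l` is the Jacobi-Trudi matrix of l empty rows. In its last column only the bottom
      -- entry h_0 is nonzero; deleting that row and that column leaves the same matrix with one row
      -- fewer, so the determinant is 1.
      R : ℕ → ℕ → List Row
      R s zero = []
      R s (suc l) = row h (s ℕ.+ l) ∷ R s l

      expand-R : ∀ l κ → expand (R 0 (suc l)) κ ≡ κ (R 1 l)
      expand-R zero κ = trans (cong (λ x → sg 0 * x * κ [] + 0#) h0)
        (solve 1 (λ k → :con 1ℚ :* :con 1ℚ :* k :+ :con 0ℚ := k) refl _)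
      expand-R (suc l) κ = trans (cong₂ (λ x y → sg (length (R 0 (suc l))) * x * κ (R 0 (suc l)) + y) (hsuc l) (expand-R l (λ gs → κ (row h (suc l) ∷ gs))))
        (solve 3 (λ s k y → s :* :con 0ℚ :* k :+ y := y) refl _ _ _)

      shift-R : ∀ l → map shift (R 1 l) ≡ R 0 l
      shift-R zero = refl
      shift-R (suc l) = cong₂ _∷_ refl (shift-R l)

      det-R : ∀ l → det l (R 0 l) ≡ 1#
      det-R zero = refl
      det-R (suc l) = trans (expand-R l (λ gs → det l (map shift gs))) (trans (cong (det l) (shift-R l)) (det-R l))

      rows-R : ∀ la → Dec 0 la → rows h la ≡ R 0 (length la)
      rows-R [] _ = refl
      rows-R (zero ∷ la) (_ , d) = cong₂ _∷_ refl (rows-R la d)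

      row-zero : ∀ a k → k < a → row h a k ≡ 0#
      row-zero (suc a) zero _ = hsuc a
      row-zero (suc a) (suc k) (s≤s lt) = row-zero a k lt

    det-rows-empty : ∀ la → Dec 0 la → det (length la) (rows h la) ≡ 1#
    det-rows-empty la d = trans (cong (det (length la)) (rows-R la d)) (det-R (length la))

    -- Every entry of the first row is some h_a with a ≥ 1, hence 0.
    det-rows-nonempty : ∀ k la → det (suc (length la)) (rows h (suc k ∷ la)) ≡ 0#
    det-rows-nonempty k la = det-zero-row _ _ _ (λ j j<l → row-zero _ j (ℕₚ.≤-trans j<l (s≤s (ℕₚ.m≤n+m _ k))))

  private
    dot-zero : ∀ j l → dot (λ _ → 0#) j l ≡ 0#
    dot-zero j [] = refl
    dot-zero j (h ∷ l) = trans (cong₂ _+_ (zeroˡ h) (dot-zero (suc j) l)) (+-identityˡ _)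

    hom-zero : ∀ k → hom (λ _ → 0#) (suc k) ≡ 0#
    hom-zero k = trans (cong₂ _*_ refl (dot-zero 1 (homs _ k))) (zeroʳ _)

  S-zero-empty : ∀ la → Dec 0 la → S (λ _ → 0#) la ≡ 1#
  S-zero-empty = det-rows-empty _ refl hom-zero

  S-zero-nonempty : ∀ k la → S (λ _ → 0#) (suc k ∷ la) ≡ 0#
  S-zero-nonempty = det-rows-nonempty _ refl hom-zero

  Newton : (ℕ → Carrier) → ℕ → Carrier → List Carrier → Set
  Newton a k x hs = ι (natℚ (suc k)) * x ≡ dot a 1 hs

  hom-newton : ∀ a k → Newton a k (hom a (suc k)) (homs a k)
  hom-newton a k = begin
    ι (natℚ (suc k)) * (ι (ℚ.1/ natℚ (suc k)) * d) ≡⟨ *-assoc _ _ _ ⟨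
    ι (natℚ (suc k)) * ι (ℚ.1/ natℚ (suc k)) * d   ≡⟨ cong (_* d) (trans (sym (ι-* _ _)) (cong ι (natℚ-inv k))) ⟩
    1# * d                                         ≡⟨ *-identityˡ d ⟩
    d                                              ∎
    where d = dot a 1 (homs a k)

  newton-unique : ∀ {a k x hs} → Newton a k x hs → x ≡ ι (ℚ.1/ natℚ (suc k)) * dot a 1 hs
  newton-unique {a} {k} {x} {hs} e = begin
    x                                               ≡⟨ *-identityˡ x ⟨
    1# * x                                          ≡⟨ cong (_* x) (trans (cong ι (sym (natℚ-inv k))) (ι-* _ _)) ⟩
    ι (natℚ (suc k)) * ι (ℚ.1/ natℚ (suc k)) * x    ≡⟨ cong (_* x) (*-comm _ _) ⟩
    ι (ℚ.1/ natℚ (suc k)) * ι (natℚ (suc k)) * x    ≡⟨ *-assoc _ _ _ ⟩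
    ι (ℚ.1/ natℚ (suc k)) * (ι (natℚ (suc k)) * x)  ≡⟨ cong₂ _*_ refl e ⟩
    ι (ℚ.1/ natℚ (suc k)) * dot a 1 hs              ∎

  down : (ℕ → Carrier) → ℕ → List Carrier
  down g zero = g 0 ∷ []
  down g (suc k) = g (suc k) ∷ down g k

  homs-down : ∀ a k → homs a k ≡ down (hom a) k
  homs-down a zero = refl
  homs-down a (suc k) = cong₂ _∷_ refl (homs-down a k)

  -- The tool for computing `hom`: a proposed closed form only has to satisfy Newton's identities.
  -- The induction carries the whole descending list because each identity refers to all smaller
  -- indices.
  hom-unique : ∀ {a} g → g 0 ≡ 1# → (∀ k → Newton a k (g (suc k)) (down g k)) → ∀ k → g k ≡ hom a k
  hom-unique {a} g g0 eq = proj₁ ∘ go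
    where
    go : ∀ k → g k ≡ hom a k × down g k ≡ homs a k
    go zero = g0 , cong (_∷ []) g0
    go (suc k) = let e = trans (newton-unique {a} {k} {g (suc k)} {down g k} (eq k)) (cong (λ l → ι (ℚ.1/ natℚ (suc k)) * dot a 1 l) (proj₂ (go k))) in
      e , cong₂ _∷_ e (proj₂ (go k))

  module AddVariable (a : ℕ → Carrier) (t : Carrier) where
    a⁺ : ℕ → Carrier
    a⁺ k = a k + t ^ k

    private
      h = hom a

      -- Coefficients of H(x)/(1 - t x), where H is the generating function of h: adjoining a
      -- variable t multiplies H by 1/(1 - t x).
      g : ℕ → Carrier
      g zero = 1#
      g (suc k) = h (suc k) + t * g k

      dot-g : ∀ j k → dot a j (down g (suc k)) ≡ dot a j (down h (suc k)) + t * dot a j (down g k)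
      dot-g j zero = solve 5 (λ t x h y h′ → x :* (h :+ t :* :con 1ℚ) :+ (y :* :con 1ℚ :+ :con 0ℚ)
          := (x :* h :+ (y :* :con 1ℚ :+ :con 0ℚ)) :+ t :* (x :* :con 1ℚ :+ :con 0ℚ)) refl t (a j) (h 1) (a (suc j)) (h 0)
      dot-g j (suc k) = trans (cong₂ _+_ refl (dot-g (suc j) k))
        (solve 6 (λ t x h g y z → x :* (h :+ t :* g) :+ (y :+ t :* z) := (x :* h :+ y) :+ t :* (x :* g :+ z)) refl
          t (a j) (h (suc (suc k))) (g (suc k)) _ _)

      dot-pow : ∀ j l → dot (t ^_) (suc j) l ≡ t * dot (t ^_) j l
      dot-pow j [] = sym (zeroʳ t)
      dot-pow j (x ∷ l) = trans (cong₂ _+_ refl (dot-pow (suc j) l))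
        (solve 4 (λ t p x y → t :* p :* x :+ t :* y := t :* (p :* x :+ y)) refl t _ x _)

      dot-a⁺ : ∀ j l → dot a⁺ j l ≡ dot a j l + dot (t ^_) j l
      dot-a⁺ j [] = sym (+-identityˡ _)
      dot-a⁺ j (x ∷ l) = trans (cong₂ _+_ refl (dot-a⁺ (suc j) l))
        (solve 5 (λ a p h x y → (a :+ p) :* h :+ (x :+ y) := (a :* h :+ x) :+ (p :* h :+ y)) refl
          (a j) (t ^ j) x _ _)

      g-newton : ∀ k → Newton a⁺ k (g (suc k)) (down g k)
      g-newton zero = begin
        ι (natℚ 1) * (h 1 + t * 1#)        ≡⟨ solve 3 (λ n h t → n :* (h :+ t :* :con 1ℚ) := n :* h :+ n :* t) refl _ _ _ ⟩
        ι (natℚ 1) * h 1 + ι (natℚ 1) * t  ≡⟨ cong₂ _+_ (hom-newton a 0) (*-identityˡ t) ⟩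
        dot a 1 (1# ∷ []) + t              ≡⟨ solve 2 (λ a t → (a :* :con 1ℚ :+ :con 0ℚ) :+ t
                                                := (a :+ t :* :con 1ℚ) :* :con 1ℚ :+ :con 0ℚ) refl (a 1) t ⟩
        dot a⁺ 1 (1# ∷ [])                 ∎
      g-newton (suc k) = begin
        n * (h (suc (suc k)) + t * g (suc k))
          ≡⟨ solve 4 (λ n h t g → n :* (h :+ t :* g) := n :* h :+ t :* (n :* g)) refl n _ t _ ⟩
        n * h (suc (suc k)) + t * (n * g (suc k))
          ≡⟨ cong₂ (λ x y → x + t * (y * g (suc k))) (trans (hom-newton a (suc k)) (cong (dot a 1) (homs-down a (suc k)))) (ι-nat-suc (suc k)) ⟩
        dh + t * ((1# + m) * g (suc k))
          ≡⟨ solve 4 (λ x t m g → x :+ t :* ((:con 1ℚ :+ m) :* g) := x :+ t :* (g :+ m :* g)) refl dh t m _ ⟩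
        dh + t * (g (suc k) + m * g (suc k))
          ≡⟨ cong (λ x → dh + t * (g (suc k) + x)) (trans (g-newton k) (dot-a⁺ 1 (down g k))) ⟩
        dh + t * (g (suc k) + (dot a 1 (down g k) + dot (t ^_) 1 (down g k)))
          ≡⟨ solve 5 (λ x t g y z → x :+ t :* (g :+ (y :+ z)) := (x :+ t :* y) :+ (t :* :con 1ℚ :* g :+ t :* z)) refl dh t _ _ _ ⟩
        -- The term t·g_{k+1}, left over from (k + 2) = 1 + (k + 1), is the j = 1 term of Σ t^j
        -- g_{k+2-j}; the last summand supplies the terms with j ≥ 2.
        (dh + t * dot a 1 (down g k)) + (t * 1# * g (suc k) + t * dot (t ^_) 1 (down g k))
          ≡⟨ cong₂ _+_ (sym (dot-g 1 k)) (cong₂ _+_ refl (sym (dot-pow 1 (down g k)))) ⟩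
        dot a 1 (down g (suc k)) + dot (t ^_) 1 (down g (suc k))
          ≡⟨ dot-a⁺ 1 (down g (suc k)) ⟨
        dot a⁺ 1 (down g (suc k)) ∎
        where
        n = ι (natℚ (suc (suc k)))
        m = ι (natℚ (suc k))
        dh = dot a 1 (down h (suc k))

    h⁺ : ℕ → Carrier
    h⁺ = hom a⁺

    hom-suc : ∀ k → h⁺ (suc k) ≡ h (suc k) + t * h⁺ k
    hom-suc k = trans (sym (hom-unique g refl g-newton (suc k))) (cong (λ x → _ + t * x) (hom-unique g refl g-newton k))

    row-suc : ∀ b k → row h⁺ (suc b) k ≡ row h (suc b) k + t * row h⁺ b k
    row-suc b zero = hom-suc b
    row-suc zero (suc zero) = solve 1 (λ t → :con 1ℚ := :con 1ℚ :+ t :* :con 0ℚ) refl t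
    row-suc zero (suc (suc k)) = solve 1 (λ t → :con 0ℚ := :con 0ℚ :+ t :* :con 0ℚ) refl t
    row-suc (suc b) (suc k) = row-suc b k

    row-zero≗ : row h⁺ 0 ≗ row h 0
    row-zero≗ zero = refl
    row-zero≗ (suc k) = refl

    open Strip _+_ (t *_) 0#

    -- When two adjacent shifted parts of the new rows coincide the determinant vanishes: this is
    -- what confines the removed boxes to a horizontal strip.
    jt-branch : ∀ n fs la {b} → Dec b la → det n (fs ++ rows h⁺ la) ≡ Z (λ μ → det n (fs ++ rows h μ)) la
    jt-branch-row : ∀ n fs post k → Dec k post →
      det n (fs ++ row h⁺ (k ℕ.+ length post) ∷ rows h⁺ post) ≡ Zrow (λ μ → det n (fs ++ rows h μ)) post k

    jt-branch n fs [] d = refl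
    jt-branch n fs (k ∷ post) (_ , d) = jt-branch-row n fs post k d

    private
      keep-row : ∀ n fs post k → Dec k post →
        det n (fs ++ row h (k ℕ.+ length post) ∷ rows h⁺ post) ≡ Z (λ μ → det n (fs ++ rows h (k ∷ μ))) post
      keep-row n fs post k d = begin
        det n (fs ++ r ∷ rows h⁺ post)          ≡⟨ cong (det n) (++-assoc fs (r ∷ []) _) ⟨
        det n ((fs ++ r ∷ []) ++ rows h⁺ post)  ≡⟨ jt-branch n (fs ++ r ∷ []) post d ⟩
        Z (λ μ → det n ((fs ++ r ∷ []) ++ rows h μ)) post
          ≡⟨ Z-cong post d (λ μ _ l _ → cong (det n) (trans (++-assoc fs (r ∷ []) _)
                (cong (λ m → fs ++ row h (k ℕ.+ m) ∷ rows h μ) (sym l)))) ⟩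
        Z (λ μ → det n (fs ++ rows h (k ∷ μ))) post ∎
        where r = row h (k ℕ.+ length post)

      replace-row : ∀ n fs {r r′} gs → r ≗ r′ → det n (fs ++ r ∷ gs) ≡ det n (fs ++ r′ ∷ gs)
      replace-row n fs gs e = det-cong n (PW.++⁺ ≗-refl (e ∷ ≗-refl))

    jt-branch-row n fs [] zero d = trans (replace-row n fs [] row-zero≗) (keep-row n fs [] zero d)
    jt-branch-row n fs (zero ∷ post) zero d = trans
      (det-linear n (row-suc (length post)) fs _)
      (trans (cong₂ (λ x y → x + t * y) (keep-row n fs (zero ∷ post) zero d) (det-alternating n fs _))
        (solve 2 (λ x t → x :+ t :* :con 0ℚ := x) refl _ t))
    jt-branch-row n fs post (suc k) d with hd post ≤ᵇ k | ℕₚ.≤ᵇ-reflects-≤ (hd post) k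
    ... | true | ofʸ p = trans (det-linear n (row-suc (k ℕ.+ length post)) fs _)
      (cong₂ (λ x y → x + t * y) (keep-row n fs post (suc k) d) (jt-branch-row n fs post k (Dec-hd post d p)))
    ... | false | ofⁿ ¬p = trans (det-linear n (row-suc (k ℕ.+ length post)) fs _)
      (cong₂ _+_ (keep-row n fs post (suc k) d) (trans (cong (t *_) (vanish post d ¬p)) (zeroʳ t)))
      where
      vanish : ∀ post → Dec (suc k) post → ¬ hd post ≤ k →
               det n (fs ++ row h⁺ (k ℕ.+ length post) ∷ rows h⁺ post) ≡ 0#
      vanish [] d ¬p = ⊥-elim (¬p z≤n)
      vanish (p ∷ post) (p≤ , _) ¬p = trans
        (cong (λ m → det n (fs ++ row h⁺ m ∷ rows h⁺ (p ∷ post)))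
          (trans (ℕₚ.+-suc k (length post)) (cong (ℕ._+ length post) (sym p≡))))
        (det-alternating n fs _)
        where
        p≡ : p ≡ suc k
        p≡ = ℕₚ.≤-antisym p≤ (ℕₚ.≰⇒> ¬p)

    S-branch : ∀ la {b} → Dec b la → S a⁺ la ≡ Z (S a) la
    S-branch la d = trans (jt-branch (length la) [] la d)
      (Z-cong la d (λ μ _ l _ → cong (λ n → det n (rows h μ)) (sym l)))

  open AddVariable public using (S-branch)

  -- Homogeneity: the sign change p_k ↦ (-1)^k p_k

  private
    prod : List Carrier → Carrier
    prod [] = 1#
    prod (d ∷ ds) = d * prod ds

    colprod : (ℕ → Carrier) → ℕ → Carrier
    colprod c zero = 1#
    colprod c (suc n) = c 0 * colprod (c ∘ suc) n

    Scaled : Set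
    Scaled = Carrier × Row

    scaled : (ℕ → Carrier) → Scaled → Row
    scaled c (d , f) k = d * c k * f k

    -- `q` collects the factors of the rows that the expansion has already passed and handed to the
    -- continuation.
    expand-scaled : ∀ c (ds : List Scaled) {κ κ′ q} →
      (∀ l → κ′ (map (scaled c) l) ≡ q * prod (map proj₁ l) * κ (map proj₂ l)) →
      expand (map (scaled c) ds) κ′ ≡ c 0 * q * prod (map proj₁ ds) * expand (map proj₂ ds) κ
    expand-scaled c [] e = sym (zeroʳ _)
    expand-scaled c ((d , f) ∷ ds) {κ} {κ′} {q} e = trans
      (cong₂ _+_
        (cong₂ (λ m x → sg m * (d * c 0 * f 0) * x) (trans (length-map _ ds) (sym (length-map proj₂ ds))) (e ds))
        (expand-scaled c ds {λ l → κ (f ∷ l)} {λ l → κ′ (scaled c (d , f) ∷ l)} {q * d}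
          (λ l → trans (e ((d , f) ∷ l)) (*-congʳ (sym (*-assoc _ _ _))))))
      (solve 8 (λ s d c f q p k x → s :* (d :* c :* f) :* (q :* p :* k) :+ c :* (q :* d) :* p :* x
          := c :* q :* (d :* p) :* (s :* f :* k :+ x)) refl
        _ d (c 0) (f 0) q _ _ _)

    det-scaled : ∀ n c ds → det n (map (scaled c) ds) ≡ colprod c n * prod (map proj₁ ds) * det n (map proj₂ ds)
    det-scaled zero c [] = solve 0 (:con 1ℚ := :con 1ℚ :* :con 1ℚ :* :con 1ℚ) refl
    det-scaled zero c (_ ∷ _) = sym (zeroʳ _)
    det-scaled (suc n) c ds = expand-scaled c ds λ l → trans
      (cong (det n) (trans (sym (map-∘ l)) (map-∘ l)))
      (trans (det-scaled n (c ∘ suc) (map (λ (d , f) → d , f ∘ suc) l))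
        (cong₂ (λ x y → colprod (c ∘ suc) n * prod x * det n y)
          (sym (map-∘ l)) (trans (sym (map-∘ l)) (map-∘ l))))

    row-signed : ∀ {h h′} → (∀ k → h′ k ≡ sg k * h k) → ∀ a k → row h′ a k ≡ sg a * sg k * row h a k
    row-signed e a zero = trans (e a) (*-congʳ (sym (*-identityʳ _)))
    row-signed e zero (suc k) = sym (zeroʳ _)
    row-signed e (suc a) (suc k) = trans (row-signed e a k)
      (trans (solve 3 (λ x y r → x :* y :* r := (:con (ℚ.- 1ℚ) :* x) :* (:con (ℚ.- 1ℚ) :* y) :* r) refl _ _ _)
        (cong₂ _*_ (cong₂ _*_ (sym (sg-suc a)) (sym (sg-suc k))) refl))

    items : (ℕ → Carrier) → List ℕ → List Scaled
    items h [] = []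
    items h (k ∷ la) = (sg (k ℕ.+ length la) , row h (k ℕ.+ length la)) ∷ items h la

    items-rows : ∀ h la → map proj₂ (items h la) ≡ rows h la
    items-rows h [] = refl
    items-rows h (k ∷ la) = cong₂ _∷_ refl (items-rows h la)

    rows-items : ∀ {h h′} → (∀ k → h′ k ≡ sg k * h k) → ∀ la → Pointwise _≗_ (rows h′ la) (map (scaled sg) (items h la))
    rows-items e [] = []
    rows-items e (k ∷ la) = row-signed e _ ∷ rows-items e la

    colprod-snoc : ∀ c n → colprod c (suc n) ≡ colprod c n * c n
    colprod-snoc c zero = *-comm _ _
    colprod-snoc c (suc n) = trans (cong (c 0 *_) (colprod-snoc (c ∘ suc) n)) (sym (*-assoc _ _ _))

    -- The column indices 0, ..., l - 1 and the numbers of rows below each row run through the same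
    -- set, so their signs cancel in pairs and only the parts of λ contribute.
    total-sign : ∀ h la → colprod sg (length la) * prod (map proj₁ (items h la)) ≡ sg (sum la)
    total-sign h [] = *-identityˡ _
    total-sign h (k ∷ la) = begin
      colprod sg (suc l) * (sg (k ℕ.+ l) * p)     ≡⟨ cong₂ (λ x y → x * (y * p)) (colprod-snoc sg l) (sg-+ k l) ⟩
      colprod sg l * sg l * (sg k * sg l * p)     ≡⟨ solve 4 (λ c s k p → c :* s :* (k :* s :* p) := (s :* s) :* (k :* (c :* p))) refl _ _ _ _ ⟩
      sg l * sg l * (sg k * (colprod sg l * p))   ≡⟨ cong₂ (λ x y → x * (sg k * y)) (sg-square l) (total-sign h la) ⟩
      1# * (sg k * sg (sum la))                   ≡⟨ trans (*-identityˡ _) (sym (sg-+ k (sum la))) ⟩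
      sg (k ℕ.+ sum la)                           ∎
      where
      l = length la
      p = prod (map proj₁ (items h la))

    -- In every product of the sum the two indices add up to j + k, so all terms change by the same
    -- sign.
    dot-signed : ∀ {a a′} → (∀ k → a′ k ≡ sg k * a k) → ∀ {h h′} → (∀ k → h′ k ≡ sg k * h k) →
                 ∀ j k → dot a′ j (down h′ k) ≡ sg (j ℕ.+ k) * dot a j (down h k)
    dot-signed {a} {a′} ea {h} {h′} eh j zero = trans
      (cong₂ (λ x y → x * y + 0#) (ea j) (eh 0))
      (trans (solve 4 (λ s a u h → s :* a :* (u :* h) :+ :con 0ℚ := s :* u :* (a :* h :+ :con 0ℚ)) refl _ _ _ _)
        (*-congʳ (sym (sg-+ j 0))))
    dot-signed {a} {a′} ea {h} {h′} eh j (suc k) = trans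
      (cong₂ _+_ (cong₂ _*_ (ea j) (eh (suc k)))
        (trans (dot-signed ea eh (suc j) k) (cong (λ m → sg m * dot a (suc j) (down h k)) (sym (ℕₚ.+-suc j k)))))
      (trans (solve 6 (λ s a u h w y → s :* a :* (u :* h) :+ w :* y := (s :* u) :* (a :* h) :+ w :* y) refl _ _ _ _ _ _)
        (trans (cong₂ _+_ (cong (_* (a j * h (suc k))) (sym (sg-+ j (suc k)))) refl)
          (solve 3 (λ s x y → s :* x :+ s :* y := s :* (x :+ y)) refl _ _ _)))

    hom-signed : ∀ {a a′} → (∀ k → a′ k ≡ sg k * a k) → ∀ k → hom a′ k ≡ sg k * hom a k
    hom-signed {a} {a′} ea k = sym (hom-unique (λ k → sg k * hom a k) (*-identityˡ _) newton k)
      where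
      newton : ∀ k → Newton a′ k (sg (suc k) * hom a (suc k)) (down (λ k → sg k * hom a k) k)
      newton k = begin
        ι (natℚ (suc k)) * (sg (suc k) * hom a (suc k)) ≡⟨ solve 3 (λ n s h → n :* (s :* h) := s :* (n :* h)) refl _ _ _ ⟩
        sg (suc k) * (ι (natℚ (suc k)) * hom a (suc k)) ≡⟨ cong₂ _*_ refl (trans (hom-newton a k) (cong (dot a 1) (homs-down a k))) ⟩
        sg (suc k) * dot a 1 (down (hom a) k)           ≡⟨ dot-signed ea (λ _ → refl) 1 k ⟨
        dot a′ 1 (down (λ k → sg k * hom a k) k)        ∎

  -- s_λ is homogeneous of degree |λ| when p_k has degree k. On the matrix, h_{a-k} changes by
  -- (-1)^a (-1)^k, a row factor times a column factor.
  S-signed : ∀ {a a′} → (∀ k → a′ k ≡ sg k * a k) → ∀ la → S a′ la ≡ sg (sum la) * S a la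
  S-signed {a} {a′} ea la = begin
    det (length la) (rows (hom a′) la)
      ≡⟨ det-cong (length la) (rows-items (hom-signed ea) la) ⟩
    det (length la) (map (scaled sg) (items (hom a) la))
      ≡⟨ det-scaled (length la) sg (items (hom a) la) ⟩
    colprod sg (length la) * prod (map proj₁ (items (hom a) la)) * det (length la) (map proj₂ (items (hom a) la))
      ≡⟨ cong₂ _*_ (total-sign (hom a) la) (cong (det (length la)) (items-rows (hom a) la)) ⟩
    sg (sum la) * S a la ∎

  module _ (t : Carrier) where
    open Strip _+_ (t *_) 0#

    -- The leading term of Z f λ is f λ; both sides are arranged so that no subtraction occurs.
    Z-leading : ∀ {f g b} la → Dec b la →
      (∀ μ → Dec b μ → sum μ < sum la → f μ ≡ g μ) → Z f la + g la ≡ Z g la + f la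
    Z-leading [] d e = +-comm _ _
    Z-leading {f} {g} {b} (zero ∷ post) (le , d) e = Z-leading post d (λ μ dμ lt → e (0 ∷ μ) (le , dμ) lt)
    Z-leading {f} {g} {b} (suc k ∷ post) (le , d) e with hd post ≤ᵇ k | ℕₚ.≤ᵇ-reflects-≤ (hd post) k
    ... | false | _ = trans (solve 2 (λ x y → x :+ :con 0ℚ :+ y := x :+ y) refl _ _)
      (trans (Z-leading post d (λ μ dμ lt → e (suc k ∷ μ) (le , dμ) (ℕₚ.+-monoʳ-< (suc k) lt)))
        (solve 2 (λ x y → x :+ y := x :+ :con 0ℚ :+ y) refl _ _))
    ... | true | ofʸ p = trans (solve 3 (λ x z y → x :+ z :+ y := x :+ y :+ z) refl _ _ _)
      (trans (cong₂ _+_ (Z-leading post d (λ μ dμ lt → e (suc k ∷ μ) (le , dμ) (ℕₚ.+-monoʳ-< (suc k) lt)))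
               (cong (t *_) (Z-cong (k ∷ post) (ℕₚ.≤-trans (ℕₚ.n≤1+n k) le , Dec-hd post d p)
                 (λ μ dμ _ s → e μ dμ (s≤s s)))))
        (solve 3 (λ x z y → x :+ y :+ z := x :+ z :+ y) refl _ _ _))

-- Sums over semistandard tableaux

Tableau : Set
Tableau = List (List ℕ)

Entries : ℕ → List ℕ → Set
Entries m = All (λ x → 1 ≤ x × x ≤ m)

letters : ℕ → List ℕ
letters m = map suc (upTo m)

-- A pair (k , m) stands for a row of length k with entries in 1,…,m.
Fits : List (ℕ × ℕ) → Tableau → Set
Fits = Pointwise (λ (k , m) r → length r ≡ k × Entries m r)

alphabet : ℕ → List ℕ → List (ℕ × ℕ)
alphabet m = map (_, m)

append : ℕ → ℕ → Tableau → Tableau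
append x j [] = []
append x zero (r ∷ T) = (r ∷ʳ x) ∷ T
append x (suc j) (r ∷ T) = r ∷ append x j T

leHead : ℕ → List ℕ → Bool
leHead a [] = true
leHead a (b ∷ _) = a ≤ᵇ b

weaklyIncreasing-∷ : ∀ a r → weaklyIncreasing (a ∷ r) ≡ leHead a r ∧ weaklyIncreasing r
weaklyIncreasing-∷ a [] = refl
weaklyIncreasing-∷ a (b ∷ r) = refl

≤⇒≤ᵇ≡true : ∀ {m n} → m ≤ n → (m ≤ᵇ n) ≡ true
≤⇒≤ᵇ≡true {m} {n} le with m ≤ᵇ n | ℕₚ.≤ᵇ-reflects-≤ m n
... | true | _ = refl
... | false | ofⁿ ¬p = ⊥-elim (¬p le)

<⇒≤ᵇ≡false : ∀ {m n} → n < m → (m ≤ᵇ n) ≡ false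
<⇒≤ᵇ≡false {m} {n} lt with m ≤ᵇ n | ℕₚ.≤ᵇ-reflects-≤ m n
... | false | _ = refl
... | true | ofʸ p = ⊥-elim (ℕₚ.<⇒≱ lt p)

leHead-∷ʳ : ∀ a r m → a ≤ m → leHead a (r ∷ʳ m) ≡ leHead a r
leHead-∷ʳ a [] m le = ≤⇒≤ᵇ≡true le
leHead-∷ʳ a (b ∷ r) m le = refl

colStrict-∷ʳ-below : ∀ {m} prev r → Entries m prev → colStrict prev (r ∷ʳ suc m) ≡ colStrict prev r
colStrict-∷ʳ-below [] [] e = refl
colStrict-∷ʳ-below [] (_ ∷ _) e = refl
colStrict-∷ʳ-below (a ∷ prev) [] ((_ , le) ∷ _) rewrite ≤⇒≤ᵇ≡true (s≤s le) = c prev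
  where
  c : ∀ u → colStrict u [] ≡ true
  c [] = refl
  c (_ ∷ _) = refl
colStrict-∷ʳ-below (a ∷ prev) (b ∷ r) (_ ∷ e) = cong (_ ∧_) (colStrict-∷ʳ-below prev r e)

colStrict-∷ʳ-above : ∀ r s x → length s ≤ length r → colStrict (r ∷ʳ x) s ≡ colStrict r s
colStrict-∷ʳ-above [] [] x le = refl
colStrict-∷ʳ-above (_ ∷ _) [] x le = refl
colStrict-∷ʳ-above (a ∷ r) (b ∷ s) x (s≤s le) = cong (_ ∧_) (colStrict-∷ʳ-above r s x le)

colStrict-∷ʳ-full : ∀ {m} r s → length s ≡ suc (length r) → Entries m s → colStrict (r ∷ʳ m) s ≡ false
colStrict-∷ʳ-full [] (b ∷ []) l ((_ , le) ∷ _) rewrite <⇒≤ᵇ≡false (s≤s le) = refl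
colStrict-∷ʳ-full (a ∷ r) (b ∷ s) l (_ ∷ e) rewrite colStrict-∷ʳ-full r s (ℕₚ.suc-injective l) e = ∧-comm _ false

module Sums (𝔸 : ℚAlgebra) where
  open ℚAlgebra 𝔸
  open Solver

  private variable
    X Y : Set

  when : Bool → Carrier → Carrier
  when b x = if b then x else 0#

  when-∧ : ∀ p q x → when (p ∧ q) x ≡ when q (when p x)
  when-∧ true true x = refl
  when-∧ true false x = refl
  when-∧ false true x = refl
  when-∧ false false x = refl

  when-swap : ∀ p q {x} → when p (when q x) ≡ when q (when p x)
  when-swap true q = refl
  when-swap false true = refl
  when-swap false false = refl

  when-zero : ∀ p → when p 0# ≡ 0#
  when-zero true = refl
  when-zero false = refl

  when-+ : ∀ p x y → when p (x + y) ≡ when p x + when p y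
  when-+ true x y = refl
  when-+ false x y = sym (+-identityˡ _)

  when-* : ∀ p c x → when p (c * x) ≡ c * when p x
  when-* true c x = refl
  when-* false c x = sym (zeroʳ c)

  sumOver : List X → (X → Carrier) → Carrier
  sumOver [] F = 0#
  sumOver (x ∷ l) F = F x + sumOver l F

  sumOver-cong : ∀ (l : List X) {F G} → (∀ x → F x ≡ G x) → sumOver l F ≡ sumOver l G
  sumOver-cong [] e = refl
  sumOver-cong (x ∷ l) e = cong₂ _+_ (e x) (sumOver-cong l e)

  sumOver-zero : ∀ (l : List X) {F} → (∀ x → F x ≡ 0#) → sumOver l F ≡ 0#
  sumOver-zero [] e = refl
  sumOver-zero (x ∷ l) e = trans (cong₂ _+_ (e x) (sumOver-zero l e)) (+-identityˡ _)

  sumOver-+ : ∀ (l : List X) {F G} → sumOver l (λ x → F x + G x) ≡ sumOver l F + sumOver l G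
  sumOver-+ [] = sym (+-identityˡ _)
  sumOver-+ (x ∷ l) = trans (cong₂ _+_ refl (sumOver-+ l))
    (solve 4 (λ a b c d → (a :+ b) :+ (c :+ d) := (a :+ c) :+ (b :+ d)) refl _ _ _ _)

  sumOver-* : ∀ (l : List X) {F} c → sumOver l (λ x → c * F x) ≡ c * sumOver l F
  sumOver-* [] c = sym (zeroʳ c)
  sumOver-* (x ∷ l) c = trans (cong₂ _+_ refl (sumOver-* l c))
    (solve 3 (λ c a b → c :* a :+ c :* b := c :* (a :+ b)) refl c _ _)

  sumOver-++ : ∀ (l l′ : List X) {F} → sumOver (l ++ l′) F ≡ sumOver l F + sumOver l′ F
  sumOver-++ [] l′ = sym (+-identityˡ _)
  sumOver-++ (x ∷ l) l′ = trans (cong₂ _+_ refl (sumOver-++ l l′)) (sym (+-assoc _ _ _))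

  sumOver-map : ∀ (f : X → Y) l {F} → sumOver (map f l) F ≡ sumOver l (F ∘ f)
  sumOver-map f [] = refl
  sumOver-map f (x ∷ l) = cong₂ _+_ refl (sumOver-map f l)

  sumOver-concat-map : ∀ (f : X → List Y) l {F} → sumOver (concat (map f l)) F ≡ sumOver l (λ x → sumOver (f x) F)
  sumOver-concat-map f [] = refl
  sumOver-concat-map f (x ∷ l) = trans (sumOver-++ (f x) _) (cong₂ _+_ refl (sumOver-concat-map f l))

  sumOver-filter : ∀ (p : X → Bool) l {F} → sumOver (filterᵇ p l) F ≡ sumOver l (λ x → when (p x) (F x))
  sumOver-filter p [] = refl
  sumOver-filter p (x ∷ l) with p x
  ... | true = cong₂ _+_ refl (sumOver-filter p l)
  ... | false = trans (sumOver-filter p l) (sym (+-identityˡ _))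

  sumOver-words : ∀ k m {F} → sumOver (words (suc k) m) F ≡ sumOver (letters m) (λ a → sumOver (words k m) (λ r → F (a ∷ r)))
  sumOver-words k m = trans (sumOver-concat-map _ (letters m)) (sumOver-cong (letters m) (λ a → sumOver-map (a ∷_) (words k m)))

  letters-suc : ∀ m {G} → sumOver (letters (suc m)) G ≡ sumOver (letters m) G + G (suc m)
  letters-suc m {G} = begin
    sumOver (map suc (upTo (suc m))) G       ≡⟨ cong (λ l → sumOver (map suc l) G) (upTo-∷ʳ m) ⟨
    sumOver (map suc (upTo m ∷ʳ m)) G        ≡⟨ cong (λ l → sumOver l G) (map-++ suc (upTo m) (m ∷ [])) ⟩
    sumOver (letters m ++ suc m ∷ []) G      ≡⟨ sumOver-++ (letters m) (suc m ∷ []) ⟩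
    sumOver (letters m) G + (G (suc m) + 0#) ≡⟨ cong₂ _+_ refl (+-identityʳ _) ⟩
    sumOver (letters m) G + G (suc m)        ∎

  letters-cong : ∀ m {F G} → (∀ a → 1 ≤ a → a ≤ m → F a ≡ G a) → sumOver (letters m) F ≡ sumOver (letters m) G
  letters-cong zero e = refl
  letters-cong (suc m) e = trans (letters-suc m) (trans
    (cong₂ _+_ (letters-cong m (λ a 1≤a a≤m → e a 1≤a (ℕₚ.≤-trans a≤m (ℕₚ.n≤1+n m)))) (e (suc m) (s≤s z≤n) ℕₚ.≤-refl))
    (sym (letters-suc m)))

  words-cong : ∀ k m {F G} → (∀ r → length r ≡ k → Entries m r → F r ≡ G r) → sumOver (words k m) F ≡ sumOver (words k m) G
  words-cong zero m e = cong (_+ 0#) (e [] refl [])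
  words-cong (suc k) m e = trans (sumOver-words k m) (trans
    (letters-cong m (λ a 1≤a a≤m → words-cong k m (λ r l en → e (a ∷ r) (cong suc l) ((1≤a , a≤m) ∷ en))))
    (sym (sumOver-words k m)))

  W : ℕ → ℕ → (List ℕ → Carrier) → Carrier
  W k m F = sumOver (words k m) (λ r → when (weaklyIncreasing r) (F r))

  W-cong : ∀ k m {F G} → (∀ r → length r ≡ k → Entries m r → F r ≡ G r) → W k m F ≡ W k m G
  W-cong k m e = words-cong k m (λ r l en → cong (when (weaklyIncreasing r)) (e r l en))

  W-zero : ∀ k m {F} → (∀ r → length r ≡ k → Entries m r → F r ≡ 0#) → W k m F ≡ 0#
  W-zero k m e = trans (W-cong k m e) (sumOver-zero (words k m) (λ r → when-zero (weaklyIncreasing r)))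

  W-+ : ∀ k m {F G} → W k m (λ r → F r + G r) ≡ W k m F + W k m G
  W-+ k m = trans (sumOver-cong (words k m) (λ r → when-+ (weaklyIncreasing r) _ _)) (sumOver-+ (words k m))

  W-* : ∀ k m {F} c → W k m (λ r → c * F r) ≡ c * W k m F
  W-* k m c = trans (sumOver-cong (words k m) (λ r → when-* (weaklyIncreasing r) c _)) (sumOver-* (words k m) c)

  W-when : ∀ p k m {F} → W k m (λ r → when p (F r)) ≡ when p (W k m F)
  W-when true k m = refl
  W-when false k m = W-zero k m (λ _ _ _ → refl)

  W-suc : ∀ k m {F} → W (suc k) m F ≡ sumOver (letters m) (λ a → W k m (λ r → when (leHead a r) (F (a ∷ r))))
  W-suc k m {F} = trans (sumOver-words k m) (sumOver-cong (letters m) (λ a → sumOver-cong (words k m) (λ r →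
    trans (cong (λ b → when b (F (a ∷ r))) (weaklyIncreasing-∷ a r)) (when-∧ (leHead a r) _ _))))

  -- A weakly increasing word in 1,…,m+1 either avoids the letter m+1 or ends with it.
  W-peel : ∀ k m {F} → W (suc k) (suc m) F ≡ W (suc k) m F + W k (suc m) (λ r → F (r ∷ʳ suc m))
  W-peel zero m {F} = begin
    W 1 (suc m) F                                  ≡⟨ W-suc 0 (suc m) ⟩
    sumOver (letters (suc m)) (λ a → F (a ∷ []) + 0#)                    ≡⟨ letters-suc m ⟩
    sumOver (letters m) (λ a → F (a ∷ []) + 0#) + (F (suc m ∷ []) + 0#)  ≡⟨ cong₂ _+_ (sym (W-suc 0 m)) refl ⟩
    W 1 m F + W 0 (suc m) (λ r → F (r ∷ʳ suc m))   ∎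
  W-peel (suc k) m {F} = begin
    W (suc (suc k)) (suc m) F
      ≡⟨ W-suc (suc k) (suc m) ⟩
    sumOver (letters (suc m)) (λ a → W (suc k) (suc m) (F′ a))
      ≡⟨ sumOver-cong (letters (suc m)) (λ a → W-peel k m) ⟩
    sumOver (letters (suc m)) (λ a → W (suc k) m (F′ a) + W k (suc m) (λ r → F′ a (r ∷ʳ suc m)))
      ≡⟨ sumOver-+ (letters (suc m)) ⟩
    sumOver (letters (suc m)) (λ a → W (suc k) m (F′ a)) + sumOver (letters (suc m)) (λ a → W k (suc m) (λ r → F′ a (r ∷ʳ suc m)))
      ≡⟨ cong₂ _+_ first second ⟩
    W (suc (suc k)) m F + W (suc k) (suc m) (λ r → F (r ∷ʳ suc m)) ∎
    where
    F′ : ℕ → List ℕ → Carrier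
    F′ a r = when (leHead a r) (F (a ∷ r))
    avoid : ∀ r → length r ≡ suc k → Entries m r → F′ (suc m) r ≡ 0#
    avoid (b ∷ r) _ ((_ , b≤m) ∷ _) = cong (λ p → when p (F (suc m ∷ b ∷ r))) (<⇒≤ᵇ≡false (s≤s b≤m))
    first : sumOver (letters (suc m)) (λ a → W (suc k) m (F′ a)) ≡ W (suc (suc k)) m F
    first = begin
      sumOver (letters (suc m)) (λ a → W (suc k) m (F′ a))                   ≡⟨ letters-suc m ⟩
      sumOver (letters m) (λ a → W (suc k) m (F′ a)) + W (suc k) m (F′ (suc m)) ≡⟨ cong₂ _+_ refl (W-zero (suc k) m avoid) ⟩
      sumOver (letters m) (λ a → W (suc k) m (F′ a)) + 0#                    ≡⟨ +-identityʳ _ ⟩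
      sumOver (letters m) (λ a → W (suc k) m (F′ a))                         ≡⟨ W-suc (suc k) m ⟨
      W (suc (suc k)) m F                                                    ∎
    second : sumOver (letters (suc m)) (λ a → W k (suc m) (λ r → F′ a (r ∷ʳ suc m))) ≡ W (suc k) (suc m) (λ r → F (r ∷ʳ suc m))
    second = trans
      (letters-cong (suc m) (λ a _ a≤ → W-cong k (suc m) (λ r _ _ →
        cong (λ p → when p (F (a ∷ (r ∷ʳ suc m)))) (leHead-∷ʳ a r (suc m) a≤))))
      (sym (W-suc k (suc m)))

  -- A sum over semistandard tableaux placed below the row `prev`, in which each row has its own
  -- largest admissible letter. Mixed bounds are the intermediate states when the letter m + 1 is
  -- removed row by row from the top.
  B : List ℕ → List (ℕ × ℕ) → (Tableau → Carrier) → Carrier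
  B prev [] φ = φ []
  B prev ((k , m) ∷ s) φ = W k m (λ r → when (colStrict prev r) (B r s (λ T → φ (r ∷ T))))

  B-cong : ∀ prev s {φ ψ} → (∀ T → Fits s T → φ T ≡ ψ T) → B prev s φ ≡ B prev s ψ
  B-cong prev [] e = e [] []
  B-cong prev ((k , m) ∷ s) e = W-cong k m (λ r l en → cong (when (colStrict prev r))
    (B-cong r s (λ T f → e (r ∷ T) ((l , en) ∷ f))))

  B-+ : ∀ prev s {φ ψ} → B prev s (λ T → φ T + ψ T) ≡ B prev s φ + B prev s ψ
  B-+ prev [] = refl
  B-+ prev ((k , m) ∷ s) = trans (W-cong k m (λ r _ _ →
    trans (cong (when (colStrict prev r)) (B-+ r s)) (when-+ (colStrict prev r) _ _))) (W-+ k m)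

  B-* : ∀ prev s {φ} c → B prev s (λ T → c * φ T) ≡ c * B prev s φ
  B-* prev [] c = refl
  B-* prev ((k , m) ∷ s) c = trans (W-cong k m (λ r _ _ →
    trans (cong (when (colStrict prev r)) (B-* r s c)) (when-* (colStrict prev r) c _))) (W-* k m c)

  B-zero : ∀ prev s {φ} → (∀ T → Fits s T → φ T ≡ 0#) → B prev s φ ≡ 0#
  B-zero prev s {φ} e = trans (B-cong prev s (λ T f → trans (e T f) (sym (zeroˡ 1#)))) (trans (B-* prev s {λ _ → 1#} 0#) (zeroˡ _))

  private
    -- Nothing can stand below the largest letter, so appending it to `r` is compatible with the
    -- next row exactly when that row is no longer than `r`. This is the horizontal strip condition
    -- on the side of tableaux.
    B-extended : ∀ k m r post {φ} → length r ≡ k → hd post ≤ suc k →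
      B (r ∷ʳ suc m) (alphabet (suc m) post) φ ≡ when (hd post ≤ᵇ k) (B r (alphabet (suc m) post) φ)
    B-extended k m r [] l le = refl
    B-extended k m r (p ∷ post) refl le with p ≤ᵇ length r | ℕₚ.≤ᵇ-reflects-≤ p (length r)
    ... | true | ofʸ p≤ = W-cong p (suc m) (λ s ls _ → cong (λ b → when b _)
      (colStrict-∷ʳ-above r s (suc m) (subst (_≤ length r) (sym ls) p≤)))
    ... | false | ofⁿ ¬p = W-zero p (suc m) (λ s ls en → cong (λ b → when b _)
      (colStrict-∷ʳ-full r s (trans ls (ℕₚ.≤-antisym le (ℕₚ.≰⇒> ¬p))) en))

  -- Either the letter m+1 is absent from the row after pre, or the last box of that row can be removed.
  B-peel : ∀ m pre prev k post {φ} → All (λ p → proj₂ p ≡ m) pre → Entries m prev → hd post ≤ suc k →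
    B prev (pre ++ (suc k , suc m) ∷ alphabet (suc m) post) φ
    ≡ B prev (pre ++ (suc k , m) ∷ alphabet (suc m) post) φ
      + when (hd post ≤ᵇ k) (B prev (pre ++ (k , suc m) ∷ alphabet (suc m) post) (λ T → φ (append (suc m) (length pre) T)))
  B-peel m [] prev k post {φ} _ en le = trans (W-peel k m) (cong₂ _+_ refl (trans
    (W-cong k (suc m) (λ r l _ → begin
      when (colStrict prev (r ∷ʳ suc m)) (B (r ∷ʳ suc m) s (ψ r))
        ≡⟨ cong₂ when (colStrict-∷ʳ-below prev r en) (B-extended k m r post l le) ⟩
      when (colStrict prev r) (when c (B r s (ψ r)))
        ≡⟨ when-swap (colStrict prev r) c ⟩
      when c (when (colStrict prev r) (B r s (ψ r))) ∎))
    (W-when c k (suc m))))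
    where
    s = alphabet (suc m) post
    c = hd post ≤ᵇ k
    ψ : List ℕ → Tableau → Carrier
    ψ r T = φ ((r ∷ʳ suc m) ∷ T)
  B-peel m ((k₀ , m) ∷ pre) prev k post (refl ∷ ms) en le = trans
    (W-cong k₀ m (λ r _ enr → trans (cong (when (colStrict prev r)) (B-peel m pre r k post ms enr le))
      (when-+ (colStrict prev r) _ _)))
    (trans (W-+ k₀ m) (cong₂ _+_ refl (trans
      (W-cong k₀ m (λ r _ _ → when-swap (colStrict prev r) (hd post ≤ᵇ k)))
      (W-when (hd post ≤ᵇ k) k₀ m))))

  B-empty-row : ∀ m m′ pre prev s {φ} → B prev (pre ++ (0 , m) ∷ s) φ ≡ B prev (pre ++ (0 , m′) ∷ s) φ
  B-empty-row m m′ [] prev s = refl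
  B-empty-row m m′ ((k , a) ∷ pre) prev s = W-cong k a (λ r _ _ → cong (when (colStrict prev r)) (B-empty-row m m′ pre r s))

  private
    rearrange : ∀ a b c d x → when ((a ∧ b) ∧ (c ∧ d)) x ≡ when a (when c (when (b ∧ d) x))
    rearrange true b true d x = refl
    rearrange true true false d x = refl
    rearrange true false false d x = refl
    rearrange false b c d x = refl

    sumOver-when : ∀ p (l : List X) {F} → sumOver l (λ x → when p (F x)) ≡ when p (sumOver l F)
    sumOver-when true l = refl
    sumOver-when false l = sumOver-zero l (λ _ → refl)

  fillings-B : ∀ m prev la {φ} →
    sumOver (fillings la m) (λ T → when (all weaklyIncreasing T ∧ columnsStrict (prev ∷ T)) (φ T)) ≡ B prev (alphabet m la) φ
  fillings-B m prev [] = +-identityʳ _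
  fillings-B m prev (k ∷ la) {φ} = trans (sumOver-concat-map _ (words k m)) (sumOver-cong (words k m) λ r → begin
    sumOver (map (r ∷_) (fillings la m)) _
      ≡⟨ sumOver-map (r ∷_) (fillings la m) ⟩
    sumOver (fillings la m) (λ T → when ((weaklyIncreasing r ∧ all weaklyIncreasing T) ∧ (colStrict prev r ∧ columnsStrict (r ∷ T))) (φ (r ∷ T)))
      ≡⟨ sumOver-cong (fillings la m) (λ T → rearrange (weaklyIncreasing r) _ (colStrict prev r) _ _) ⟩
    sumOver (fillings la m) (λ T → when (weaklyIncreasing r) (when (colStrict prev r) (when (all weaklyIncreasing T ∧ columnsStrict (r ∷ T)) (φ (r ∷ T)))))
      ≡⟨ trans (sumOver-when (weaklyIncreasing r) (fillings la m)) (cong (when (weaklyIncreasing r)) (sumOver-when (colStrict prev r) (fillings la m))) ⟩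
    when (weaklyIncreasing r) (when (colStrict prev r) (sumOver (fillings la m) _))
      ≡⟨ cong (when (weaklyIncreasing r) ∘ when (colStrict prev r)) (fillings-B m r la) ⟩
    when (weaklyIncreasing r) (when (colStrict prev r) (B r (alphabet m la) _)) ∎)

  private
    columnsStrict-[] : ∀ T → columnsStrict ([] ∷ T) ≡ columnsStrict T
    columnsStrict-[] [] = refl
    columnsStrict-[] (_ ∷ _) = refl

  sumOver-SSYT : ∀ m la {φ} → sumOver (fillings la m) (λ T → when (isSSYT T) (φ T)) ≡ B [] (alphabet m la) φ
  sumOver-SSYT m la {φ} = trans
    (sumOver-cong (fillings la m) (λ T → cong (λ b → when (all weaklyIncreasing T ∧ b) (φ T)) (sym (columnsStrict-[] T))))
    (fillings-B m [] la)

  fillings-cong : ∀ m la {F G} → (∀ T → Fits (alphabet m la) T → F T ≡ G T) → sumOver (fillings la m) F ≡ sumOver (fillings la m) G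
  fillings-cong m [] e = cong (_+ 0#) (e [] [])
  fillings-cong m (k ∷ la) e = trans (unfold k la) (trans
    (words-cong k m (λ r l en → fillings-cong m la (λ T f → e (r ∷ T) ((l , en) ∷ f))))
    (sym (unfold k la)))
    where
    unfold : ∀ k la {F} → sumOver (fillings (k ∷ la) m) F ≡ sumOver (words k m) (λ r → sumOver (fillings la m) (λ T → F (r ∷ T)))
    unfold k la = trans (sumOver-concat-map _ (words k m)) (sumOver-cong (words k m) (λ r → sumOver-map (r ∷_) (fillings la m)))

Fits-length : ∀ {s T} → Fits s T → length T ≡ length s
Fits-length f = sym (PW.Pointwise-length f)

length-mid-< : ∀ {X : Set} (P : List X) {x rest} → length P < length (P ++ x ∷ rest)
length-mid-< [] = s≤s z≤n
length-mid-< (_ ∷ P) = s≤s (length-mid-< P)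

Fits-< : ∀ P {x rest T} → Fits (P ++ x ∷ rest) T → length P < length T
Fits-< P f = subst (length P <_) (sym (Fits-length f)) (length-mid-< P)

-- Branching of the tableau sums and comparison with Jacobi-Trudi

module SchurJT (𝔸 : ℚAlgebra) (ξ : ℕ → ℚAlgebra.Carrier 𝔸) where
  open ℚAlgebra 𝔸
  open Solver
  open Sums 𝔸
  open JacobiTrudi ops
  open JTLaws 𝔸

  monomial : List ℕ → Carrier
  monomial [] = 1#
  monomial (x ∷ l) = ξ x * monomial l

  weight : Tableau → Carrier
  weight = monomial ∘ concat

  monomial-++ : ∀ l l′ → monomial (l ++ l′) ≡ monomial l * monomial l′
  monomial-++ [] l′ = sym (*-identityˡ _)
  monomial-++ (x ∷ l) l′ = trans (cong (ξ x *_) (monomial-++ l l′)) (sym (*-assoc _ _ _))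

  weight-append : ∀ x j T → j < length T → weight (append x j T) ≡ ξ x * weight T
  weight-append x zero (r ∷ T) _ = begin
    monomial ((r ++ x ∷ []) ++ concat T)            ≡⟨ monomial-++ (r ++ x ∷ []) (concat T) ⟩
    monomial (r ++ x ∷ []) * weight T               ≡⟨ cong (_* weight T) (monomial-++ r (x ∷ [])) ⟩
    monomial r * (ξ x * 1#) * weight T              ≡⟨ solve 3 (λ r x t → r :* (x :* :con 1ℚ) :* t := x :* (r :* t)) refl _ _ _ ⟩
    ξ x * (monomial r * weight T)                   ≡⟨ cong (ξ x *_) (monomial-++ r (concat T)) ⟨
    ξ x * weight (r ∷ T)                            ∎
  weight-append x (suc j) (r ∷ T) (s≤s lt) = begin
    monomial (r ++ concat (append x j T))           ≡⟨ monomial-++ r _ ⟩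
    monomial r * weight (append x j T)              ≡⟨ cong (monomial r *_) (weight-append x j T lt) ⟩
    monomial r * (ξ x * weight T)                   ≡⟨ solve 3 (λ r x t → r :* (x :* t) := x :* (r :* t)) refl _ _ _ ⟩
    ξ x * (monomial r * weight T)                   ≡⟨ cong (ξ x *_) (monomial-++ r (concat T)) ⟨
    ξ x * weight (r ∷ T)                            ∎

  schurB : ℕ → List ℕ → Carrier
  schurB m la = B [] (alphabet m la) weight

  psum : ℕ → ℕ → Carrier
  psum zero k = 0#
  psum (suc m) k = psum m k + ξ (suc m) ^ k

  module _ (m : ℕ) where
    open Strip _+_ (ξ (suc m) *_) 0#

    -- `P` holds the upper rows, already confined to the letters 1, ..., m. `B-peel` either confines
    -- the current row as well or strips a box of weight `ξ (suc m)` from it, which is the recursion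
    -- of `Zrow`.
    schur-branch′ : ∀ P post {b} → All (λ p → proj₂ p ≡ m) P → Dec b post →
      B [] (P ++ alphabet (suc m) post) weight ≡ Z (λ μ → B [] (P ++ alphabet m μ) weight) post
    schur-branch-row : ∀ P post k → All (λ p → proj₂ p ≡ m) P → Dec k post →
      B [] (P ++ (k , suc m) ∷ alphabet (suc m) post) weight ≡ Zrow (λ μ → B [] (P ++ alphabet m μ) weight) post k

    schur-branch′ P [] ms d = refl
    schur-branch′ P (k ∷ post) ms (_ , d) = schur-branch-row P post k ms d

    private
      keep : ∀ P post k → All (λ p → proj₂ p ≡ m) P → Dec k post →
        B [] (P ++ (k , m) ∷ alphabet (suc m) post) weight ≡ Z (λ μ → B [] (P ++ alphabet m (k ∷ μ)) weight) post
      keep P post k ms d = begin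
        B [] (P ++ (k , m) ∷ alphabet (suc m) post) weight
          ≡⟨ cong (λ s → B [] s weight) (++-assoc P ((k , m) ∷ []) _) ⟨
        B [] ((P ++ (k , m) ∷ []) ++ alphabet (suc m) post) weight
          ≡⟨ schur-branch′ (P ++ (k , m) ∷ []) post (Allₚ.++⁺ ms (refl ∷ [])) d ⟩
        Z (λ μ → B [] ((P ++ (k , m) ∷ []) ++ alphabet m μ) weight) post
          ≡⟨ Z-cong post d (λ μ _ _ _ → cong (λ s → B [] s weight) (++-assoc P ((k , m) ∷ []) _)) ⟩
        Z (λ μ → B [] (P ++ alphabet m (k ∷ μ)) weight) post ∎

    schur-branch-row P post zero ms d = trans (B-empty-row (suc m) m P [] _) (keep P post zero ms d)
    schur-branch-row P post (suc k) ms d = trans (B-peel m P [] k post ms [] (Dec⇒hd post d))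
      (cong₂ _+_ (keep P post (suc k) ms d) rest)
      where
      rest : when (hd post ≤ᵇ k) (B [] (P ++ (k , suc m) ∷ alphabet (suc m) post) (λ T → weight (append (suc m) (length P) T)))
             ≡ (if hd post ≤ᵇ k then ξ (suc m) * Zrow (λ μ → B [] (P ++ alphabet m μ) weight) post k else 0#)
      rest with hd post ≤ᵇ k | ℕₚ.≤ᵇ-reflects-≤ (hd post) k
      ... | false | _ = refl
      ... | true | ofʸ p = trans (B-cong [] s (λ T f → weight-append (suc m) (length P) T (Fits-< P f)))
        (trans (B-* [] s (ξ (suc m))) (cong (ξ (suc m) *_) (schur-branch-row P post k ms (Dec-hd post d p))))
        where s = P ++ (k , suc m) ∷ alphabet (suc m) post

    schur-branch : ∀ la {b} → Dec b la → schurB (suc m) la ≡ Z (schurB m) la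
    schur-branch la d = schur-branch′ [] la [] d

  schurB-empty : ∀ la → Dec 0 la → schurB 0 la ≡ 1#
  schurB-empty [] d = refl
  schurB-empty (zero ∷ la) (_ , d) = trans (+-identityʳ _) (schurB-empty la d)

  schurB-S : ∀ m la {b} → Dec b la → schurB m la ≡ S (psum m) la
  schurB-S zero [] d = sym (S-zero-empty [] tt)
  schurB-S zero (zero ∷ la) (_ , d) = trans (schurB-empty (0 ∷ la) (z≤n , d)) (sym (S-zero-empty (0 ∷ la) (z≤n , d)))
  schurB-S zero (suc k ∷ la) d = sym (S-zero-nonempty k la)
  schurB-S (suc m) la d = begin
    schurB (suc m) la    ≡⟨ schur-branch m la d ⟩
    Z (schurB m) la      ≡⟨ Z-cong la d (λ μ dμ _ _ → schurB-S m μ dμ) ⟩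
    Z (S (psum m)) la    ≡⟨ S-branch (psum m) (ξ (suc m)) la d ⟨
    S (psum (suc m)) la  ∎
    where open Strip _+_ (ξ (suc m) *_) 0#

-- The tableau definition of Schur functions over ℚ

powℚ-^ : ∀ x k → powℚ x k ≡ Ops._^_ ℚ-ops x k
powℚ-^ x zero = refl
powℚ-^ x (suc k) = cong (x ℚ.*_) (powℚ-^ x k)

module SchurQ where
  open ℚAlgebra ℚ-algebra
  open Sums ℚ-algebra
  open JacobiTrudi ℚ-ops

  private
    ℚsum-map : ∀ {X : Set} (f : X → ℚ) l → ℚsum (map f l) ≡ sumOver l f
    ℚsum-map f [] = refl
    ℚsum-map f (x ∷ l) = cong (f x +_) (ℚsum-map f l)


  module _ {n : ℕ} (x : Fin n → ℚ) where
    open SchurJT ℚ-algebra (xAt x)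

    private
      ℚprod-monomial : ∀ l → ℚprod (map (xAt x) l) ≡ monomial l
      ℚprod-monomial [] = refl
      ℚprod-monomial (a ∷ l) = cong (xAt x a *_) (ℚprod-monomial l)

      xAt-toℕ : ∀ i → xAt x (suc (toℕ i)) ≡ x i
      xAt-toℕ i with toℕ i ℕ.<? n
      ... | yes lt = cong x (Finₚ.fromℕ<-toℕ i lt)
      ... | no ¬lt = ⊥-elim (¬lt (Finₚ.toℕ<n i))

      psum-letters : ∀ m k → psum m k ≡ sumOver (letters m) (λ a → xAt x a ^ k)
      psum-letters zero k = refl
      psum-letters (suc m) k = trans (cong₂ _+_ (psum-letters m k) refl) (sym (letters-suc m))

      letters-allFin : ∀ m → letters m ≡ map (suc ∘ toℕ) (allFin m)
      letters-allFin m = trans (cong (map suc) (upTo-allFin m)) (sym (map-∘ (allFin m)))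
        where
        applyUpTo-tabulate : ∀ {X : Set} (f : ℕ → X) m → applyUpTo f m ≡ tabulate {n = m} (f ∘ toℕ)
        applyUpTo-tabulate f zero = refl
        applyUpTo-tabulate f (suc m) = cong (f 0 ∷_) (applyUpTo-tabulate (f ∘ suc) m)
        upTo-allFin : ∀ m → upTo m ≡ map toℕ (allFin m)
        upTo-allFin m = trans (applyUpTo-tabulate (λ i → i) m) (sym (map-tabulate (λ i → i) toℕ))

    powerSum-psum : ∀ k → powerSum k n x ≡ psum n k
    powerSum-psum k = begin
      ℚsum (map (λ i → powℚ (x i) k) (allFin n))              ≡⟨ ℚsum-map _ (allFin n) ⟩
      sumOver (allFin n) (λ i → powℚ (x i) k)                 ≡⟨ sumOver-cong (allFin n) (λ i → trans (powℚ-^ (x i) k) (cong (_^ k) (sym (xAt-toℕ i)))) ⟩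
      sumOver (allFin n) (λ i → xAt x (suc (toℕ i)) ^ k)      ≡⟨ sumOver-map (suc ∘ toℕ) (allFin n) ⟨
      sumOver (map (suc ∘ toℕ) (allFin n)) (λ a → xAt x a ^ k) ≡⟨ cong (λ l → sumOver l (λ a → xAt x a ^ k)) (letters-allFin n) ⟨
      sumOver (letters n) (λ a → xAt x a ^ k)                 ≡⟨ psum-letters n k ⟨
      psum n k                                                ∎

    schur-S : ∀ la {b} → Dec b la → schur la n x ≡ S (λ k → powerSum k n x) la
    schur-S la d = begin
      schur la n x
        ≡⟨ ℚsum-map _ (filterᵇ isSSYT (fillings la n)) ⟩
      sumOver (filterᵇ isSSYT (fillings la n)) (λ T → ℚprod (map (xAt x) (concat T)))
        ≡⟨ sumOver-filter isSSYT (fillings la n) ⟩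
      sumOver (fillings la n) (λ T → when (isSSYT T) (ℚprod (map (xAt x) (concat T))))
        ≡⟨ sumOver-cong (fillings la n) (λ T → cong (when (isSSYT T)) (ℚprod-monomial (concat T))) ⟩
      sumOver (fillings la n) (λ T → when (isSSYT T) (weight T))
        ≡⟨ sumOver-SSYT n la ⟩
      schurB n la
        ≡⟨ schurB-S n la d ⟩
      S (psum n) la
        ≡⟨ S-cong (λ k → sym (powerSum-psum k)) la ⟩
      S (λ k → powerSum k n x) la ∎

-- Standard tableaux with prescribed descents

≡ᵇ-refl : ∀ n → (n ≡ᵇ n) ≡ true
≡ᵇ-refl zero = refl
≡ᵇ-refl (suc n) = ≡ᵇ-refl n

≢⇒≡ᵇ≡false : ∀ {m n} → m ≢ n → (m ≡ᵇ n) ≡ false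
≢⇒≡ᵇ≡false {zero} {zero} ne = ⊥-elim (ne refl)
≢⇒≡ᵇ≡false {zero} {suc n} ne = refl
≢⇒≡ᵇ≡false {suc m} {zero} ne = refl
≢⇒≡ᵇ≡false {suc m} {suc n} ne = ≢⇒≡ᵇ≡false (ne ∘ cong suc)

≡ᵇ≡true⇒≡ : ∀ m n → (m ≡ᵇ n) ≡ true → m ≡ n
≡ᵇ≡true⇒≡ zero zero _ = refl
≡ᵇ≡true⇒≡ (suc m) (suc n) e = cong suc (≡ᵇ≡true⇒≡ m n e)

all-upTo-suc : ∀ p m → all p (upTo (suc m)) ≡ all p (upTo m) ∧ p m
all-upTo-suc p m = trans (cong (all p) (sym (upTo-∷ʳ m))) (snoc (upTo m))
  where
  snoc : ∀ l → all p (l ∷ʳ m) ≡ all p l ∧ p m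
  snoc [] = ∧-identityʳ _
  snoc (x ∷ l) = trans (cong (p x ∧_) (snoc l)) (sym (∧-assoc (p x) _ _))

all-upTo-cong : ∀ {p q} m → (∀ i → i < m → p i ≡ q i) → all p (upTo m) ≡ all q (upTo m)
all-upTo-cong zero e = refl
all-upTo-cong {p} {q} (suc m) e = trans (all-upTo-suc p m) (trans
  (cong₂ _∧_ (all-upTo-cong m (λ i lt → e i (ℕₚ.≤-trans lt (ℕₚ.n≤1+n m)))) (e m ℕₚ.≤-refl))
  (sym (all-upTo-suc q m)))

∧-elim : ∀ {a b} → a ∧ b ≡ true → a ≡ true × b ≡ true
∧-elim {true} {true} _ = refl , refl

all-upTo-elim : ∀ p m → all p (upTo m) ≡ true → ∀ i → i < m → p i ≡ true
all-upTo-elim p (suc m) e i (s≤s le) with i ℕ.≟ m | ∧-elim (trans (sym (all-upTo-suc p m)) e)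
... | yes refl | _ , e′ = e′
... | no ne | e′ , _ = all-upTo-elim p m e′ i (ℕₚ.≤∧≢⇒< le ne)

count-++ : ∀ x l l′ → count x (l ++ l′) ≡ count x l ℕ.+ count x l′
count-++ x [] l′ = refl
count-++ x (y ∷ l) l′ with y ≡ᵇ x
... | true = cong suc (count-++ x l l′)
... | false = count-++ x l l′

count-self : ∀ x → count x (x ∷ []) ≡ 1
count-self x rewrite ≡ᵇ-refl x = refl

count-other : ∀ {x y} → y ≢ x → count x (y ∷ []) ≡ 0
count-other ne rewrite ≢⇒≡ᵇ≡false ne = refl

count-append-self : ∀ x j T → j < length T → count x (concat (append x j T)) ≡ suc (count x (concat T))
count-append-self x zero (r ∷ T) _ = begin
  count x ((r ++ x ∷ []) ++ concat T)               ≡⟨ count-++ x (r ++ x ∷ []) (concat T) ⟩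
  count x (r ++ x ∷ []) ℕ.+ count x (concat T)      ≡⟨ cong (ℕ._+ count x (concat T)) (trans (count-++ x r (x ∷ [])) (cong (count x r ℕ.+_) (count-self x))) ⟩
  count x r ℕ.+ 1 ℕ.+ count x (concat T)            ≡⟨ cong (ℕ._+ count x (concat T)) (ℕₚ.+-comm (count x r) 1) ⟩
  suc (count x r ℕ.+ count x (concat T))            ≡⟨ cong suc (count-++ x r (concat T)) ⟨
  suc (count x (r ++ concat T))                     ∎
count-append-self x (suc j) (r ∷ T) (s≤s lt) = begin
  count x (r ++ concat (append x j T))              ≡⟨ count-++ x r _ ⟩
  count x r ℕ.+ count x (concat (append x j T))     ≡⟨ cong (count x r ℕ.+_) (count-append-self x j T lt) ⟩
  count x r ℕ.+ suc (count x (concat T))            ≡⟨ ℕₚ.+-suc (count x r) _ ⟩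
  suc (count x r ℕ.+ count x (concat T))            ≡⟨ cong suc (count-++ x r (concat T)) ⟨
  suc (count x (r ++ concat T))                     ∎

count-append-other : ∀ {x y} j T → y ≢ x → count x (concat (append y j T)) ≡ count x (concat T)
count-append-other j [] ne = refl
count-append-other {x} {y} zero (r ∷ T) ne = begin
  count x ((r ++ y ∷ []) ++ concat T)               ≡⟨ count-++ x (r ++ y ∷ []) (concat T) ⟩
  count x (r ++ y ∷ []) ℕ.+ count x (concat T)      ≡⟨ cong (ℕ._+ count x (concat T)) (trans (count-++ x r (y ∷ [])) (cong (count x r ℕ.+_) (count-other ne))) ⟩
  count x r ℕ.+ 0 ℕ.+ count x (concat T)            ≡⟨ cong (ℕ._+ count x (concat T)) (ℕₚ.+-identityʳ (count x r)) ⟩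
  count x r ℕ.+ count x (concat T)                  ≡⟨ count-++ x r (concat T) ⟨
  count x (r ++ concat T)                           ∎
count-append-other {x} {y} (suc j) (r ∷ T) ne = trans (count-++ x r _)
  (trans (cong (count x r ℕ.+_) (count-append-other j T ne)) (sym (count-++ x r (concat T))))

count-absent : ∀ {m} r → Entries m r → count (suc m) r ≡ 0
count-absent [] [] = refl
count-absent {m} (x ∷ r) ((_ , x≤m) ∷ e) rewrite ≢⇒≡ᵇ≡false {x} {suc m} (ℕₚ.<⇒≢ (s≤s x≤m)) = count-absent r e

Bounded : ℕ → Tableau → Set
Bounded m = All (Entries m)

count-absent-T : ∀ {m} T → Bounded m T → count (suc m) (concat T) ≡ 0
count-absent-T [] [] = refl
count-absent-T {m} (r ∷ T) (e ∷ es) = trans (count-++ (suc m) r (concat T)) (cong₂ ℕ._+_ (count-absent r e) (count-absent-T T es))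

Fits-bounded : ∀ {m} la {T} → Fits (alphabet m la) T → Bounded m T
Fits-bounded [] [] = []
Fits-bounded (k ∷ la) ((_ , e) ∷ f) = e ∷ Fits-bounded la f

has : ℕ → List ℕ → Bool
has x = any (λ a → a ≡ᵇ x)

has-++-self : ∀ x r → has x (r ∷ʳ x) ≡ true
has-++-self x [] rewrite ≡ᵇ-refl x = refl
has-++-self x (y ∷ r) with y ≡ᵇ x
... | true = refl
... | false = has-++-self x r

has-++-other : ∀ {x y} r → y ≢ x → has x (r ∷ʳ y) ≡ has x r
has-++-other [] ne rewrite ≢⇒≡ᵇ≡false ne = refl
has-++-other {x} (z ∷ r) ne = cong ((z ≡ᵇ x) ∨_) (has-++-other r ne)

has-absent : ∀ {m} r → Entries m r → has (suc m) r ≡ false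
has-absent [] [] = refl
has-absent {m} (x ∷ r) ((_ , x≤m) ∷ e) rewrite ≢⇒≡ᵇ≡false {x} {suc m} (ℕₚ.<⇒≢ (s≤s x≤m)) = has-absent r e

has-count : ∀ x r → has x r ≡ false → count x r ≡ 0
has-count x [] e = refl
has-count x (y ∷ r) e with y ≡ᵇ x
... | false = has-count x r e

rowOf-append-other : ∀ {x y} j T → y ≢ x → rowOf x (append y j T) ≡ rowOf x T
rowOf-append-other j [] ne = refl
rowOf-append-other zero (r ∷ T) ne rewrite has-++-other r ne = refl
rowOf-append-other {x} (suc j) (r ∷ T) ne with has x r
... | true = refl
... | false = cong suc (rowOf-append-other j T ne)

rowOf-append-≤ : ∀ x j T → j < length T → rowOf x (append x j T) ≤ j
rowOf-append-≤ x zero (r ∷ T) _ rewrite has-++-self x r = z≤n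
rowOf-append-≤ x (suc j) (r ∷ T) (s≤s lt) with has x r
... | true = z≤n
... | false = s≤s (rowOf-append-≤ x j T lt)

rowOf-append-self : ∀ {m} j T → j < length T → Bounded m T → rowOf (suc m) (append (suc m) j T) ≡ j
rowOf-append-self {m} zero (r ∷ T) _ _ rewrite has-++-self (suc m) r = refl
rowOf-append-self {m} (suc j) (r ∷ T) (s≤s lt) (e ∷ es) rewrite has-absent r e = cong suc (rowOf-append-self j T lt es)

rowOf-avoids : ∀ {m} P {k rest T} → Fits (P ++ (k , m) ∷ rest) T → rowOf (suc m) T ≢ length P
rowOf-avoids [] {T = r ∷ T} ((_ , e) ∷ _) eq rewrite has-absent r e = ℕₚ.1+n≢0 eq
rowOf-avoids {m} (_ ∷ P) {T = r ∷ T} (_ ∷ f) eq with has (suc m) r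
... | true = ℕₚ.0≢1+n eq
... | false = rowOf-avoids P f (ℕₚ.suc-injective eq)

-- For an absent entry `rowOf` runs past the end and returns `length T`; an entry that occurs stops
-- it earlier.
rowOf-< : ∀ x T → count x (concat T) ≢ 0 → rowOf x T < length T
rowOf-< x [] ne = ⊥-elim (ne refl)
rowOf-< x (r ∷ T) ne with has x r in eq
... | true = s≤s z≤n
... | false = s≤s (rowOf-< x T (λ e → ne (trans (count-++ x r (concat T)) (cong₂ ℕ._+_ (has-count x r eq) e))))

standard : ℕ → Tableau → Bool
standard m T = all (λ i → count (suc i) (concat T) ≡ᵇ 1) (upTo m)

private
  strict≡weak : ∀ {n} r → Entries n r → (∀ x → 1 ≤ x → x ≤ n → count x r ≤ 1) → strictlyIncreasing r ≡ weaklyIncreasing r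
  strict≡weak [] _ _ = refl
  strict≡weak (a ∷ []) _ _ = refl
  strict≡weak {n} (a ∷ b ∷ r) ((1≤a , a≤n) ∷ e) once = cong₂ _∧_ (compare (ℕ._≟_ a b)) (strict≡weak (b ∷ r) e once′)
    where
    once′ : ∀ x → 1 ≤ x → x ≤ n → count x (b ∷ r) ≤ 1
    once′ x p q = ℕₚ.≤-trans (subst (count x (b ∷ r) ≤_) (sym (count-++ x (a ∷ []) (b ∷ r))) (ℕₚ.m≤n+m _ (count x (a ∷ [])))) (once x p q)
    compare : Relation.Nullary.Dec (a ≡ b) → (a <ᵇ b) ≡ (a ≤ᵇ b)
    compare (yes refl) = ⊥-elim (ℕₚ.<⇒≱ two (once a 1≤a a≤n))
      where
      two : 1 < count a (a ∷ a ∷ r)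
      two rewrite ≡ᵇ-refl a = s≤s (s≤s z≤n)
    compare (no ne) with ℕₚ.<-cmp a b
    ... | tri< lt _ _ = trans (≤⇒≤ᵇ≡true lt) (sym (≤⇒≤ᵇ≡true (ℕₚ.<⇒≤ lt)))
    ... | tri≈ _ eq _ = ⊥-elim (ne eq)
    ... | tri> _ _ gt = trans (<⇒≤ᵇ≡false {suc a} (s≤s (ℕₚ.<⇒≤ gt))) (sym (<⇒≤ᵇ≡false gt))

  all-strict≡weak : ∀ {n} T → Bounded n T → (∀ x → 1 ≤ x → x ≤ n → count x (concat T) ≤ 1) →
                    all strictlyIncreasing T ≡ all weaklyIncreasing T
  all-strict≡weak [] _ _ = refl
  all-strict≡weak (r ∷ T) (e ∷ es) once = cong₂ _∧_
    (strict≡weak r e (λ x p q → ℕₚ.≤-trans (subst (count x r ≤_) (sym (count-++ x r (concat T))) (ℕₚ.m≤m+n _ _)) (once x p q)))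
    (all-strict≡weak T es (λ x p q → ℕₚ.≤-trans (subst (count x (concat T) ≤_) (sym (count-++ x r (concat T))) (ℕₚ.m≤n+m _ (count x r))) (once x p q)))

-- In a standard filling every entry occurs once, so weakly increasing rows are strict. This lets
-- the semistandard sums `B` count standard tableaux too, with standardness moved into the summand.
isSYT-SSYT : ∀ n T → Bounded n T → isSYT n T ≡ isSSYT T ∧ standard n T
isSYT-SSYT n T e with standard n T in eq
... | false = trans (cong (all strictlyIncreasing T ∧_) (∧-zeroʳ _)) (trans (∧-zeroʳ _) (sym (∧-zeroʳ _)))
... | true = trans (cong₂ _∧_ (all-strict≡weak T e once) (∧-identityʳ _)) (sym (∧-identityʳ _))
  where
  once : ∀ x → 1 ≤ x → x ≤ n → count x (concat T) ≤ 1
  once (suc i) _ lt = ℕₚ.≤-reflexive (≡ᵇ≡true⇒≡ _ 1 (all-upTo-elim (λ i → count (suc i) (concat T) ≡ᵇ 1) n eq i lt))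

sum-mid : ∀ pre k post → sum (pre ++ suc k ∷ post) ≡ suc (sum (pre ++ k ∷ post))
sum-mid [] k post = refl
sum-mid (p ∷ pre) k post = trans (cong (p ℕ.+_) (sum-mid pre k post)) (ℕₚ.+-suc p _)

Dec-mid : ∀ {b} pre k post → Dec b (pre ++ k ∷ post) → Dec k post
Dec-mid [] k post (_ , d) = d
Dec-mid (p ∷ pre) k post (_ , d) = Dec-mid pre k post d

Dec-remove : ∀ {b} pre k post → Dec b (pre ++ suc k ∷ post) → hd post ≤ k → Dec b (pre ++ k ∷ post)
Dec-remove [] k post (le , d) h = ℕₚ.≤-trans (ℕₚ.n≤1+n k) le , Dec-hd post d h
Dec-remove (p ∷ pre) k post (le , d) h = le , Dec-remove pre k post d h

-- Removing the largest entry of a standard tableau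

module SYT (𝔸 : ℚAlgebra) (w : ℕ → Bool) where
  open ℚAlgebra 𝔸
  open Solver
  open Sums 𝔸

  -- By `B-peel`, lowering the bound of a row from m + 1 to m loses only tableaux with m + 1 at the
  -- end of that row, and φ vanishes on these by hypothesis. `N` bounds the row indices concerned,
  -- `L` is the number of all rows.
  restrict : ∀ m P mid rest {φ b} N L → All (λ p → proj₂ p ≡ m) P → Dec b (mid ++ rest) →
    length P ℕ.+ length mid ≤ N → length P ℕ.+ length (mid ++ rest) ≡ L →
    (∀ j T → j < N → j < length T → length T ≡ L → φ (append (suc m) j T) ≡ 0#) →
    B [] (P ++ alphabet (suc m) (mid ++ rest)) φ ≡ B [] (P ++ alphabet m mid ++ alphabet (suc m) rest) φ
  restrict m P [] rest N L ms d le eq e = refl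
  restrict m P (k ∷ mid) rest {φ} N L ms (_ , d) le eq e = begin
    B [] (P ++ (k , suc m) ∷ alphabet (suc m) (mid ++ rest)) φ
      ≡⟨ step k d ⟩
    B [] (P ++ (k , m) ∷ alphabet (suc m) (mid ++ rest)) φ
      ≡⟨ cong (λ s → B [] s φ) (++-assoc P ((k , m) ∷ []) _) ⟨
    B [] ((P ++ (k , m) ∷ []) ++ alphabet (suc m) (mid ++ rest)) φ
      ≡⟨ restrict m (P ++ (k , m) ∷ []) mid rest N L (Allₚ.++⁺ ms (refl ∷ [])) d
           (subst (_≤ N) (sym (snoc+ mid)) le) (trans (snoc+ (mid ++ rest)) eq) e ⟩
    B [] ((P ++ (k , m) ∷ []) ++ alphabet m mid ++ alphabet (suc m) rest) φ
      ≡⟨ cong (λ s → B [] s φ) (++-assoc P ((k , m) ∷ []) _) ⟩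
    B [] (P ++ (k , m) ∷ alphabet m mid ++ alphabet (suc m) rest) φ ∎
    where
    snoc+ : ∀ (l : List ℕ) → length (P ++ (k , m) ∷ []) ℕ.+ length l ≡ length P ℕ.+ suc (length l)
    snoc+ l = trans (cong (ℕ._+ length l) (length-++ P)) (ℕₚ.+-assoc (length P) 1 (length l))
    full : ∀ {k a T} → Fits (P ++ (k , a) ∷ alphabet (suc m) (mid ++ rest)) T → length T ≡ L
    full f = trans (Fits-length f) (trans (length-++ P) (trans
      (cong (λ l → length P ℕ.+ suc l) (length-map _ (mid ++ rest))) eq))
    P<N : length P < N
    P<N = ℕₚ.≤-trans (subst (suc (length P) ≤_) (sym (ℕₚ.+-suc (length P) (length mid))) (s≤s (ℕₚ.m≤m+n _ _))) le
    step : ∀ k → Dec k (mid ++ rest) → B [] (P ++ (k , suc m) ∷ alphabet (suc m) (mid ++ rest)) φ ≡ B [] (P ++ (k , m) ∷ alphabet (suc m) (mid ++ rest)) φ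
    step zero d = B-empty-row (suc m) m P [] _
    step (suc k) d = trans (B-peel m P [] k (mid ++ rest) ms [] (Dec⇒hd (mid ++ rest) d))
      (trans (cong₂ _+_ refl (trans
          (cong (when (hd (mid ++ rest) ≤ᵇ k)) (B-zero [] (P ++ (k , suc m) ∷ alphabet (suc m) (mid ++ rest)) (λ T f → e (length P) T P<N (Fits-< P f) (full f))))
          (when-zero (hd (mid ++ rest) ≤ᵇ k))))
        (+-identityʳ _))

  pattern′ : ℕ → Tableau → Bool
  pattern′ m T = all (λ j → isDescent T (suc j) ⇔ᵇ w (suc j)) (upTo (m ∸ 1))

  -- The empty tableau satisfies every ρ. As a result the partial strip sum `G` of an empty shape
  -- does not depend on j, as it must, since no box can be removed.
  lastRow : (ℕ → Bool) → ℕ → Tableau → Bool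
  lastRow ρ zero T = true
  lastRow ρ (suc m) T = ρ (rowOf (suc m) T)

  good : (ℕ → Bool) → ℕ → Tableau → Bool
  good ρ m T = standard m T ∧ pattern′ m T ∧ lastRow ρ m T

  -- Standard tableaux with the prescribed descents whose largest entry lies in a row satisfying ρ.
  K : ℕ → List ℕ → (ℕ → Bool) → Carrier
  K m la ρ = B [] (alphabet m la) (λ T → when (good ρ m T) 1#)

  -- For m ≥ 1, m is a descent of the extended tableau exactly when its row lies above row j.
  -- Prescribing the descent at m thus becomes a condition on the row of the new largest entry m.
  good-append : ∀ m j T → j < length T → Bounded m T →
    good (_≡ᵇ j) (suc m) (append (suc m) j T) ≡ good (λ j′ → (j′ <ᵇ j) ⇔ᵇ w m) m T
  good-append m j T lt e =
    cong₂ _∧_ std-eq (trans (cong₂ _∧_ (pat-eq m T lt e) last-eq) (∧-identityʳ _))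
    where
    ne : ∀ {i} → i < m → suc m ≢ suc i
    ne i<m = ℕₚ.>⇒≢ (s≤s i<m)
    std-eq : standard (suc m) (append (suc m) j T) ≡ standard m T
    std-eq = trans (all-upTo-suc _ m) (trans (cong₂ _∧_
      (all-upTo-cong m (λ i i<m → cong (_≡ᵇ 1) (count-append-other j T (ne i<m))))
      (cong (_≡ᵇ 1) (trans (count-append-self (suc m) j T lt) (cong suc (count-absent-T T e)))))
      (∧-identityʳ _))
    last-eq : (rowOf (suc m) (append (suc m) j T) ≡ᵇ j) ≡ true
    last-eq = trans (cong (_≡ᵇ j) (rowOf-append-self j T lt e)) (≡ᵇ-refl j)
    pat-eq : ∀ m T → j < length T → Bounded m T →
             pattern′ (suc m) (append (suc m) j T) ≡ pattern′ m T ∧ lastRow (λ j′ → (j′ <ᵇ j) ⇔ᵇ w m) m T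
    pat-eq zero T lt e = refl
    pat-eq (suc m) T lt e = trans (all-upTo-suc _ m) (cong₂ _∧_
      (all-upTo-cong m (λ i i<m → cong₂ (λ x y → (x <ᵇ y) ⇔ᵇ w (suc i))
        (rowOf-append-other j T (ℕₚ.>⇒≢ (ℕₚ.m≤n⇒m≤1+n (s≤s i<m))))
        (rowOf-append-other j T (ℕₚ.>⇒≢ (s≤s (s≤s i<m))))))
      (cong₂ (λ x y → (x <ᵇ y) ⇔ᵇ w (suc m)) (rowOf-append-other j T (ℕₚ.>⇒≢ ℕₚ.≤-refl)) (rowOf-append-self j T lt e)))

  private
    not-standard : ∀ ρ m T → count (suc m) (concat T) ≢ 1 → good ρ (suc m) T ≡ false
    not-standard ρ m T ne = cong (_∧ (pattern′ (suc m) T ∧ lastRow ρ (suc m) T)) (trans (all-upTo-suc (λ i → count (suc i) (concat T) ≡ᵇ 1) m)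
      (trans (cong (all (λ i → count (suc i) (concat T) ≡ᵇ 1) (upTo m) ∧_) (≢⇒≡ᵇ≡false ne)) (∧-zeroʳ _)))

    wrong-row : ∀ j m T → rowOf (suc m) T ≢ j → good (_≡ᵇ j) (suc m) T ≡ false
    wrong-row j m T ne = trans (cong (λ b → standard (suc m) T ∧ pattern′ (suc m) T ∧ b) (≢⇒≡ᵇ≡false ne))
      (trans (cong (standard (suc m) T ∧_) (∧-zeroʳ _)) (∧-zeroʳ _))

    length-alphabet : ∀ m pre → length (alphabet m pre) ≡ length pre
    length-alphabet m pre = length-map _ pre

    all-alphabet : ∀ m pre → All (λ p → proj₂ p ≡ m) (alphabet m pre)
    all-alphabet m [] = []
    all-alphabet m (_ ∷ pre) = refl ∷ all-alphabet m pre

  module _ (m : ℕ) (pre post : List ℕ) where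
    private
      j₀ = length pre
      P = alphabet m pre
      φ : Tableau → Carrier
      φ T = when (good (_≡ᵇ j₀) (suc m) T) 1#

      P≡j₀ : length P ≡ j₀
      P≡j₀ = length-alphabet m pre

      avoids : ∀ k s T → Fits (P ++ (k , m) ∷ s) T → φ T ≡ 0#
      avoids k s T f = cong (λ b → when b 1#) (wrong-row j₀ m T (λ eq → rowOf-avoids P f (trans eq (sym P≡j₀))))

      reach : ∀ k {b} → Dec b (pre ++ k ∷ post) →
        K (suc m) (pre ++ k ∷ post) (_≡ᵇ j₀) ≡ B [] (P ++ (k , suc m) ∷ alphabet (suc m) post) φ
      reach k d = restrict m [] pre (k ∷ post) j₀ _ [] d ℕₚ.≤-refl refl (λ j T j<j₀ j<T _ →
        cong (λ b → when b 1#) (wrong-row j₀ m (append (suc m) j T) (λ eq → ℕₚ.<⇒≱ j<j₀ (subst (_≤ j) eq (rowOf-append-≤ (suc m) j T j<T)))))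

    K-zero-row : ∀ {b} → Dec b (pre ++ 0 ∷ post) → K (suc m) (pre ++ 0 ∷ post) (_≡ᵇ j₀) ≡ 0#
    K-zero-row d = trans (reach 0 d) (trans (B-empty-row (suc m) m P [] s) (B-zero [] (P ++ (0 , m) ∷ s) (avoids 0 s)))
      where s = alphabet (suc m) post

    -- Rows above j₀ are cleared of m + 1 because its first occurrence must be in row j₀, rows from
    -- j₀ on because a second m + 1 would not be standard. What remains is to strip the last box of
    -- row j₀, which is possible exactly when the row below is short enough.
    K-step : ∀ k {b} → Dec b (pre ++ suc k ∷ post) →
      K (suc m) (pre ++ suc k ∷ post) (_≡ᵇ j₀)
      ≡ when (hd post ≤ᵇ k) (K m (pre ++ k ∷ post) (λ j → (j <ᵇ j₀) ⇔ᵇ w m))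
    K-step k d = begin
      K (suc m) (pre ++ suc k ∷ post) (_≡ᵇ j₀)
        ≡⟨ reach (suc k) d ⟩
      B [] (P ++ (suc k , suc m) ∷ alphabet (suc m) post) φ
        ≡⟨ B-peel m P [] k post (all-alphabet m pre) [] (Dec⇒hd post (Dec-mid pre (suc k) post d)) ⟩
      B [] (P ++ (suc k , m) ∷ alphabet (suc m) post) φ + when (hd post ≤ᵇ k) (B [] (P ++ (k , suc m) ∷ alphabet (suc m) post) φ′)
        ≡⟨ cong₂ _+_ (B-zero [] (P ++ (suc k , m) ∷ alphabet (suc m) post) (avoids (suc k) (alphabet (suc m) post))) rest ⟩
      0# + when (hd post ≤ᵇ k) (K m (pre ++ k ∷ post) (λ j → (j <ᵇ j₀) ⇔ᵇ w m))
        ≡⟨ +-identityˡ _ ⟩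
      when (hd post ≤ᵇ k) (K m (pre ++ k ∷ post) (λ j → (j <ᵇ j₀) ⇔ᵇ w m)) ∎
      where
      φ′ : Tableau → Carrier
      φ′ T = φ (append (suc m) (length P) T)
      length-append : ∀ x j T → length (append x j T) ≡ length T
      length-append x j [] = refl
      length-append x zero (r ∷ T) = refl
      length-append x (suc j) (r ∷ T) = cong suc (length-append x j T)
      vanish : ∀ j T → length P < length T → j < length T → φ′ (append (suc m) j T) ≡ 0#
      vanish j T P<T j<T = cong (λ b → when b 1#) (not-standard (_≡ᵇ j₀) m (append (suc m) (length P) (append (suc m) j T)) (λ eq → two (trans (sym (trans
          (count-append-self (suc m) (length P) (append (suc m) j T) (subst (length P <_) (sym (length-append (suc m) j T)) P<T))
          (cong suc (count-append-self (suc m) j T j<T)))) eq)))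
        where
        two : ∀ {n} → suc (suc n) ≢ 1
        two ()
      rest : when (hd post ≤ᵇ k) (B [] (P ++ (k , suc m) ∷ alphabet (suc m) post) φ′)
             ≡ when (hd post ≤ᵇ k) (K m (pre ++ k ∷ post) (λ j → (j <ᵇ j₀) ⇔ᵇ w m))
      rest with hd post ≤ᵇ k | ℕₚ.≤ᵇ-reflects-≤ (hd post) k
      ... | false | _ = refl
      ... | true | ofʸ p = begin
        B [] (P ++ alphabet (suc m) (k ∷ post)) φ′
          ≡⟨ cong (λ l → B [] (P ++ alphabet (suc m) l) φ′) (++-identityʳ (k ∷ post)) ⟨
        B [] (P ++ alphabet (suc m) ((k ∷ post) ++ [])) φ′
          ≡⟨ restrict m P (k ∷ post) [] {b = k} N _ (all-alphabet m pre) d′ ℕₚ.≤-refl refl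
               (λ j T _ j<T l → vanish j T (subst (length P <_) (sym l) (ℕₚ.m<m+n (length P) (s≤s z≤n))) j<T) ⟩
        B [] (P ++ alphabet m (k ∷ post) ++ []) φ′
          ≡⟨ cong (λ s → B [] s φ′) (trans (cong (P ++_) (++-identityʳ _)) (sym (map-++ _ pre (k ∷ post)))) ⟩
        B [] (alphabet m (pre ++ k ∷ post)) φ′
          ≡⟨ B-cong [] (alphabet m (pre ++ k ∷ post)) (λ T f → trans
               (cong (λ l → φ (append (suc m) l T)) P≡j₀)
               (cong (λ b → when b 1#) (good-append m j₀ T
                 (subst (j₀ <_) (sym (trans (Fits-length f) (length-alphabet m (pre ++ k ∷ post)))) (length-mid-< pre)) (Fits-bounded (pre ++ k ∷ post) f)))) ⟩
        K m (pre ++ k ∷ post) (λ j → (j <ᵇ j₀) ⇔ᵇ w m) ∎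
        where
        N = length P ℕ.+ length (k ∷ post)
        d′ : Dec k ((k ∷ post) ++ [])
        d′ = subst (Dec k) (sym (++-identityʳ (k ∷ post))) (ℕₚ.≤-refl , Dec-hd post (Dec-mid pre (suc k) post d) p)

  K-cong : ∀ m la {ρ σ} → (∀ j → ρ j ≡ σ j) → K m la ρ ≡ K m la σ
  K-cong zero la e = refl
  K-cong (suc m) la e = B-cong [] (alphabet (suc m) la) (λ T _ →
    cong (λ b → when (standard (suc m) T ∧ pattern′ (suc m) T ∧ b) 1#) (e (rowOf (suc m) T)))

  private
    when-split : ∀ a b c → c ≡ a ∨ b → a ∧ b ≡ false → ∀ s p x → when (s ∧ p ∧ c) x ≡ when (s ∧ p ∧ a) x + when (s ∧ p ∧ b) x
    when-split true false _ refl _ true true x = sym (+-identityʳ _)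
    when-split false true _ refl _ true true x = sym (+-identityˡ _)
    when-split false false _ refl _ true true x = sym (+-identityˡ _)
    when-split a b _ refl _ true false x = sym (+-identityˡ _)
    when-split a b _ refl _ false p x = sym (+-identityˡ _)

    <-or-≡ : ∀ x j → (x <ᵇ suc j) ≡ (x <ᵇ j) ∨ (x ≡ᵇ j)
    <-or-≡ zero zero = refl
    <-or-≡ zero (suc j) = refl
    <-or-≡ (suc x) zero = refl
    <-or-≡ (suc x) (suc j) = <-or-≡ x j

    <-and-≡ : ∀ x j → (x <ᵇ j) ∧ (x ≡ᵇ j) ≡ false
    <-and-≡ zero zero = refl
    <-and-≡ zero (suc j) = refl
    <-and-≡ (suc x) zero = refl
    <-and-≡ (suc x) (suc j) = <-and-≡ x j

    ≥-or-≡ : ∀ x j → not (x <ᵇ j) ≡ not (x <ᵇ suc j) ∨ (x ≡ᵇ j)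
    ≥-or-≡ zero zero = refl
    ≥-or-≡ zero (suc j) = refl
    ≥-or-≡ (suc x) zero = refl
    ≥-or-≡ (suc x) (suc j) = ≥-or-≡ x j

    ≥-and-≡ : ∀ x j → not (x <ᵇ suc j) ∧ (x ≡ᵇ j) ≡ false
    ≥-and-≡ zero zero = refl
    ≥-and-≡ zero (suc j) = refl
    ≥-and-≡ (suc x) zero = refl
    ≥-and-≡ (suc x) (suc j) = ≥-and-≡ x j

  K-split : ∀ m la {ρ σ τ} → (∀ j → τ j ≡ ρ j ∨ σ j) → (∀ j → ρ j ∧ σ j ≡ false) → K (suc m) la τ ≡ K (suc m) la ρ + K (suc m) la σ
  K-split m la e d = trans
    (B-cong [] (alphabet (suc m) la) (λ T _ → when-split _ _ _ (e (rowOf (suc m) T)) (d (rowOf (suc m) T)) (standard (suc m) T) (pattern′ (suc m) T) 1#))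
    (B-+ [] (alphabet (suc m) la))

  K-< : ∀ m la j → K (suc m) la (_<ᵇ suc j) ≡ K (suc m) la (_<ᵇ j) + K (suc m) la (_≡ᵇ j)
  K-< m la j = K-split m la {_<ᵇ j} {_≡ᵇ j} {_<ᵇ suc j} (λ x → <-or-≡ x j) (λ x → <-and-≡ x j)

  K-≥ : ∀ m la j → K (suc m) la (λ x → not (x <ᵇ j)) ≡ K (suc m) la (λ x → not (x <ᵇ suc j)) + K (suc m) la (_≡ᵇ j)
  K-≥ m la j = K-split m la {λ x → not (x <ᵇ suc j)} {_≡ᵇ j} {λ x → not (x <ᵇ j)} (λ x → ≥-or-≡ x j) (λ x → ≥-and-≡ x j)

  -- Telescoping of the strip sums with weight 𝕚 per box

  module _ (𝕚 : Carrier) (𝕚² : 𝕚 * 𝕚 ≡ - 1#) (w-suc : ∀ m → w (suc m) ≡ not (w m)) where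
    open Strip _+_ (𝕚 *_) 0#

    -- Closed form of the partial strip sums: boxes have been removed from rows of index ≥ j only.
    G : ℕ → List ℕ → ℕ → Carrier
    G m la j = if w m then K m la (_<ᵇ j) else 𝕚 * K m la (λ j′ → not (j′ <ᵇ j))

    G-same : ∀ m la j → K (suc m) la (_≡ᵇ j) ≡ 0# → G (suc m) la (suc j) ≡ G (suc m) la j
    G-same m la j z with w (suc m)
    ... | true = trans (K-< m la j) (trans (cong₂ _+_ refl z) (+-identityʳ _))
    ... | false = sym (cong (𝕚 *_) (trans (K-≥ m la j) (trans (cong₂ _+_ refl z) (+-identityʳ _))))

    G-zero : ∀ la j j′ → G 0 la j ≡ G 0 la j′
    G-zero la j j′ with w 0
    ... | true = refl
    ... | false = refl

    -- The hypothesis, supplied by `K-step`, evaluates the number of tableaux with largest entry in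
    -- row j. If `w m` holds, this number is what row ≥ j + 1 lacks to row ≥ j, and both terms carry
    -- the weight 𝕚. Otherwise it enters with 𝕚 · 𝕚 = -1 and cuts row < j + 1 down to row < j.
    G-step : ∀ m la μ j → K (suc m) la (_≡ᵇ j) ≡ K m μ (λ j′ → (j′ <ᵇ j) ⇔ᵇ w m) →
      G (suc m) la (suc j) + 𝕚 * G m μ j ≡ G (suc m) la j
    G-step m la μ j e rewrite w-suc m with w m
    ... | true = begin
      𝕚 * K (suc m) la (λ x → not (x <ᵇ suc j)) + 𝕚 * K m μ (_<ᵇ j)
        ≡⟨ solve 3 (λ i a b → i :* a :+ i :* b := i :* (a :+ b)) refl 𝕚 _ _ ⟩
      𝕚 * (K (suc m) la (λ x → not (x <ᵇ suc j)) + K m μ (_<ᵇ j))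
        ≡⟨ cong (λ x → 𝕚 * (K (suc m) la (λ x → not (x <ᵇ suc j)) + x)) (trans (K-cong m μ (λ x → sym (⇔-true (x <ᵇ j)))) (sym e)) ⟩
      𝕚 * (K (suc m) la (λ x → not (x <ᵇ suc j)) + K (suc m) la (_≡ᵇ j))
        ≡⟨ cong (𝕚 *_) (K-≥ m la j) ⟨
      𝕚 * K (suc m) la (λ x → not (x <ᵇ j)) ∎
      where
      ⇔-true : ∀ b → (b ⇔ᵇ true) ≡ b
      ⇔-true true = refl
      ⇔-true false = refl
    ... | false = begin
      K (suc m) la (_<ᵇ suc j) + 𝕚 * (𝕚 * K m μ (λ x → not (x <ᵇ j)))
        ≡⟨ cong₂ (λ x y → x + 𝕚 * (𝕚 * y)) (K-< m la j)
             (trans (K-cong m μ (λ x → sym (⇔-false (x <ᵇ j)))) (sym e)) ⟩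
      K (suc m) la (_<ᵇ j) + k + 𝕚 * (𝕚 * k)
        ≡⟨ solve 3 (λ a k i → a :+ k :+ i :* (i :* k) := a :+ k :+ (i :* i) :* k) refl _ k 𝕚 ⟩
      K (suc m) la (_<ᵇ j) + k + (𝕚 * 𝕚) * k
        ≡⟨ cong (λ x → K (suc m) la (_<ᵇ j) + k + x * k) 𝕚² ⟩
      K (suc m) la (_<ᵇ j) + k + (- 1#) * k
        ≡⟨ solve 2 (λ a k → a :+ k :+ (:con (ℚ.- 1ℚ) :* :con 1ℚ) :* k := a) refl _ k ⟩
      K (suc m) la (_<ᵇ j) ∎
      where
      k = K (suc m) la (_≡ᵇ j)
      ⇔-false : ∀ b → (b ⇔ᵇ false) ≡ not b
      ⇔-false true = refl
      ⇔-false false = refl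

    f : List ℕ → Carrier
    f la = G (sum la) la (length la)

    -- The rows in `pre` are frozen. Keeping row j = `length pre` leads to G at j + 1, removing a
    -- box from it to 𝕚 times G at j for the smaller shape, and `G-step` adds the two. If no box can
    -- be removed, the largest entry cannot lie in row j and `G-same` applies.
    Z-G : ∀ pre post {b} → Dec b (pre ++ post) → Z (λ μ → f (pre ++ μ)) post ≡ G (sum (pre ++ post)) (pre ++ post) (length pre)
    Zrow-G : ∀ pre post k {b} → Dec b (pre ++ k ∷ post) →
      Zrow (λ μ → f (pre ++ μ)) post k ≡ G (sum (pre ++ k ∷ post)) (pre ++ k ∷ post) (length pre)
    Z-G pre [] d = cong (G (sum (pre ++ [])) (pre ++ [])) (cong length (++-identityʳ pre))
    Z-G pre (k ∷ post) d = Zrow-G pre post k d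

    private
      keep : ∀ pre post k {b} → Dec b (pre ++ k ∷ post) →
        Z (λ μ → f (pre ++ k ∷ μ)) post ≡ G (sum (pre ++ k ∷ post)) (pre ++ k ∷ post) (suc (length pre))
      keep pre post k {b} d = begin
        Z (λ μ → f (pre ++ k ∷ μ)) post
          ≡⟨ Z-cong post (Dec-mid pre k post d) (λ μ _ _ _ → cong f (sym (++-assoc pre (k ∷ []) μ))) ⟩
        Z (λ μ → f ((pre ++ k ∷ []) ++ μ)) post
          ≡⟨ Z-G (pre ++ k ∷ []) post (subst (Dec b) (sym (++-assoc pre (k ∷ []) post)) d) ⟩
        G (sum ((pre ++ k ∷ []) ++ post)) ((pre ++ k ∷ []) ++ post) (length (pre ++ k ∷ []))
          ≡⟨ cong₂ (λ l j → G (sum l) l j) (++-assoc pre (k ∷ []) post) (trans (length-++ pre) (ℕₚ.+-comm (length pre) 1)) ⟩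
        G (sum (pre ++ k ∷ post)) (pre ++ k ∷ post) (suc (length pre)) ∎

    Zrow-G pre post zero {b} d = trans (keep pre post 0 d) (go (sum (pre ++ 0 ∷ post)))
      where
      go : ∀ n → G n (pre ++ 0 ∷ post) (suc (length pre)) ≡ G n (pre ++ 0 ∷ post) (length pre)
      go zero = G-zero (pre ++ 0 ∷ post) (suc (length pre)) (length pre)
      go (suc m) = G-same m (pre ++ 0 ∷ post) (length pre) (K-zero-row m pre post d)
    Zrow-G pre post (suc k) {b} d = trans (cong₂ _+_ (keep pre post (suc k) d) refl)
      (trans (cong (λ n → G n la (suc (length pre)) + (if hd post ≤ᵇ k then 𝕚 * Zrow (λ μ → f (pre ++ μ)) post k else 0#)) (sum-mid pre k post))
        (trans (rest (K-step (sum μ) pre post k d)) (cong (λ n → G n la (length pre)) (sym (sum-mid pre k post)))))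
      where
      la = pre ++ suc k ∷ post
      μ = pre ++ k ∷ post
      rest : K (suc (sum μ)) la (_≡ᵇ length pre) ≡ when (hd post ≤ᵇ k) (K (sum μ) μ (λ j → (j <ᵇ length pre) ⇔ᵇ w (sum μ))) →
        G (suc (sum μ)) la (suc (length pre)) + (if hd post ≤ᵇ k then 𝕚 * Zrow (λ μ → f (pre ++ μ)) post k else 0#)
        ≡ G (suc (sum μ)) la (length pre)
      rest e with hd post ≤ᵇ k | ℕₚ.≤ᵇ-reflects-≤ (hd post) k
      ... | true | ofʸ p = trans (cong (λ x → G (suc (sum μ)) la (suc (length pre)) + 𝕚 * x) (Zrow-G pre post k (Dec-remove pre k post d p)))
        (G-step (sum μ) la μ (length pre) e)
      ... | false | _ = trans (+-identityʳ _) (G-same (sum μ) la (length pre) e)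

    number : List ℕ → Carrier
    number la = K (sum la) la (const true)

    number-empty : ∀ la ρ → sum la ≡ 0 → K 0 la ρ ≡ 1#
    number-empty [] ρ e = refl
    number-empty (zero ∷ la) ρ e = trans (+-identityʳ _) (number-empty la ρ e)

    private
      K-none : ∀ m la {ρ} → (∀ j → ρ j ≡ false) → K (suc m) la ρ ≡ 0#
      K-none m la {ρ} e = B-zero [] (alphabet (suc m) la) (λ T _ → cong (λ b → when b 1#)
        (trans (cong (λ b → standard (suc m) T ∧ pattern′ (suc m) T ∧ b) (e (rowOf (suc m) T)))
          (trans (cong (standard (suc m) T ∧_) (∧-zeroʳ _)) (∧-zeroʳ _))))

      <⇒<ᵇ≡true : ∀ {x y} → x < y → (x <ᵇ y) ≡ true
      <⇒<ᵇ≡true {x} = ≤⇒≤ᵇ≡true {suc x}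

      occupied : ∀ m la (ρ σ : ℕ → Bool) → (∀ j → j < length la → ρ j ≡ σ j) → K (suc m) la ρ ≡ K (suc m) la σ
      occupied m la ρ σ e = B-cong [] (alphabet (suc m) la) (λ T f → go T (trans (Fits-length f) (length-alphabet (suc m) la)))
        where
        go : ∀ T → length T ≡ length la → when (good ρ (suc m) T) 1# ≡ when (good σ (suc m) T) 1#
        go T l with standard (suc m) T in eq
        ... | false = refl
        ... | true = cong (λ b → when (pattern′ (suc m) T ∧ b) 1#) (e (rowOf (suc m) T) (subst (rowOf (suc m) T <_) l
          (rowOf-< (suc m) T (λ z → one z (≡ᵇ≡true⇒≡ _ 1 (all-upTo-elim (λ i → count (suc i) (concat T) ≡ᵇ 1) (suc m) eq m ℕₚ.≤-refl))))))
          where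
          one : ∀ {n} → n ≡ 0 → n ≢ 1
          one refl ()

    -- At j = `length la` the condition row < j always holds and row ≥ j never does; at j = 0, in
    -- `Zf-suc`, it is the reverse. So f lives on the sizes n ≥ 1 with `w n` and `Z f` on those
    -- without it, each carrying the tableau counts.
    f-suc : ∀ la n → sum la ≡ suc n → f la ≡ when (w (suc n)) (number la)
    f-suc la n e rewrite e with w (suc n)
    ... | true = occupied n la (_<ᵇ length la) (const true) (λ j lt → <⇒<ᵇ≡true lt)
    ... | false = trans (cong (𝕚 *_) (trans (occupied n la (λ j → not (j <ᵇ length la)) (const false) (λ j lt → cong not (<⇒<ᵇ≡true lt)))
        (K-none n la (λ _ → refl)))) (zeroʳ 𝕚)

    f-zero : ∀ la → sum la ≡ 0 → f la ≡ (if w 0 then 1# else 𝕚)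
    f-zero la e rewrite e with w 0
    ... | true = number-empty la (_<ᵇ length la) e
    ... | false = trans (cong (𝕚 *_) (number-empty la (λ j → not (j <ᵇ length la)) e)) (*-identityʳ 𝕚)

    Zf-suc : ∀ la n {b} → Dec b la → sum la ≡ suc n → Z f la ≡ when (not (w (suc n))) (𝕚 * number la)
    Zf-suc la n d e = trans (Z-G [] la d) (trans (cong (λ m → G m la 0) e) (trans (go n)
        (cong (λ m → when (not (w (suc n))) (𝕚 * K m la (const true))) (sym e))))
      where
      go : ∀ n → G (suc n) la 0 ≡ when (not (w (suc n))) (𝕚 * K (suc n) la (const true))
      go n with w (suc n)
      ... | true = K-none n la (λ _ → refl)
      ... | false = refl

    Zf-zero : ∀ la {b} → Dec b la → sum la ≡ 0 → Z f la ≡ (if w 0 then 1# else 𝕚)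
    Zf-zero la d e = trans (Z-G [] la d) (trans (cong (λ m → G m la 0) e) (trans (G-zero la 0 (length la))
      (trans (cong (λ m → G m la (length la)) (sym e)) (f-zero la e))))

  number-filter : ∀ la → sumOver (filterᵇ (pattern′ (sum la)) (SYTs la)) (λ _ → 1#) ≡ K (sum la) la (const true)
  number-filter la = begin
    sumOver (filterᵇ (pattern′ n) (SYTs la)) (λ _ → 1#)
      ≡⟨ sumOver-filter (pattern′ n) (SYTs la) ⟩
    sumOver (SYTs la) (λ T → when (pattern′ n T) 1#)
      ≡⟨ sumOver-filter (isSYT n) (fillings la n) ⟩
    sumOver (fillings la n) (λ T → when (isSYT n T) (when (pattern′ n T) 1#))
      ≡⟨ fillings-cong n la (λ T f → trans (cong (λ b → when b (when (pattern′ n T) 1#)) (isSYT-SSYT n T (Fits-bounded la f)))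
           (regroup (isSSYT T) (standard n T) (pattern′ n T) (lastRow (const true) n T) (last-true n T))) ⟩
    sumOver (fillings la n) (λ T → when (isSSYT T) (when (good (const true) n T) 1#))
      ≡⟨ sumOver-SSYT n la ⟩
    K n la (const true) ∎
    where
    n = sum la
    last-true : ∀ n T → lastRow (const true) n T ≡ true
    last-true zero T = refl
    last-true (suc n) T = refl
    regroup : ∀ a b c d → d ≡ true → when (a ∧ b) (when c 1#) ≡ when a (when (b ∧ c ∧ d) 1#)
    regroup true true true _ refl = refl
    regroup true true false _ refl = refl
    regroup true false c _ refl = refl
    regroup false b c _ refl = refl

-- Univariate polynomials and linear functionals

private
  maxℚ : List ℚ → ℚ
  maxℚ [] = 0ℚ
  maxℚ (q ∷ l) = q ℚ.⊔ maxℚ l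

  ≤-maxℚ : ∀ l → All (ℚ._≤ maxℚ l) l
  ≤-maxℚ [] = []
  ≤-maxℚ (q ∷ l) = ℚₚ.p≤p⊔q q (maxℚ l) ∷ All.map (λ le → ℚₚ.≤-trans le (ℚₚ.p≤q⊔p q (maxℚ l))) (≤-maxℚ l)

  x<x+1 : ∀ x → x ℚ.< x ℚ.+ 1ℚ
  x<x+1 x = subst (ℚ._< x ℚ.+ 1ℚ) (ℚₚ.+-identityʳ x) (ℚₚ.+-monoʳ-< x (ℚₚ.positive⁻¹ 1ℚ))

fresh : ∀ l → ∃ λ x → All (x ≢_) l
fresh l = maxℚ l ℚ.+ 1ℚ , All.map (λ le eq → ℚₚ.<⇒≢ (ℚₚ.≤-<-trans le (x<x+1 (maxℚ l))) (sym eq)) (≤-maxℚ l)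

freshes : ∀ n bad → ∃ λ rs → length rs ≡ n × AllPairs _≢_ rs × All (λ r → All (r ≢_) bad) rs
freshes zero bad = [] , refl , [] , []
freshes (suc n) bad with fresh bad
... | x , x∉ with freshes n (x ∷ bad)
... | rs , l , dis , ok = x ∷ rs , cong suc l , All.map (λ { (r≢x ∷ _) eq → r≢x (sym eq) }) ok ∷ dis
                        , x∉ ∷ All.map (λ { (_ ∷ a) → a }) ok

module Univariate (𝔸 : ℚAlgebra) where
  open ℚAlgebra 𝔸
  open Solver

  private
    variable
      u v : ℕ → Carrier

  -- The linear functional E^k ↦ u k on polynomials given by their coefficient lists.
  L : (ℕ → Carrier) → List Carrier → Carrier
  L u [] = 0#
  L u (a ∷ p) = a * u 0 + L (u ∘ suc) p

  ev : Carrier → List Carrier → Carrier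
  ev z = L (z ^_)

  emb : List ℚ → List Carrier
  emb = map ι

  L-cong : ∀ p → (∀ k → u k ≡ v k) → L u p ≡ L v p
  L-cong [] e = refl
  L-cong (a ∷ p) e = cong₂ _+_ (cong (a *_) (e 0)) (L-cong p (e ∘ suc))

  L-linear : ∀ p c → L (λ k → u k + c * v k) p ≡ L u p + c * L v p
  L-linear [] c = solve 1 (λ c → :con 0ℚ := :con 0ℚ :+ c :* :con 0ℚ) refl c
  L-linear {u} {v} (a ∷ p) c = trans (cong₂ _+_ refl (L-linear p c))
    (solve 6 (λ a u v c x y → a :* (u :+ c :* v) :+ (x :+ c :* y) := (a :* u :+ x) :+ c :* (a :* v :+ y)) refl
      a (u 0) (v 0) c _ _)

  L-scale : ∀ p c → L (λ k → c * u k) p ≡ c * L u p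
  L-scale [] c = sym (zeroʳ c)
  L-scale {u} (a ∷ p) c = trans (cong₂ _+_ refl (L-scale p c))
    (solve 4 (λ a u c x → a :* (c :* u) :+ c :* x := c :* (a :* u :+ x)) refl a (u 0) c _)

  ev-∷ : ∀ z a p → ev z (a ∷ p) ≡ a + z * ev z p
  ev-∷ z a p = cong₂ _+_ (*-identityʳ a) (L-scale p z)

  addL : List Carrier → List Carrier → List Carrier
  addL [] q = q
  addL (a ∷ p) [] = a ∷ p
  addL (a ∷ p) (b ∷ q) = (a + b) ∷ addL p q

  scaleL : Carrier → List Carrier → List Carrier
  scaleL c = map (c *_)

  L-add : ∀ p q → L u (addL p q) ≡ L u p + L u q
  L-add [] q = sym (+-identityˡ _)
  L-add (a ∷ p) [] = sym (+-identityʳ _)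
  L-add {u} (a ∷ p) (b ∷ q) = trans (cong₂ _+_ refl (L-add p q))
    (solve 5 (λ a b u x y → (a :+ b) :* u :+ (x :+ y) := (a :* u :+ x) :+ (b :* u :+ y)) refl a b (u 0) _ _)

  L-scaleL : ∀ c p → L u (scaleL c p) ≡ c * L u p
  L-scaleL c [] = sym (zeroʳ c)
  L-scaleL {u} c (a ∷ p) = trans (cong₂ _+_ refl (L-scaleL c p))
    (solve 4 (λ c a u x → c :* a :* u :+ c :* x := c :* (a :* u :+ x)) refl c a (u 0) _)

  emb-addE : ∀ p q → emb (addE p q) ≡ addL (emb p) (emb q)
  emb-addE [] q = refl
  emb-addE (a ∷ p) [] = refl
  emb-addE (a ∷ p) (b ∷ q) = cong₂ _∷_ (ι-+ a b) (emb-addE p q)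

  emb-scaleE : ∀ c p → emb (scaleE c p) ≡ scaleL (ι c) (emb p)
  emb-scaleE c [] = refl
  emb-scaleE c (a ∷ p) = cong₂ _∷_ (ι-* c a) (emb-scaleE c p)

  ev-addE : ∀ z p q → ev z (emb (addE p q)) ≡ ev z (emb p) + ev z (emb q)
  ev-addE z p q = trans (cong (ev z) (emb-addE p q)) (L-add (emb p) (emb q))

  ev-mulE : ∀ z p q → ev z (emb (mulE p q)) ≡ ev z (emb p) * ev z (emb q)
  ev-mulE z [] q = sym (zeroˡ _)
  ev-mulE z (a ∷ p) q = begin
    ev z (emb (addE (scaleE a q) (0ℚ ∷ mulE p q)))              ≡⟨ ev-addE z (scaleE a q) (0ℚ ∷ mulE p q) ⟩
    ev z (emb (scaleE a q)) + ev z (0# ∷ emb (mulE p q))        ≡⟨ cong₂ _+_ (trans (cong (ev z) (emb-scaleE a q)) (L-scaleL (ι a) (emb q)))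
                                                                     (trans (ev-∷ z 0# (emb (mulE p q))) (cong (λ x → 0# + z * x) (ev-mulE z p q))) ⟩
    ι a * ev z (emb q) + (0# + z * (ev z (emb p) * ev z (emb q))) ≡⟨ solve 4 (λ a y z x → a :* y :+ (:con 0ℚ :+ z :* (x :* y)) := (a :+ z :* x) :* y) refl (ι a) _ z _ ⟩
    (ι a + z * ev z (emb p)) * ev z (emb q)                     ≡⟨ cong (_* ev z (emb q)) (ev-∷ z (ι a) (emb p)) ⟨
    ev z (emb (a ∷ p)) * ev z (emb q)                           ∎

  ev-con : ∀ z c → ev z (emb (c ∷ [])) ≡ ι c
  ev-con z c = trans (+-identityʳ _) (*-identityʳ _)

  -- Lists may end in zeros, so being the zero polynomial is a property of the entries and not
  -- equality with `[]`.
  AllZero : List Carrier → Set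
  AllZero = All (_≡ 0#)

  L-AllZero : ∀ u {p} → AllZero p → L u p ≡ 0#
  L-AllZero u [] = refl
  L-AllZero u (e ∷ es) = trans (cong₂ _+_ (trans (cong (_* u 0) e) (zeroˡ _)) (L-AllZero (u ∘ suc) es)) (+-identityˡ _)

  -- Horner's scheme: the coefficients of the quotient by E - r are the values at r of the tails of
  -- the list.
  quotient : Carrier → List Carrier → List Carrier
  quotient r [] = []
  quotient r (a ∷ []) = []
  quotient r (a ∷ b ∷ p) = ev r (b ∷ p) ∷ quotient r (b ∷ p)

  ev-quotient : ∀ z r p → ev z p ≡ ev r p + (z - r) * ev z (quotient r p)
  ev-quotient z r [] = solve 2 (λ z r → :con 0ℚ := :con 0ℚ :+ (z :- r) :* :con 0ℚ) refl z r
  ev-quotient z r (a ∷ []) = solve 3 (λ a z r → a :* :con 1ℚ :+ :con 0ℚ := a :* :con 1ℚ :+ :con 0ℚ :+ (z :- r) :* :con 0ℚ) refl a z r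
  ev-quotient z r (a ∷ p@(b ∷ p′)) = begin
    ev z (a ∷ p)                                     ≡⟨ ev-∷ z a p ⟩
    a + z * ev z p                                   ≡⟨ cong (λ x → a + z * x) (ev-quotient z r p) ⟩
    a + z * (ev r p + (z - r) * ev z (quotient r p)) ≡⟨ solve 5 (λ a z r x y → a :+ z :* (x :+ (z :- r) :* y) := (a :+ r :* x) :+ (z :- r) :* (x :+ z :* y)) refl a z r _ _ ⟩
    (a + r * ev r p) + (z - r) * (ev r p + z * ev z (quotient r p)) ≡⟨ cong₂ (λ x y → x + (z - r) * y) (ev-∷ r a p) (ev-∷ z (ev r p) (quotient r p)) ⟨
    ev r (a ∷ p) + (z - r) * ev z (quotient r (a ∷ p)) ∎

  AllZero-quotient : ∀ r p → ev r p ≡ 0# → AllZero (quotient r p) → AllZero p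
  AllZero-quotient r [] _ _ = []
  AllZero-quotient r (a ∷ []) e _ = trans (sym (trans (+-identityʳ _) (*-identityʳ _))) e ∷ []
  AllZero-quotient r (a ∷ p@(b ∷ p′)) e (e′ ∷ es) =
    (begin a              ≡⟨ solve 2 (λ a r → a := a :+ r :* :con 0ℚ) refl a r ⟩
           a + r * 0#     ≡⟨ cong (λ x → a + r * x) e′ ⟨
           a + r * ev r p ≡⟨ ev-∷ r a p ⟨
           ev r (a ∷ p)   ≡⟨ e ⟩
           0#             ∎)
    ∷ AllZero-quotient r p e′ es

  ι-cancel : ∀ {q x} → q ≢ 0ℚ → ι q * x ≡ 0# → x ≡ 0#
  ι-cancel {q} {x} q≢0 e = begin
    x                       ≡⟨ *-identityˡ x ⟨
    1# * x                  ≡⟨ cong (λ y → ι y * x) (ℚₚ.*-inverseˡ q) ⟨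
    ι (ℚ.1/ q ℚ.* q) * x    ≡⟨ cong (_* x) (ι-* _ q) ⟩
    ι (ℚ.1/ q) * ι q * x    ≡⟨ *-assoc _ _ _ ⟩
    ι (ℚ.1/ q) * (ι q * x)  ≡⟨ cong (ι (ℚ.1/ q) *_) e ⟩
    ι (ℚ.1/ q) * 0#         ≡⟨ zeroʳ _ ⟩
    0#                      ∎
    where instance _ = ℚ.≢-nonZero q≢0

  private
    length-quotient : ∀ r a p → length (quotient r (a ∷ p)) ≡ length p
    length-quotient r a [] = refl
    length-quotient r a (b ∷ p) = cong suc (length-quotient r b p)

    ι-sub : ∀ s r → ι s - ι r ≡ ι (s ℚ.- r)
    ι-sub s r = sym (trans (ι-+ s (ℚ.- r)) (cong (ι s +_) (ι-neg r)))

    sub≢0 : ∀ {r s} → r ≢ s → s ℚ.- r ≢ 0ℚ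
    sub≢0 {r} {s} ne e = ne (sym (ℚAlgebra.x-y≡0⇒x≡y ℚ-algebra (trans (cong (s ℚ.+_) (trans (sym (ℚₚ.neg-distribˡ-* 1ℚ r)) (cong ℚ.-_ (ℚₚ.*-identityˡ r)))) e)))

  -- The algebra may have zero divisors, as the dual numbers do. Division by E - r still works
  -- because the roots are rational and differences of distinct rationals are units.
  too-many-roots : ∀ rs p → AllPairs _≢_ rs → length p ≤ length rs → All (λ r → ev (ι r) p ≡ 0#) rs → AllZero p
  too-many-roots rs [] _ _ _ = []
  too-many-roots (r ∷ rs) p@(a ∷ p′) (r≢ ∷ dis) (s≤s le) (e ∷ es) =
    AllZero-quotient (ι r) p e (too-many-roots rs (quotient (ι r) p) dis
      (subst (_≤ length rs) (sym (length-quotient (ι r) a p′)) le)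
      (All.zipWith (λ {s} (r≢s , e′) → ι-cancel (sub≢0 r≢s) (begin
          ι (s ℚ.- r) * ev (ι s) (quotient (ι r) p)            ≡⟨ cong (_* ev (ι s) (quotient (ι r) p)) (ι-sub s r) ⟨
          (ι s - ι r) * ev (ι s) (quotient (ι r) p)            ≡⟨ +-identityˡ _ ⟨
          0# + (ι s - ι r) * ev (ι s) (quotient (ι r) p)       ≡⟨ cong (_+ (ι s - ι r) * ev (ι s) (quotient (ι r) p)) e ⟨
          ev (ι r) p + (ι s - ι r) * ev (ι s) (quotient (ι r) p) ≡⟨ ev-quotient (ι s) (ι r) p ⟨
          ev (ι s) p                                           ≡⟨ e′ ⟩
          0#                                                   ∎)) (r≢ , es)))

  vanishing : ∀ bad p → (∀ q → All (q ≢_) bad → ev (ι q) p ≡ 0#) → AllZero p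
  vanishing bad p e with freshes (length p) bad
  ... | rs , l , dis , ok = too-many-roots rs p dis (ℕₚ.≤-reflexive (sym l)) (All.map (λ {q} a → e q a) ok)

  -- The passage from points to functionals: the difference has every rational as a root, so all its
  -- coefficients are 0 and any functional annihilates it. Evaluation at a point is multiplicative,
  -- which makes the hypothesis accessible to ring identities.
  transfer : ∀ p q → (∀ r → ev (ι r) p ≡ ev (ι r) q) → ∀ u → L u p ≡ L u q
  transfer p q e u = x-y≡0⇒x≡y (trans (sym (difference u)) (L-AllZero u (vanishing [] d
      (λ r _ → trans (difference (ι r ^_)) (trans (cong (_- ev (ι r) q) (e r)) (x-x≡0 _))))))
    where
    d = addL p (scaleL (ι (ℚ.- 1ℚ)) q)
    difference : ∀ u → L u d ≡ L u p - L u q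
    difference u = trans (L-add p _) (cong₂ _+_ refl (L-scaleL _ q))

  -- T c u k is the value of the functional u on (E + c)^k.
  T : Carrier → (ℕ → Carrier) → ℕ → Carrier
  T c u zero = u 0
  T c u (suc k) = T c (λ j → u (suc j) + c * u j) k

  T-cong : ∀ c k → (∀ j → u j ≡ v j) → T c u k ≡ T c v k
  T-cong c zero e = e 0
  T-cong c (suc k) e = T-cong c k (λ j → cong₂ (λ x y → x + c * y) (e (suc j)) (e j))

  T-linear : ∀ c d k → T c (λ j → u j + d * v j) k ≡ T c u k + d * T c v k
  T-linear c d zero = refl
  T-linear {u} {v} c d (suc k) = trans
    (T-cong c k (λ j → solve 6 (λ c d u v u′ v′ → (u :+ d :* v) :+ c :* (u′ :+ d :* v′) := (u :+ c :* u′) :+ d :* (v :+ c :* v′)) refl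
      c d (u (suc j)) (v (suc j)) (u j) (v j)))
    (T-linear c d k)

  T-scale : ∀ c d k → T c (λ j → d * u j) k ≡ d * T c u k
  T-scale c d zero = refl
  T-scale {u} c d (suc k) = trans
    (T-cong c k (λ j → solve 4 (λ c d u u′ → d :* u :+ c :* (d :* u′) := d :* (u :+ c :* u′)) refl c d (u (suc j)) (u j)))
    (T-scale c d k)

  T-pow : ∀ c z k → T c (z ^_) k ≡ (z + c) ^ k
  T-pow c z zero = refl
  T-pow c z (suc k) = trans
    (T-cong c k (λ j → solve 3 (λ c z p → z :* p :+ c :* p := (z :+ c) :* p) refl c z (z ^ j)))
    (trans (T-scale c (z + c) k) (cong ((z + c) *_) (T-pow c z k)))

  T-compose : ∀ c d u k → T c (T d u) k ≡ T (c + d) u k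
  T-compose c d u zero = refl
  T-compose c d u (suc k) = trans
    (T-cong c k (λ j → trans (sym (T-linear d c j))
      (T-cong d j (λ i → solve 4 (λ c d x y → (x :+ d :* y) :+ c :* y := x :+ (c :+ d) :* y) refl c d (u (suc i)) (u i)))))
    (T-compose c d (λ i → u (suc i) + (c + d) * u i) k)

  T-zero : ∀ c u k → (∀ j → j < k → u j ≡ 0#) → T c u k ≡ u k
  T-zero c u zero e = refl
  T-zero c u (suc k) e = trans
    (T-zero c _ k (λ j j<k → trans (cong₂ (λ x y → x + c * y) (e (suc j) (s≤s j<k)) (e j (ℕₚ.m≤n⇒m≤1+n j<k))) (collapse c)))
    (trans (cong (λ y → u (suc k) + c * y) (e k ℕₚ.≤-refl)) (solve 2 (λ x c → x :+ c :* :con 0ℚ := x) refl _ c))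
    where
    collapse : ∀ c → 0# + c * 0# ≡ 0#
    collapse = solve 1 (λ c → :con 0ℚ :+ c :* :con 0ℚ := :con 0ℚ) refl

  T-id : ∀ u k → T 0# u k ≡ u k
  T-id u zero = refl
  T-id u (suc k) = trans (T-id _ k) (solve 2 (λ x y → x :+ :con 0ℚ :* y := x) refl (u (suc k)) (u k))

  translate : Carrier → List Carrier → List Carrier
  translate c [] = []
  translate c (a ∷ p) = addL (a ∷ []) (addL (0# ∷ translate c p) (scaleL c (translate c p)))

  L-translate : ∀ c u p → L u (translate c p) ≡ L (T c u) p
  L-translate c u [] = refl
  L-translate c u (a ∷ p) = begin
    L u (addL (a ∷ []) (addL (0# ∷ q) (scaleL c q)))
      ≡⟨ L-add {u} (a ∷ []) (addL (0# ∷ q) (scaleL c q)) ⟩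
    L u (a ∷ []) + L u (addL (0# ∷ q) (scaleL c q))
      ≡⟨ cong (L u (a ∷ []) +_) (trans (L-add (0# ∷ q) (scaleL c q)) (cong (L u (0# ∷ q) +_) (L-scaleL c q))) ⟩
    (a * u 0 + 0#) + ((0# * u 0 + L (u ∘ suc) q) + c * L u q)
      ≡⟨ solve 5 (λ a u x c y → (a :* u :+ :con 0ℚ) :+ ((:con 0ℚ :* u :+ x) :+ c :* y) := a :* u :+ (x :+ c :* y)) refl a (u 0) _ c _ ⟩
    a * u 0 + (L (u ∘ suc) q + c * L u q)
      ≡⟨ cong (a * u 0 +_) (trans (sym (L-linear q c)) (L-translate c _ p)) ⟩
    a * u 0 + L (T c (λ j → u (suc j) + c * u j)) p ∎
    where q = translate c p

  ev-translate : ∀ c z p → ev z (translate c p) ≡ ev (z + c) p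
  ev-translate c z p = trans (L-translate c (z ^_) p) (L-cong p (T-pow c z))

-- Euler numbers

isOdd-suc : ∀ n → isOdd (suc n) ≡ not (isOdd n)
isOdd-suc zero = refl
isOdd-suc (suc zero) = refl
isOdd-suc (suc (suc n)) = isOdd-suc n

half-2+ : ∀ n → half (suc (suc n)) ≡ suc (half n)
half-2+ n = m/n≡1+[m∸n]/n {suc (suc n)} {2} (s≤s (s≤s z≤n))

module Euler (𝔸 : ℚAlgebra) where
  open ℚAlgebra 𝔸
  open Solver
  open Univariate 𝔸

  ιℤ : ℤ → Carrier
  ιℤ z = ι (intℚ z)

  ιℤ-+ : ∀ a b → ιℤ (a ℤ.+ b) ≡ ιℤ a + ιℤ b
  ιℤ-+ a b = trans (cong ι (intℚ-+ a b)) (ι-+ _ _)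

  ιℤ-* : ∀ a b → ιℤ (a ℤ.* b) ≡ ιℤ a * ιℤ b
  ιℤ-* a b = trans (cong ι (intℚ-* a b)) (ι-* _ _)

  ιℤ-neg : ∀ a → ιℤ (ℤ.- a) ≡ - ιℤ a
  ιℤ-neg a = trans (cong (ιℤ) (sym (ℤₚ.-1*i≡-i a))) (trans (ιℤ-* (ℤ.- (ℤ.+ 1)) a) refl)

  private
    variable
      u v u′ v′ : ℕ → Carrier

  -- Product of exponential generating functions, by the Leibniz rule.
  bs : ℕ → (ℕ → Carrier) → (ℕ → Carrier) → Carrier
  bs zero u v = u 0 * v 0
  bs (suc n) u v = bs n (u ∘ suc) v + bs n u (v ∘ suc)

  bs-cong : ∀ n → (∀ k → u k ≡ u′ k) → (∀ k → v k ≡ v′ k) → bs n u v ≡ bs n u′ v′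
  bs-cong zero e e′ = cong₂ _*_ (e 0) (e′ 0)
  bs-cong (suc n) e e′ = cong₂ _+_ (bs-cong n (e ∘ suc) e′) (bs-cong n e (e′ ∘ suc))

  bs-linearˡ : ∀ n c → bs n (λ k → u k + c * u′ k) v ≡ bs n u v + c * bs n u′ v
  bs-linearˡ {u} {u′} {v} zero c = solve 4 (λ u u′ c v → (u :+ c :* u′) :* v := u :* v :+ c :* (u′ :* v)) refl (u 0) (u′ 0) c (v 0)
  bs-linearˡ (suc n) c = trans (cong₂ _+_ (bs-linearˡ n c) (bs-linearˡ n c))
    (solve 5 (λ c a b x y → (a :+ c :* b) :+ (x :+ c :* y) := (a :+ x) :+ c :* (b :+ y)) refl c _ _ _ _)

  bs-scaleʳ : ∀ n c → bs n u (λ k → c * v k) ≡ c * bs n u v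
  bs-scaleʳ {u} {v} zero c = solve 3 (λ u c v → u :* (c :* v) := c :* (u :* v)) refl (u 0) c (v 0)
  bs-scaleʳ (suc n) c = trans (cong₂ _+_ (bs-scaleʳ n c) (bs-scaleʳ n c))
    (solve 3 (λ c a b → c :* a :+ c :* b := c :* (a :+ b)) refl c _ _)

  bs-+ʳ : ∀ n → bs n u (λ k → v k + v′ k) ≡ bs n u v + bs n u v′
  bs-+ʳ {u} {v} {v′} zero = solve 3 (λ u v v′ → u :* (v :+ v′) := u :* v :+ u :* v′) refl (u 0) (v 0) (v′ 0)
  bs-+ʳ (suc n) = trans (cong₂ _+_ (bs-+ʳ n) (bs-+ʳ n))
    (solve 4 (λ a b x y → (a :+ b) :+ (x :+ y) := (a :+ x) :+ (b :+ y)) refl _ _ _ _)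

  -- On exponential generating functions, translation by c is multiplication by e^{cx}.
  T-bs : ∀ c u k → T c u k ≡ bs k u (c ^_)
  T-bs c u zero = sym (*-identityʳ _)
  T-bs c u (suc k) = trans (T-bs c _ k) (trans (bs-linearˡ k c) (cong₂ _+_ refl (sym (bs-scaleʳ k c))))

  -- `true` stands for odd generating functions, `false` for even ones; the parity of a product is
  -- then given by `xor`.
  Supported : Bool → (ℕ → Carrier) → Set
  Supported p u = ∀ k → isOdd k ≡ not p → u k ≡ 0#

  private
    not-not : ∀ b → not (not b) ≡ b
    not-not true = refl
    not-not false = refl

    supported-suc : ∀ {p} → Supported p u → Supported (not p) (u ∘ suc)
    supported-suc {p = p} s k e = s (suc k) (trans (isOdd-suc k) (cong not (trans e (not-not p))))

  bs-supported : ∀ n {p q} → Supported p u → Supported q v → isOdd n ≡ not (p xor q) → bs n u v ≡ 0#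
  bs-supported {u} {v} zero {true} {false} s t e = trans (cong (_* v 0) (s 0 refl)) (zeroˡ _)
  bs-supported {u} {v} zero {false} {true} s t e = trans (cong (u 0 *_) (t 0 refl)) (zeroʳ _)
  bs-supported (suc n) {p} {q} s t e = trans (cong₂ _+_
    (bs-supported n (supported-suc s) t (flip p q (trans (sym (isOdd-suc n)) e)))
    (bs-supported n s (supported-suc t) (flip′ p q (trans (sym (isOdd-suc n)) e)))) (+-identityˡ _)
    where
    flip : ∀ p q → not (isOdd n) ≡ not (p xor q) → isOdd n ≡ not (not p xor q)
    flip p q e with isOdd n
    flip true true () | true
    flip true false e | true = refl
    flip false true e | true = refl
    flip false false () | true
    flip true true e | false = refl
    flip true false () | false
    flip false true () | false
    flip false false e | false = refl
    flip′ : ∀ p q → not (isOdd n) ≡ not (p xor q) → isOdd n ≡ not (p xor not q)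
    flip′ p q e with isOdd n
    flip′ true true () | true
    flip′ true false e | true = refl
    flip′ false true e | true = refl
    flip′ false false () | true
    flip′ true true e | false = refl
    flip′ true false () | false
    flip′ false true () | false
    flip′ false false e | false = refl

  sumTo : ℕ → (ℕ → Carrier) → Carrier
  sumTo zero F = 0#
  sumTo (suc n) F = sumTo n F + F n

  sumTo-cong : ∀ n {F G} → (∀ k → k < n → F k ≡ G k) → sumTo n F ≡ sumTo n G
  sumTo-cong zero e = refl
  sumTo-cong (suc n) e = cong₂ _+_ (sumTo-cong n (λ k lt → e k (ℕₚ.m≤n⇒m≤1+n lt))) (e n ℕₚ.≤-refl)

  sumTo-+ : ∀ n {F G} → sumTo n (λ k → F k + G k) ≡ sumTo n F + sumTo n G
  sumTo-+ zero = sym (+-identityˡ _)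
  sumTo-+ (suc n) = trans (cong₂ _+_ (sumTo-+ n) refl)
    (solve 4 (λ a b x y → (a :+ b) :+ (x :+ y) := (a :+ x) :+ (b :+ y)) refl _ _ _ _)

  sumTo-front : ∀ n {F} → sumTo (suc n) F ≡ F 0 + sumTo n (F ∘ suc)
  sumTo-front zero = +-comm _ _
  sumTo-front (suc n) = trans (cong₂ _+_ (sumTo-front n) refl) (+-assoc _ _ _)

  private
    binom : ℕ → ℕ → Carrier
    binom n k = ιℤ (ℤ.+ (n C k))

    pascal : ∀ n k → binom (suc n) (suc k) ≡ binom n k + binom n (suc k)
    pascal n k = trans (cong (ιℤ ∘ ℤ.+_) (sym (nCk+nC[k+1]≡[n+1]C[k+1] n k))) (ιℤ-+ (ℤ.+ (n C k)) (ℤ.+ (n C suc k)))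

  -- Pascal's rule. It links the Leibniz form of the product to the binomial convolution by which
  -- `nextEuler` is defined.
  binomial-bs : ∀ n u v → sumTo (suc n) (λ k → binom n k * u k * v (n ∸ k)) ≡ bs n u v
  binomial-bs zero u v = solve 2 (λ u v → :con 0ℚ :+ :con 1ℚ :* u :* v := u :* v) refl (u 0) (v 0)
  binomial-bs (suc n) u v = begin
    sumTo (suc (suc n)) F
      ≡⟨ sumTo-front (suc n) ⟩
    F 0 + sumTo (suc n) (F ∘ suc)
      ≡⟨ cong (F 0 +_) (trans (sumTo-cong (suc n) (λ k _ → trans (cong (λ b → b * u (suc k) * v (n ∸ k)) (pascal n k))
           (solve 4 (λ a b u v → (a :+ b) :* u :* v := a :* u :* v :+ b :* u :* v) refl _ _ _ _))) (sumTo-+ (suc n))) ⟩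
    F 0 + (sumTo (suc n) (λ k → binom n k * u (suc k) * v (n ∸ k)) + sumTo (suc n) (H ∘ suc))
      ≡⟨ solve 3 (λ f a b → f :+ (a :+ b) := a :+ (f :+ b)) refl _ _ _ ⟩
    sumTo (suc n) (λ k → binom n k * u (suc k) * v (n ∸ k)) + (H 0 + sumTo (suc n) (H ∘ suc))
      ≡⟨ cong₂ _+_ (binomial-bs n (u ∘ suc) v) (sym (sumTo-front (suc n))) ⟩
    bs n (u ∘ suc) v + sumTo (suc (suc n)) H
      ≡⟨ cong (bs n (u ∘ suc) v +_) (trans (cong₂ _+_ (sumTo-cong (suc n) (λ k k≤n → cong (λ m → binom n k * u k * v m) (ℕₚ.+-∸-assoc 1 (ℕₚ.≤-pred k≤n)))) last) (+-identityʳ _)) ⟩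
    bs n (u ∘ suc) v + sumTo (suc n) (λ k → binom n k * u k * v (suc (n ∸ k)))
      ≡⟨ cong (bs n (u ∘ suc) v +_) (binomial-bs n u (v ∘ suc)) ⟩
    bs n (u ∘ suc) v + bs n u (v ∘ suc) ∎
    where
    F H : ℕ → Carrier
    F k = binom (suc n) k * u k * v (suc n ∸ k)
    H k = binom n k * u k * v (suc n ∸ k)
    last : H (suc n) ≡ 0#
    last = trans (cong (λ b → ιℤ (ℤ.+ b) * u (suc n) * v (n ∸ n)) (k>n⇒nCk≡0 (ℕₚ.n<1+n n)))
      (solve 2 (λ u v → :con 0ℚ :* u :* v := :con 0ℚ) refl _ _)

  ε εe εo δ cs sn : ℕ → Carrier
  ε k = ιℤ (euler k)
  εe k = if isOdd k then 0# else ε k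
  εo k = if isOdd k then ε k else 0#
  δ k = ιℤ (δ0 k)
  cs k = ιℤ (cosC k)
  sn k = ιℤ (sinC k)

  private
    eulers-map : ∀ n → eulers n ≡ map euler (upTo n)
    eulers-map zero = refl
    eulers-map (suc n) = trans (cong (_++ euler n ∷ []) (eulers-map n))
      (trans (sym (map-++ euler (upTo n) (n ∷ []))) (cong (map euler) (upTo-∷ʳ n)))

    term : ℕ → ℕ × ℤ → ℤ
    term n (k , e) = (ℤ.+ (n C k)) ℤ.* e ℤ.* cosC (n ∸ k)

    nextEuler-term : ∀ n es → nextEuler n es ≡ (δ0 n ℤ.+ sinC n) ℤ.- ℤsum (map (term n) (zip (upTo n) es))
    nextEuler-term n es = cong (λ l → (δ0 n ℤ.+ sinC n) ℤ.- ℤsum l) (map-cong (λ _ → refl) (zip (upTo n) es))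

    ιℤ-sum : ∀ n l → ιℤ (ℤsum (map (term n) (zip l (map euler l))))
             ≡ Sums.sumOver 𝔸 l (λ k → binom n k * ε k * cs (n ∸ k))
    ιℤ-sum n [] = refl
    ιℤ-sum n (k ∷ l) = trans (ιℤ-+ _ _) (cong₂ _+_
      (trans (ιℤ-* _ (cosC (n ∸ k))) (cong (_* cs (n ∸ k)) (ιℤ-* (ℤ.+ (n C k)) (euler k)))) (ιℤ-sum n l))

    sumOver-upTo : ∀ n F → Sums.sumOver 𝔸 (upTo n) F ≡ sumTo n F
    sumOver-upTo zero F = refl
    sumOver-upTo (suc n) F = trans (cong (λ l → Sums.sumOver 𝔸 l F) (sym (upTo-∷ʳ n)))
      (trans (Sums.sumOver-++ 𝔸 (upTo n) (n ∷ [])) (cong₂ _+_ (sumOver-upTo n F) (+-identityʳ _)))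

  -- The sum subtracted in `nextEuler` is the convolution without its top term C(n,n) E_n c_0 = E_n.
  ε-cos : ∀ n → bs n ε cs ≡ δ n + sn n
  ε-cos n = begin
    bs n ε cs
      ≡⟨ binomial-bs n ε cs ⟨
    sumTo n F + binom n n * ε n * cs (n ∸ n)
      ≡⟨ cong (sumTo n F +_) (trans (cong₂ (λ b m → ιℤ (ℤ.+ b) * ε n * cs m) (nCn≡1 n) (ℕₚ.n∸n≡0 n))
           (solve 1 (λ e → :con 1ℚ :* e :* :con 1ℚ := e) refl (ε n))) ⟩
    sumTo n F + ε n
      ≡⟨ cong (sumTo n F +_) (trans (cong ιℤ (nextEuler-term n (eulers n))) (trans (ιℤ-+ _ _) (cong₂ _+_ (ιℤ-+ (δ0 n) (sinC n)) (trans (ιℤ-neg _) (cong (λ x → - x) lower))))) ⟩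
    sumTo n F + ((δ n + sn n) + - sumTo n F)
      ≡⟨ solve 2 (λ s x → s :+ (x :+ :con (ℚ.- 1ℚ) :* s) := x) refl (sumTo n F) (δ n + sn n) ⟩
    δ n + sn n ∎
    where
    F : ℕ → Carrier
    F k = binom n k * ε k * cs (n ∸ k)
    lower : ιℤ (ℤsum (map (term n) (zip (upTo n) (eulers n)))) ≡ sumTo n F
    lower = trans (cong (λ l → ιℤ (ℤsum (map (term n) (zip (upTo n) l)))) (eulers-map n))
      (trans (ιℤ-sum n (upTo n)) (sumOver-upTo n F))

  private
    if-true : ∀ {b} {x y : Carrier} → b ≡ true → (if b then x else y) ≡ x
    if-true refl = refl

    if-false : ∀ {b} {x y : Carrier} → b ≡ false → (if b then x else y) ≡ y
    if-false refl = refl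

  εe-even : Supported false εe
  εe-even k e = if-true e

  εo-odd : Supported true εo
  εo-odd k e = if-false e

  private
    cs-even : Supported false cs
    cs-even k e = cong ιℤ (go e)
      where
      go : isOdd k ≡ true → cosC k ≡ ℤ.+ 0
      go e rewrite e = refl

    sn-odd : Supported true sn
    sn-odd k e = cong ιℤ (go e)
      where
      go : isOdd k ≡ false → sinC k ≡ ℤ.+ 0
      go e rewrite e = refl

    δ-even : Supported false δ
    δ-even (suc k) e = refl

  ε-split : ∀ k → ε k ≡ εe k + 1# * εo k
  ε-split k = go (isOdd k) (ε k)
    where
    go : ∀ b x → x ≡ (if b then 0# else x) + 1# * (if b then x else 0#)
    go true = solve 1 (λ x → x := :con 0ℚ :+ :con 1ℚ :* x) refl
    go false = solve 1 (λ x → x := x :+ :con 1ℚ :* :con 0ℚ) refl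

  private
    split-cos : ∀ n → bs n εe cs + 1# * bs n εo cs ≡ δ n + sn n
    split-cos n = trans (sym (bs-linearˡ n 1#)) (trans (bs-cong n (λ k → sym (ε-split k)) (λ _ → refl)) (ε-cos n))

  -- (sec + tan) cos = 1 + sin splits into even and odd parts, because cos is even; the other half
  -- is `tan-cos`.
  sec-cos : ∀ n → bs n εe cs ≡ δ n
  sec-cos n = go (isOdd n) refl
    where
    go : ∀ b → isOdd n ≡ b → bs n εe cs ≡ δ n
    go true eq = trans (bs-supported n {false} {false} εe-even cs-even eq) (sym (δ-even n eq))
    go false eq = begin
      bs n εe cs                    ≡⟨ solve 1 (λ x → x := x :+ :con 1ℚ :* :con 0ℚ) refl _ ⟩
      bs n εe cs + 1# * 0#          ≡⟨ cong (λ x → bs n εe cs + 1# * x) (bs-supported n {true} {false} εo-odd cs-even eq) ⟨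
      bs n εe cs + 1# * bs n εo cs  ≡⟨ split-cos n ⟩
      δ n + sn n                    ≡⟨ trans (cong (δ n +_) (sn-odd n eq)) (+-identityʳ _) ⟩
      δ n                           ∎

  tan-cos : ∀ n → bs n εo cs ≡ sn n
  tan-cos n = go (isOdd n) refl
    where
    go : ∀ b → isOdd n ≡ b → bs n εo cs ≡ sn n
    go false eq = trans (bs-supported n {true} {false} εo-odd cs-even eq) (sym (sn-odd n eq))
    go true eq = begin
      bs n εo cs                    ≡⟨ solve 1 (λ x → x := :con 0ℚ :+ :con 1ℚ :* x) refl _ ⟩
      0# + 1# * bs n εo cs          ≡⟨ cong (λ x → x + 1# * bs n εo cs) (bs-supported n {false} {false} εe-even cs-even eq) ⟨
      bs n εe cs + 1# * bs n εo cs  ≡⟨ split-cos n ⟩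
      δ n + sn n                    ≡⟨ trans (cong (_+ sn n) (δ-even n eq)) (+-identityˡ _) ⟩
      sn n                          ∎

  δ-pow : ∀ k → δ k ≡ 0# ^ k
  δ-pow zero = refl
  δ-pow (suc k) = sym (zeroˡ _)

  T-δ : ∀ c k → T c δ k ≡ c ^ k
  T-δ c k = trans (T-cong c k δ-pow) (trans (T-pow c 0# k) (cong (_^ k) (+-identityˡ c)))

  module Imaginary (𝕚 : Carrier) (𝕚² : 𝕚 * 𝕚 ≡ - 1#) where

    private
      cs-2+ : ∀ k → cs (suc (suc k)) ≡ - cs k
      cs-2+ k = trans (cong ιℤ go) (ιℤ-neg (cosC k))
        where
        go : cosC (suc (suc k)) ≡ ℤ.- cosC k
        go rewrite half-2+ k with isOdd k
        ... | true = refl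
        ... | false = refl

      sn-2+ : ∀ k → sn (suc (suc k)) ≡ - sn k
      sn-2+ k = trans (cong ιℤ go) (ιℤ-neg (sinC k))
        where
        go : sinC (suc (suc k)) ≡ ℤ.- sinC k
        go rewrite half-2+ k with isOdd k
        ... | true = refl
        ... | false = refl

      de-moivre : ∀ j → j * j ≡ - 1# → ∀ k → j ^ k ≡ cs k + j * sn k
      de-moivre j j² zero = solve 1 (λ j → :con 1ℚ := :con 1ℚ :+ j :* :con 0ℚ) refl j
      de-moivre j j² (suc zero) = solve 1 (λ j → j :* :con 1ℚ := :con 0ℚ :+ j :* :con 1ℚ) refl j
      de-moivre j j² (suc (suc k)) = begin
        j * (j * j ^ k)                          ≡⟨ *-assoc j j _ ⟨
        j * j * j ^ k                            ≡⟨ cong₂ _*_ j² (de-moivre j j² k) ⟩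
        - 1# * (cs k + j * sn k)                 ≡⟨ solve 3 (λ c j s → (:con (ℚ.- 1ℚ) :* :con 1ℚ) :* (c :+ j :* s)
                                                      := :con (ℚ.- 1ℚ) :* c :+ j :* (:con (ℚ.- 1ℚ) :* s)) refl (cs k) j (sn k) ⟩
        - cs k + j * - sn k                      ≡⟨ cong₂ (λ x y → x + j * y) (cs-2+ k) (sn-2+ k) ⟨
        cs (suc (suc k)) + j * sn (suc (suc k))  ∎

      neg² : - 𝕚 * - 𝕚 ≡ - 1#
      neg² = trans (solve 1 (λ i → (:con (ℚ.- 1ℚ) :* i) :* (:con (ℚ.- 1ℚ) :* i) := i :* i) refl 𝕚) 𝕚²

      two : Carrier
      two = ι (1ℚ ℚ.+ 1ℚ)

      pow-sum : ∀ k → 𝕚 ^ k + (- 𝕚) ^ k ≡ two * cs k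
      pow-sum k = trans (cong₂ _+_ (de-moivre 𝕚 𝕚² k) (de-moivre (- 𝕚) neg² k))
        (solve 3 (λ c i s → (c :+ i :* s) :+ (c :+ (:con (ℚ.- 1ℚ) :* i) :* s) := :con (1ℚ ℚ.+ 1ℚ) :* c) refl (cs k) 𝕚 (sn k))

      -- Multiplication of exponential generating functions by 2 cos x.
      D : (ℕ → Carrier) → ℕ → Carrier
      D u k = T 𝕚 u k + T (- 𝕚) u k

      D-bs : ∀ u k → D u k ≡ two * bs k u cs
      D-bs u k = begin
        T 𝕚 u k + T (- 𝕚) u k                       ≡⟨ cong₂ _+_ (T-bs 𝕚 u k) (T-bs (- 𝕚) u k) ⟩
        bs k u (𝕚 ^_) + bs k u (λ m → (- 𝕚) ^ m)    ≡⟨ bs-+ʳ k ⟨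
        bs k u (λ m → 𝕚 ^ m + (- 𝕚) ^ m)            ≡⟨ bs-cong k (λ _ → refl) pow-sum ⟩
        bs k u (λ m → two * cs m)                   ≡⟨ bs-scaleʳ k two ⟩
        two * bs k u cs                             ∎

      -- 2 cos x has constant term 2: once all lower coefficients of u vanish, `T-zero` leaves
      -- `D u k` = 2 u_k.
      D-injective : ∀ u → (∀ k → D u k ≡ 0#) → ∀ k → u k ≡ 0#
      D-injective u e = <-rec _ λ k rec → ι-cancel {1ℚ ℚ.+ 1ℚ} (λ ()) (begin
        two * u k              ≡⟨ solve 1 (λ x → :con (1ℚ ℚ.+ 1ℚ) :* x := x :+ x) refl (u k) ⟩
        u k + u k              ≡⟨ cong₂ _+_ (T-zero 𝕚 u k (λ j → rec {j})) (T-zero (- 𝕚) u k (λ j → rec {j})) ⟨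
        D u k                  ≡⟨ e k ⟩
        0#                     ∎)

      D-linear : ∀ u v c k → D (λ j → u j + c * v j) k ≡ D u k + c * D v k
      D-linear u v c k = trans (cong₂ _+_ (T-linear 𝕚 c k) (T-linear (- 𝕚) c k))
        (solve 5 (λ a b x y c → (a :+ c :* b) :+ (x :+ c :* y) := (a :+ x) :+ c :* (b :+ y)) refl _ _ _ _ c)

      -- Translations commute, so 2 cos x can be applied to sec x before e^{ix} is; what is left is
      -- 2 e^{ix}.
      D-Tsec : ∀ k → D (T 𝕚 εe) k ≡ two * 𝕚 ^ k
      D-Tsec k = begin
        T 𝕚 (T 𝕚 εe) k + T (- 𝕚) (T 𝕚 εe) k  ≡⟨ cong₂ _+_ refl (trans (T-compose (- 𝕚) 𝕚 εe k)
                                                   (trans (cong (λ c → T c εe k) (+-comm (- 𝕚) 𝕚)) (sym (T-compose 𝕚 (- 𝕚) εe k)))) ⟩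
        T 𝕚 (T 𝕚 εe) k + T 𝕚 (T (- 𝕚) εe) k  ≡⟨ solve 2 (λ x y → x :+ y := x :+ :con 1ℚ :* y) refl _ _ ⟩
        T 𝕚 (T 𝕚 εe) k + 1# * T 𝕚 (T (- 𝕚) εe) k ≡⟨ T-linear 𝕚 1# k ⟨
        T 𝕚 (λ j → T 𝕚 εe j + 1# * T (- 𝕚) εe j) k ≡⟨ T-cong 𝕚 k (λ j → trans (cong (T 𝕚 εe j +_) (*-identityˡ _)) (trans (D-bs εe j) (cong (two *_) (sec-cos j)))) ⟩
        T 𝕚 (λ j → two * δ j) k              ≡⟨ T-scale 𝕚 two k ⟩
        two * T 𝕚 δ k                        ≡⟨ cong (two *_) (T-δ 𝕚 k) ⟩
        two * 𝕚 ^ k                          ∎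

    -- e^{ix} sec x = 1 + i tan x
    T-sec : ∀ k → T 𝕚 εe k ≡ δ k + 𝕚 * εo k
    T-sec k = trans (x-y≡0⇒x≡y {y = 𝕚 * εo k + δ k} (trans (shape (T 𝕚 εe k) (δ k) (εo k)) (D-injective w D-w k))) (+-comm _ _)
      where
      w : ℕ → Carrier
      w j = (T 𝕚 εe j + ι (ℚ.- 1ℚ) * δ j) + - 𝕚 * εo j
      shape : ∀ a b c → a - (𝕚 * c + b) ≡ (a + ι (ℚ.- 1ℚ) * b) + - 𝕚 * c
      shape a b c = solve 4 (λ a b c i → a :+ :con (ℚ.- 1ℚ) :* (i :* c :+ b) := (a :+ :con (ℚ.- 1ℚ) :* b) :+ (:con (ℚ.- 1ℚ) :* i) :* c) refl a b c 𝕚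
      D-w : ∀ k → D w k ≡ 0#
      D-w k = begin
        D w k
          ≡⟨ D-linear _ εo (- 𝕚) k ⟩
        D (λ j → T 𝕚 εe j + ι (ℚ.- 1ℚ) * δ j) k + - 𝕚 * D εo k
          ≡⟨ cong₂ (λ x y → x + - 𝕚 * y) (D-linear (T 𝕚 εe) δ (ι (ℚ.- 1ℚ)) k) (trans (D-bs εo k) (cong (two *_) (tan-cos k))) ⟩
        D (T 𝕚 εe) k + ι (ℚ.- 1ℚ) * D δ k + - 𝕚 * (two * sn k)
          ≡⟨ cong₂ (λ x y → x + ι (ℚ.- 1ℚ) * y + - 𝕚 * (two * sn k)) (trans (D-Tsec k) (cong (two *_) (de-moivre 𝕚 𝕚² k)))
               (trans (cong₂ _+_ (T-δ 𝕚 k) (T-δ (- 𝕚) k)) (pow-sum k)) ⟩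
        two * (cs k + 𝕚 * sn k) + ι (ℚ.- 1ℚ) * (two * cs k) + - 𝕚 * (two * sn k)
          ≡⟨ solve 4 (λ t c i s → t :* (c :+ i :* s) :+ :con (ℚ.- 1ℚ) :* (t :* c) :+ (:con (ℚ.- 1ℚ) :* i) :* (t :* s) := :con 0ℚ) refl two (cs k) 𝕚 (sn k) ⟩
        0# ∎

    -- e^{ix} tan x = i sec x − i e^{ix}
    T-tan : ∀ k → T 𝕚 εo k ≡ 𝕚 * εe k + - 𝕚 * 𝕚 ^ k
    T-tan k = begin
      T 𝕚 εo k                         ≡⟨ solve 1 (λ x → x := :con (ℚ.- 1ℚ) :* (:con (ℚ.- 1ℚ) :* :con 1ℚ :* x)) refl _ ⟩
      - (- 1# * T 𝕚 εo k)              ≡⟨ cong (λ x → - (x * T 𝕚 εo k)) 𝕚² ⟨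
      - (𝕚 * 𝕚 * T 𝕚 εo k)             ≡⟨ solve 3 (λ i x p → :con (ℚ.- 1ℚ) :* (i :* i :* x) := (:con (ℚ.- 1ℚ) :* i) :* ((p :+ i :* x) :+ :con (ℚ.- 1ℚ) :* p)) refl 𝕚 _ (𝕚 ^ k) ⟩
      - 𝕚 * (𝕚 ^ k + 𝕚 * T 𝕚 εo k - 𝕚 ^ k) ≡⟨ cong (λ x → - 𝕚 * (x - 𝕚 ^ k)) twice ⟨
      - 𝕚 * (T 𝕚 (T 𝕚 εe) k - 𝕚 ^ k)   ≡⟨ cong (λ x → - 𝕚 * (x - 𝕚 ^ k)) twice′ ⟩
      - 𝕚 * (two * 𝕚 ^ k - εe k - 𝕚 ^ k) ≡⟨ solve 3 (λ i p e → (:con (ℚ.- 1ℚ) :* i) :* (:con (1ℚ ℚ.+ 1ℚ) :* p :+ :con (ℚ.- 1ℚ) :* e :+ :con (ℚ.- 1ℚ) :* p)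
                                              := i :* e :+ (:con (ℚ.- 1ℚ) :* i) :* p) refl 𝕚 (𝕚 ^ k) (εe k) ⟩
      𝕚 * εe k + - 𝕚 * 𝕚 ^ k           ∎
      where
      twice : T 𝕚 (T 𝕚 εe) k ≡ 𝕚 ^ k + 𝕚 * T 𝕚 εo k
      twice = trans (T-cong 𝕚 k T-sec) (trans (T-linear 𝕚 𝕚 k) (cong (_+ 𝕚 * T 𝕚 εo k) (T-δ 𝕚 k)))
      twice′ : T 𝕚 (T 𝕚 εe) k ≡ two * 𝕚 ^ k - εe k
      twice′ = begin
        T 𝕚 (T 𝕚 εe) k                              ≡⟨ solve 2 (λ x e → x := (x :+ e) :+ :con (ℚ.- 1ℚ) :* e) refl _ (εe k) ⟩
        (T 𝕚 (T 𝕚 εe) k + εe k) - εe k              ≡⟨ cong (λ x → (T 𝕚 (T 𝕚 εe) k + x) - εe k) (trans (T-compose (- 𝕚) 𝕚 εe k)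
                                                         (trans (cong (λ c → T c εe k) (trans (+-comm (- 𝕚) 𝕚) (x-x≡0 𝕚))) (T-id εe k))) ⟨
        D (T 𝕚 εe) k - εe k                         ≡⟨ cong (_- εe k) (D-Tsec k) ⟩
        two * 𝕚 ^ k - εe k                          ∎

-- Umbral evaluation of the specializations

PolyE-ops : Ops
PolyE-ops = record { Carrier = PolyE ; _+_ = addE ; _*_ = mulE ; ι = λ c → c ∷ [] }

S-E : (ℕ → PolyE) → List ℕ → PolyE
S-E = JacobiTrudi.S PolyE-ops

module Umbral (𝔸 : ℚAlgebra) where
  open ℚAlgebra 𝔸
  open Solver
  open Univariate 𝔸
  open JacobiTrudi ops
  open JTLaws 𝔸
  open Euler 𝔸
  open Sums 𝔸 using (sumOver; when)

  at : Carrier → (ℕ → PolyE) → ℕ → Carrier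
  at z spec k = ev z (emb (spec k))

  ev-hom : Carrier → Hom PolyE-ops ops
  ev-hom z = record { φ = ev z ∘ emb ; φ-+ = ev-addE z ; φ-* = ev-mulE z ; φ-ι = ev-con z }

  ev-S : ∀ z spec la → ev z (emb (S-E spec la)) ≡ S (at z spec) la
  ev-S z spec la = HomS.S-hom (ev-hom z) spec la

  ι-umbral : ∀ p → ι (umbral p) ≡ L ε (emb p)
  ι-umbral p = trans (cong (ι ∘ ℚsum) (map-cong (λ _ → refl) (zip (upTo (length p)) p))) (go (λ k → k) p)
    where
    term : ℕ × ℚ → ℚ
    term (k , c) = c ℚ.* (euler k ℚ./ 1)
    go : ∀ f p → ι (ℚsum (map term (zip (applyUpTo f (length p)) p))) ≡ L (ε ∘ f) (emb p)
    go f [] = refl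
    go f (c ∷ p) = trans (ι-+ _ _) (cong₂ _+_
      (trans (ι-* c _) (cong (λ q → ι c * ι q) (/1≡intℚ (euler (f 0))))) (go (f ∘ suc) p))

  ι-length : ∀ {X : Set} (l : List X) → ι (ℕtoℚ (length l)) ≡ sumOver l (λ _ → 1#)
  ι-length l = trans (cong ι (/1≡intℚ _)) (go l)
    where
    go : ∀ l → ι (natℚ (length l)) ≡ sumOver l (λ _ → 1#)
    go [] = refl
    go (_ ∷ l) = trans (ι-nat-suc (length l)) (cong (1# +_) (go l))

  private
    spec-ev : ∀ z s → ev z (emb (0ℚ ∷ s ∷ [])) ≡ ι s * z
    spec-ev z s = solve 2 (λ z s → :con 0ℚ :* :con 1ℚ :+ (s :* (z :* :con 1ℚ) :+ :con 0ℚ) := s :* z) refl z (ι s)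

    sg-parity : ∀ k → sg k ≡ (if isOdd k then - 1# else 1#)
    sg-parity zero = refl
    sg-parity (suc k) = trans (sg-suc k) (trans (cong (λ x → - x) (sg-parity k)) (trans (go (isOdd k))
        (cong (λ b → if b then - 1# else 1#) (sym (isOdd-suc k)))))
      where
      go : ∀ b → - (if b then - 1# else 1#) ≡ (if not b then - 1# else 1#)
      go true = solve 0 (:con (ℚ.- 1ℚ) :* (:con (ℚ.- 1ℚ) :* :con 1ℚ) := :con 1ℚ) refl
      go false = refl

  -- The shape common to the three specializations: odd power sums are ±E, even ones are free of E.
  -- The parity argument rests on this alone.
  Odd-spec : (ℕ → PolyE) → Set
  Odd-spec spec = Σ (ℕ → Carrier) λ c → ∀ z k → at z spec k ≡ (if isOdd k then sg (half k) * z else c k)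

  odd-O : Odd-spec specOdd
  odd-O = (λ _ → 0#) , λ z k → go z (isOdd k) (signℚ (half k))
    where
    go : ∀ z b s → ev z (emb (if b then 0ℚ ∷ s ∷ [] else [])) ≡ (if b then ι s * z else 0#)
    go z true s = spec-ev z s
    go z false s = refl

  odd-A : Odd-spec specAlt
  odd-A = (λ k → sg (half k)) , λ z k → go z (isOdd k) (signℚ (half k))
    where
    go : ∀ z b s → ev z (emb (if b then 0ℚ ∷ s ∷ [] else s ∷ [])) ≡ (if b then ι s * z else ι s)
    go z true s = spec-ev z s
    go z false s = ev-con z s

  odd-R : Odd-spec specRalt
  odd-R = (λ k → - sg (half k)) , λ z k → go z (isOdd k) (signℚ (half k))
    where
    go : ∀ z b s → ev z (emb (if b then 0ℚ ∷ s ∷ [] else (ℚ.- s) ∷ [])) ≡ (if b then ι s * z else - ι s)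
    go z true s = spec-ev z s
    go z false s = trans (ev-con z (ℚ.- s)) (ι-neg s)

  private
    signed-at : ∀ spec → Odd-spec spec → ∀ z k → at (- z) spec k ≡ sg k * at z spec k
    signed-at spec (c , e) z k = trans (e (- z) k) (trans (go (isOdd k)) (cong₂ _*_ (sym (sg-parity k)) (sym (e z k))))
      where
      go : ∀ b → (if b then sg (half k) * - z else c k) ≡ (if b then - 1# else 1#) * (if b then sg (half k) * z else c k)
      go true = solve 2 (λ s z → s :* (:con (ℚ.- 1ℚ) :* z) := (:con (ℚ.- 1ℚ) :* :con 1ℚ) :* (s :* z)) refl _ z
      go false = sym (*-identityˡ _)

    alternate : List Carrier → List Carrier
    alternate [] = []
    alternate (a ∷ p) = a ∷ scaleL (- 1#) (alternate p)

    L-alternate : ∀ u p → L u (alternate p) ≡ L (λ k → sg k * u k) p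
    L-alternate u [] = refl
    L-alternate u (a ∷ p) = cong₂ _+_ (cong (a *_) (sym (*-identityˡ _)))
      (trans (L-scaleL (- 1#) (alternate p)) (trans (cong (- 1# *_) (L-alternate (u ∘ suc) p))
        (trans (sym (L-scale p (- 1#))) (L-cong p (λ k →
          trans (solve 2 (λ s u → (:con (ℚ.- 1ℚ) :* :con 1ℚ) :* (s :* u) := (:con (ℚ.- 1ℚ) :* s) :* u) refl (sg k) (u (suc k)))
            (cong (_* u (suc k)) (sym (sg-suc k))))))))

    neg-pow : ∀ z k → sg k * z ^ k ≡ (- z) ^ k
    neg-pow z zero = *-identityˡ _
    neg-pow z (suc k) = trans (cong (_* (z * z ^ k)) (sg-suc k))
      (trans (solve 3 (λ s z p → (:con (ℚ.- 1ℚ) :* s) :* (z :* p) := (:con (ℚ.- 1ℚ) :* z) :* (s :* p)) refl (sg k) z _)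
        (cong (- z *_) (neg-pow z k)))

  -- Replacing E by -E has the effect p_k ↦ (-1)^k p_k, so by `S-signed` the polynomial s_λ[spec]
  -- has the parity of |λ| in E. For a functional supported on the other parity this gives x = -x,
  -- hence 2x = 0.
  L-parity : ∀ spec → Odd-spec spec → ∀ la {p u} → Supported p u → isOdd (sum la) ≡ not p → L u (emb (S-E spec la)) ≡ 0#
  L-parity spec o la {p} {u} s e = ι-cancel {1ℚ ℚ.+ 1ℚ} (λ ()) (core p (trans signs (cong (λ b → (if b then - 1# else 1#) * x) e)))
    where
    q = emb (S-E spec la)
    x = L u q
    signs : (if p then - 1# else 1#) * x ≡ (if isOdd (sum la) then - 1# else 1#) * x
    signs = begin
      (if p then - 1# else 1#) * x            ≡⟨ L-scale q _ ⟨
      L (λ k → (if p then - 1# else 1#) * u k) q ≡⟨ L-cong q (λ k → same k p (isOdd k) (sg-parity k) (s k)) ⟩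
      L (λ k → sg k * u k) q                  ≡⟨ L-alternate u q ⟨
      L u (alternate q)                       ≡⟨ transfer (alternate q) (scaleL (sg (sum la)) q) (λ r → begin
          ev (ι r) (alternate q)                    ≡⟨ trans (L-alternate _ q) (L-cong q (neg-pow (ι r))) ⟩
          ev (- ι r) q                              ≡⟨ ev-S (- ι r) spec la ⟩
          S (at (- ι r) spec) la                    ≡⟨ S-signed (signed-at spec o (ι r)) la ⟩
          sg (sum la) * S (at (ι r) spec) la        ≡⟨ cong (sg (sum la) *_) (ev-S (ι r) spec la) ⟨
          sg (sum la) * ev (ι r) q                  ≡⟨ L-scaleL (sg (sum la)) q ⟨
          ev (ι r) (scaleL (sg (sum la)) q)         ∎) u ⟩
      L u (scaleL (sg (sum la)) q)            ≡⟨ L-scaleL (sg (sum la)) q ⟩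
      sg (sum la) * x                         ≡⟨ cong (_* x) (sg-parity (sum la)) ⟩
      (if isOdd (sum la) then - 1# else 1#) * x ∎
      where
      same : ∀ k p b → sg k ≡ (if b then - 1# else 1#) → (b ≡ not p → u k ≡ 0#) → (if p then - 1# else 1#) * u k ≡ sg k * u k
      same k true true e _ = cong (_* u k) (sym e)
      same k false false e _ = cong (_* u k) (sym e)
      same k true false e z = trans (cong (- 1# *_) (z refl)) (trans (zeroʳ _) (sym (trans (cong (sg k *_) (z refl)) (zeroʳ _))))
      same k false true e z = trans (cong (1# *_) (z refl)) (trans (zeroʳ _) (sym (trans (cong (sg k *_) (z refl)) (zeroʳ _))))
    core : ∀ p → (if p then - 1# else 1#) * x ≡ (if not p then - 1# else 1#) * x → ι (1ℚ ℚ.+ 1ℚ) * x ≡ 0#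
    core true h = trans (solve 1 (λ x → :con (1ℚ ℚ.+ 1ℚ) :* x := :con 1ℚ :* x :+ :con (ℚ.- 1ℚ) :* ((:con (ℚ.- 1ℚ) :* :con 1ℚ) :* x)) refl x)
        (trans (cong (λ y → y - - 1# * x) (sym h)) (x-x≡0 _))
    core false h = trans (solve 1 (λ x → :con (1ℚ ℚ.+ 1ℚ) :* x := :con 1ℚ :* x :+ :con (ℚ.- 1ℚ) :* ((:con (ℚ.- 1ℚ) :* :con 1ℚ) :* x)) refl x)
        (trans (cong (λ y → 1# * x - y) (sym h)) (x-x≡0 _))

  L-ε-even : ∀ spec → Odd-spec spec → ∀ la → isOdd (sum la) ≡ false → L ε (emb (S-E spec la)) ≡ L εe (emb (S-E spec la))
  L-ε-even spec o la e = trans (L-cong (emb (S-E spec la)) ε-split) (trans (L-linear (emb (S-E spec la)) 1#)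
    (trans (cong (λ x → L εe (emb (S-E spec la)) + 1# * x) (L-parity spec o la εo-odd e))
      (solve 1 (λ x → x :+ :con 1ℚ :* :con 0ℚ := x) refl _)))

  L-ε-odd : ∀ spec → Odd-spec spec → ∀ la → isOdd (sum la) ≡ true → L ε (emb (S-E spec la)) ≡ L εo (emb (S-E spec la))
  L-ε-odd spec o la e = trans (L-cong (emb (S-E spec la)) ε-split) (trans (L-linear (emb (S-E spec la)) 1#)
    (trans (cong (λ x → x + 1# * L εo (emb (S-E spec la))) (L-parity spec o la εe-even e))
      (solve 1 (λ x → :con 0ℚ :+ :con 1ℚ :* x := x) refl _)))

  -- With all power sums 0 the Schur function is the indicator of the empty partition; it is the
  -- inhomogeneous term of the recursions.
  S₀ : List ℕ → Carrier
  S₀ = S (λ _ → 0#)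

  S₀-empty : ∀ la {b} → Dec b la → sum la ≡ 0 → S₀ la ≡ 1#
  S₀-empty [] d e = S-zero-empty [] tt
  S₀-empty (zero ∷ la) (_ , d) e = S-zero-empty (0 ∷ la) (z≤n , d)

  S₀-nonempty : ∀ la {b} → Dec b la → ∀ n → sum la ≡ suc n → S₀ la ≡ 0#
  S₀-nonempty (suc k ∷ la) d n e = S-zero-nonempty k la
  S₀-nonempty (zero ∷ la) (_ , d) n e = ⊥-elim (ℕₚ.0≢1+n (trans (sym (flat la d)) e))
    where
    flat : ∀ la → Dec 0 la → sum la ≡ 0
    flat [] _ = refl
    flat (zero ∷ la) (_ , d) = flat la d

  -- Strip equations for the secant and tangent functionals

  module Gaussian (𝕚 : Carrier) (𝕚² : 𝕚 * 𝕚 ≡ - 1#) where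
    open Imaginary 𝕚 𝕚²
    open Strip _+_ (𝕚 *_) 0#

    private
      module ZL = Strip addL (scaleL 𝕚) []

    Z-linear : ∀ g h c la → Z (λ μ → g μ + c * h μ) la ≡ Z g la + c * Z h la
    Z-linear-row : ∀ g h c post k → Zrow (λ μ → g μ + c * h μ) post k ≡ Zrow g post k + c * Zrow h post k
    Z-linear g h c [] = refl
    Z-linear g h c (k ∷ post) = Z-linear-row g h c post k
    Z-linear-row g h c post zero = Z-linear _ _ c post
    Z-linear-row g h c post (suc k) with hd post ≤ᵇ k
    ... | true = trans (cong₂ (λ x y → x + 𝕚 * y) (Z-linear _ _ c post) (Z-linear-row g h c post k))
      (solve 6 (λ a b c i x y → (a :+ c :* b) :+ i :* (x :+ c :* y) := (a :+ i :* x) :+ c :* (b :+ i :* y)) refl _ _ c 𝕚 _ _)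
    ... | false = trans (cong (_+ 0#) (Z-linear _ _ c post))
      (solve 3 (λ a b c → (a :+ c :* b) :+ :con 0ℚ := (a :+ :con 0ℚ) :+ c :* (b :+ :con 0ℚ)) refl _ _ c)

    -- The reason for the weight 𝕚: its powers carry the signs of the specializations, so adding 𝕚^k
    -- to p_k turns E into E + 𝕚 in odd degrees and changes an even entry by (-1)^(k/2).
    pow-parity : ∀ k → 𝕚 ^ k ≡ (if isOdd k then sg (half k) * 𝕚 else sg (half k))
    pow-parity zero = refl
    pow-parity (suc zero) = *-comm _ _
    pow-parity (suc (suc k)) = begin
      𝕚 * (𝕚 * 𝕚 ^ k)                                                ≡⟨ *-assoc _ _ _ ⟨
      𝕚 * 𝕚 * 𝕚 ^ k                                                  ≡⟨ cong₂ _*_ 𝕚² (pow-parity k) ⟩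
      - 1# * (if isOdd k then sg (half k) * 𝕚 else sg (half k))      ≡⟨ go (isOdd k) ⟩
      (if isOdd k then - sg (half k) * 𝕚 else - sg (half k))         ≡⟨ cong (λ s → if isOdd k then s * 𝕚 else s) (trans (sym (sg-suc (half k))) (cong sg (sym (half-2+ k)))) ⟩
      (if isOdd k then sg (half (suc (suc k))) * 𝕚 else sg (half (suc (suc k)))) ∎
      where
      go : ∀ b → - 1# * (if b then sg (half k) * 𝕚 else sg (half k)) ≡ (if b then - sg (half k) * 𝕚 else - sg (half k))
      go true = solve 2 (λ s i → (:con (ℚ.- 1ℚ) :* :con 1ℚ) :* (s :* i) := (:con (ℚ.- 1ℚ) :* s) :* i) refl _ 𝕚
      go false = solve 1 (λ s → (:con (ℚ.- 1ℚ) :* :con 1ℚ) :* s := :con (ℚ.- 1ℚ) :* s) refl _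

    private
      add-pow : ∀ z c c′ k → c + sg (half k) ≡ c′ →
        (if isOdd k then sg (half k) * z else c) + 𝕚 ^ k ≡ (if isOdd k then sg (half k) * (z + 𝕚) else c′)
      add-pow z c c′ k e = trans (cong ((if isOdd k then sg (half k) * z else c) +_) (pow-parity k)) (go (isOdd k))
        where
        go : ∀ b → (if b then sg (half k) * z else c) + (if b then sg (half k) * 𝕚 else sg (half k)) ≡ (if b then sg (half k) * (z + 𝕚) else c′)
        go true = solve 3 (λ s z i → s :* z :+ s :* i := s :* (z :+ i)) refl _ z 𝕚
        go false = e

    R⇒O : ∀ z k → at z specRalt k + 𝕚 ^ k ≡ at (z + 𝕚) specOdd k
    R⇒O z k = trans (cong (_+ 𝕚 ^ k) (proj₂ odd-R z k)) (trans
      (add-pow z _ 0# k (solve 1 (λ s → :con (ℚ.- 1ℚ) :* s :+ s := :con 0ℚ) refl _))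
      (sym (proj₂ odd-O (z + 𝕚) k)))

    O⇒A : ∀ z k → at z specOdd k + 𝕚 ^ k ≡ at (z + 𝕚) specAlt k
    O⇒A z k = trans (cong (_+ 𝕚 ^ k) (proj₂ odd-O z k)) (trans
      (add-pow z 0# _ k (+-identityˡ _)) (sym (proj₂ odd-A (z + 𝕚) k)))

    0⇒A : ∀ k → 0# + 𝕚 ^ k ≡ at 𝕚 specAlt k
    0⇒A k = trans (+-identityˡ _) (trans (pow-parity k) (sym (proj₂ odd-A 𝕚 k)))

    at-O-zero : ∀ k → at 0# specOdd k ≡ 0#
    at-O-zero k = trans (proj₂ odd-O 0# k) (go (isOdd k))
      where
      go : ∀ b → (if b then sg (half k) * 0# else 0#) ≡ 0#
      go true = zeroʳ _
      go false = refl

    -- Removing a horizontal strip with weight 𝕚 per box adds 𝕚^k to the k-th power sum, i.e. translates E by 𝕚.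
    Z-umbral : ∀ spec spec′ → (∀ z k → at z spec k + 𝕚 ^ k ≡ at (z + 𝕚) spec′ k) → ∀ u la {b} → Dec b la →
      Z (λ μ → L u (emb (S-E spec μ))) la ≡ L (T 𝕚 u) (emb (S-E spec′ la))
    Z-umbral spec spec′ e u la d = begin
      Z (λ μ → L u (emb (S-E spec μ))) la      ≡⟨ Z-L u ⟨
      L u (ZL.Z (emb ∘ S-E spec) la)           ≡⟨ transfer (ZL.Z (emb ∘ S-E spec) la) (translate 𝕚 (emb (S-E spec′ la))) (λ r → begin
          ev (ι r) (ZL.Z (emb ∘ S-E spec) la)         ≡⟨ Z-L (ι r ^_) ⟩
          Z (λ μ → ev (ι r) (emb (S-E spec μ))) la    ≡⟨ Z-cong la d (λ μ _ _ _ → ev-S (ι r) spec μ) ⟩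
          Z (S (at (ι r) spec)) la                    ≡⟨ S-branch (at (ι r) spec) 𝕚 la d ⟨
          S (λ k → at (ι r) spec k + 𝕚 ^ k) la        ≡⟨ S-cong (e (ι r)) la ⟩
          S (at (ι r + 𝕚) spec′) la                   ≡⟨ ev-S (ι r + 𝕚) spec′ la ⟨
          ev (ι r + 𝕚) (emb (S-E spec′ la))           ≡⟨ ev-translate 𝕚 (ι r) (emb (S-E spec′ la)) ⟨
          ev (ι r) (translate 𝕚 (emb (S-E spec′ la))) ∎) u ⟩
      L u (translate 𝕚 (emb (S-E spec′ la)))   ≡⟨ L-translate 𝕚 u (emb (S-E spec′ la)) ⟩
      L (T 𝕚 u) (emb (S-E spec′ la))           ∎
      where
      Z-L : ∀ u → L u (ZL.Z (emb ∘ S-E spec) la) ≡ Z (λ μ → L u (emb (S-E spec μ))) la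
      Z-L u = StripHom.Z-hom {_+_ = addL} {scaleL 𝕚} {[]} {_+_} {𝕚 *_} {0#} (L u) L-add (L-scaleL 𝕚) refl (emb ∘ S-E spec) la

    qO qA qR : List ℕ → List Carrier
    qO la = emb (S-E specOdd la)
    qA la = emb (S-E specAlt la)
    qR la = emb (S-E specRalt la)

    Z-sec-R : ∀ la {b} → Dec b la → Z (L εe ∘ qR) la ≡ S₀ la + 𝕚 * L εo (qO la)
    Z-sec-R la d = begin
      Z (L εe ∘ qR) la                   ≡⟨ Z-umbral specRalt specOdd R⇒O εe la d ⟩
      L (T 𝕚 εe) (qO la)                 ≡⟨ L-cong (qO la) T-sec ⟩
      L (λ k → δ k + 𝕚 * εo k) (qO la)   ≡⟨ L-linear (qO la) 𝕚 ⟩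
      L δ (qO la) + 𝕚 * L εo (qO la)     ≡⟨ cong (_+ 𝕚 * L εo (qO la)) (trans (L-cong (qO la) δ-pow)
                                               (trans (ev-S 0# specOdd la) (S-cong at-O-zero la))) ⟩
      S₀ la + 𝕚 * L εo (qO la)           ∎

    -- The summand 𝕚 · `S₀` compensates the term -i e^{ix} in the translate of tan: adding 𝕚^k to
    -- zero power sums gives `specAlt` at E = 𝕚, and pairing with e^{ix} is evaluation at 𝕚.
    Z-tan-O : ∀ la {b} → Dec b la → Z (λ μ → L εo (qO μ) + 𝕚 * S₀ μ) la ≡ 𝕚 * L εe (qA la)
    Z-tan-O la d = begin
      Z (λ μ → L εo (qO μ) + 𝕚 * S₀ μ) la        ≡⟨ Z-linear (L εo ∘ qO) S₀ 𝕚 la ⟩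
      Z (L εo ∘ qO) la + 𝕚 * Z S₀ la             ≡⟨ cong₂ (λ x y → x + 𝕚 * y) first second ⟩
      (𝕚 * L εe (qA la) + - 𝕚 * ev 𝕚 (qA la)) + 𝕚 * ev 𝕚 (qA la)
        ≡⟨ solve 3 (λ i x y → (i :* x :+ (:con (ℚ.- 1ℚ) :* i) :* y) :+ i :* y := i :* x) refl 𝕚 _ _ ⟩
      𝕚 * L εe (qA la)                           ∎
      where
      first : Z (L εo ∘ qO) la ≡ 𝕚 * L εe (qA la) + - 𝕚 * ev 𝕚 (qA la)
      first = begin
        Z (L εo ∘ qO) la                               ≡⟨ Z-umbral specOdd specAlt O⇒A εo la d ⟩
        L (T 𝕚 εo) (qA la)                             ≡⟨ L-cong (qA la) T-tan ⟩
        L (λ k → 𝕚 * εe k + - 𝕚 * 𝕚 ^ k) (qA la)       ≡⟨ L-linear (qA la) (- 𝕚) ⟩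
        L (λ k → 𝕚 * εe k) (qA la) + - 𝕚 * ev 𝕚 (qA la) ≡⟨ cong (_+ - 𝕚 * ev 𝕚 (qA la)) (L-scale (qA la) 𝕚) ⟩
        𝕚 * L εe (qA la) + - 𝕚 * ev 𝕚 (qA la)          ∎
      second : Z S₀ la ≡ ev 𝕚 (qA la)
      second = begin
        Z S₀ la                    ≡⟨ S-branch (λ _ → 0#) 𝕚 la d ⟨
        S (λ k → 0# + 𝕚 ^ k) la    ≡⟨ S-cong 0⇒A la ⟩
        S (at 𝕚 specAlt) la        ≡⟨ ev-S 𝕚 specAlt la ⟨
        ev 𝕚 (qA la)               ∎

    𝕚-cancel : ∀ {x y} → 𝕚 * x ≡ 𝕚 * y → x ≡ y
    𝕚-cancel {x} {y} e = trans (sym (unit x)) (trans (cong (- 𝕚 *_) e) (unit y))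
      where
      unit : ∀ x → - 𝕚 * (𝕚 * x) ≡ x
      unit x = trans (solve 2 (λ i x → (:con (ℚ.- 1ℚ) :* i) :* (i :* x) := :con (ℚ.- 1ℚ) :* (i :* i :* x)) refl 𝕚 x)
        (trans (cong (λ y → - (y * x)) 𝕚²) (solve 1 (λ x → :con (ℚ.- 1ℚ) :* ((:con (ℚ.- 1ℚ) :* :con 1ℚ) :* x) := x) refl x))

    agree : ∀ {f g : List ℕ → Carrier} →
      (∀ la {b} → Dec b la → (∀ μ → Dec b μ → sum μ < sum la → f μ ≡ g μ) → f la ≡ g la) →
      ∀ la {b} → Dec b la → f la ≡ g la
    agree {f} {g} step la d = <-rec (λ n → ∀ la {b} → Dec b la → sum la ≡ n → f la ≡ g la)
      (λ n rec la d e → step la d (λ μ dμ lt → rec (subst (sum μ <_) e lt) μ dμ refl)) (sum la) la d refl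

    -- The strip operator is unitriangular with respect to size, so its value at λ determines f at λ
    -- once all smaller shapes are known.
    leading : ∀ {f g : List ℕ → Carrier} la {b} → Dec b la → (∀ μ → Dec b μ → sum μ < sum la → f μ ≡ g μ) →
      Z f la ≡ Z g la → f la ≡ g la
    leading {f} {g} la d rec e = x-y≡0⇒x≡y (begin
      f la - g la                            ≡⟨ solve 3 (λ f g z → f :+ :con (ℚ.- 1ℚ) :* g := (z :+ f) :+ :con (ℚ.- 1ℚ) :* (z :+ g)) refl (f la) (g la) (Z f la) ⟩
      (Z f la + f la) - (Z f la + g la)      ≡⟨ cong (λ x → (Z f la + f la) - x) (Z-leading 𝕚 la d rec) ⟩
      (Z f la + f la) - (Z g la + f la)      ≡⟨ cong (λ x → (Z f la + f la) - (x + f la)) e ⟨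
      (Z f la + f la) - (Z f la + f la)      ≡⟨ x-x≡0 _ ⟩
      0#                                     ∎)

    private
      when-cong : ∀ {b b′ x} → b ≡ b′ → when b x ≡ when b′ x
      when-cong refl = refl

    -- Reverse alternating tableaux

    module Ralt where
      w : ℕ → Bool
      w k = not (isOdd k)

      open SYT 𝔸 w

      private
        w-suc : ∀ m → w (suc m) ≡ not (w m)
        w-suc m = cong not (isOdd-suc m)

        F : List ℕ → Carrier
        F = L εe ∘ qR

        f′ : List ℕ → Carrier
        f′ = f 𝕚 𝕚² w-suc

        -- On odd sizes both sides vanish, F by parity. On even sizes both have the strip sum `S₀`:
        -- the tangent term in `Z-sec-R` drops out by parity, and `Zf-zero`, `Zf-suc` give 1 and 0.
        -- Induction on the size then applies `leading`.
        f≡F : ∀ la {b} → Dec b la → f′ la ≡ F la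
        f≡F = agree step
          where
          step : ∀ la {b} → Dec b la → (∀ μ → Dec b μ → sum μ < sum la → f′ μ ≡ F μ) → f′ la ≡ F la
          step la d rec = go (sum la) (isOdd (sum la)) refl refl
            where
            ZF : isOdd (sum la) ≡ false → Z F la ≡ S₀ la
            ZF e = trans (Z-sec-R la d) (trans (cong (λ x → S₀ la + 𝕚 * x) (L-parity specOdd odd-O la εo-odd e))
              (solve 2 (λ s i → s :+ i :* :con 0ℚ := s) refl (S₀ la) 𝕚))
            go : ∀ n b → sum la ≡ n → isOdd n ≡ b → f′ la ≡ F la
            go zero b e eo = leading la d rec (trans (Zf-zero 𝕚 𝕚² w-suc la d e)
              (trans (sym (S₀-empty la d e)) (sym (ZF (cong isOdd e)))))
            go (suc n) false e eo = leading la d rec (trans (Zf-suc 𝕚 𝕚² w-suc la n d e)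
              (trans (when-cong (cong (λ b → not (not b)) eo)) (trans (sym (S₀-nonempty la d n e)) (sym (ZF (trans (cong isOdd e) eo))))))
            go (suc n) true e eo = trans (f-suc 𝕚 𝕚² w-suc la n e) (trans (when-cong (cong not eo))
              (sym (L-parity specRalt odd-R la εe-even (trans (cong isOdd e) eo))))

      ralt-even : ∀ la {b} → Dec b la → isOdd (sum la) ≡ false → K (sum la) la (const true) ≡ L ε (qR la)
      ralt-even la d eo = trans (go (sum la) refl eo) (trans (f≡F la d) (sym (L-ε-even specRalt odd-R la eo)))
        where
        go : ∀ n → sum la ≡ n → isOdd n ≡ false → K (sum la) la (const true) ≡ f′ la
        go zero e _ = trans (cong (λ m → K m la (const true)) e) (trans (number-empty 𝕚 𝕚² w-suc la (const true) e) (sym (f-zero 𝕚 𝕚² w-suc la e)))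
        go (suc n) e eo = sym (trans (f-suc 𝕚 𝕚² w-suc la n e) (when-cong (cong not eo)))

      -- Odd sizes are not values of f; they are read off from the strip sum, which is 𝕚 times the
      -- count on one side and 𝕚 times the tangent value on the other.
      ralt-odd : ∀ la {b} → Dec b la → isOdd (sum la) ≡ true → K (sum la) la (const true) ≡ L ε (qO la)
      ralt-odd la d eo = trans (𝕚-cancel (go (sum la) refl eo)) (sym (L-ε-odd specOdd odd-O la eo))
        where
        go : ∀ n → sum la ≡ n → isOdd n ≡ true → 𝕚 * K (sum la) la (const true) ≡ 𝕚 * L εo (qO la)
        go (suc n) e eo = begin
          𝕚 * K (sum la) la (const true)     ≡⟨ cong (λ b → when (not (not b)) (𝕚 * K (sum la) la (const true))) eo ⟨
          when (not (w (suc n))) (𝕚 * K (sum la) la (const true)) ≡⟨ Zf-suc 𝕚 𝕚² w-suc la n d e ⟨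
          Z f′ la                            ≡⟨ Z-cong la d (λ μ dμ _ _ → f≡F μ dμ) ⟩
          Z F la                             ≡⟨ Z-sec-R la d ⟩
          S₀ la + 𝕚 * L εo (qO la)           ≡⟨ cong (_+ 𝕚 * L εo (qO la)) (S₀-nonempty la d n e) ⟩
          0# + 𝕚 * L εo (qO la)              ≡⟨ +-identityˡ _ ⟩
          𝕚 * L εo (qO la)                   ∎

    -- Alternating tableaux

    module Alt where
      open SYT 𝔸 isOdd

      private
        F : List ℕ → Carrier
        F μ = L εo (qO μ) + 𝕚 * S₀ μ

        f′ : List ℕ → Carrier
        f′ = f 𝕚 𝕚² isOdd-suc

        -- The parities are exchanged. On even sizes both sides equal 𝕚 · `S₀`; the value 𝕚 at the
        -- empty shape comes from `isOdd 0` being false. On odd sizes both strip sums vanish, that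
        -- of F because `Z-tan-O` leaves a secant value of odd size.
        f≡F : ∀ la {b} → Dec b la → f′ la ≡ F la
        f≡F = agree step
          where
          step : ∀ la {b} → Dec b la → (∀ μ → Dec b μ → sum μ < sum la → f′ μ ≡ F μ) → f′ la ≡ F la
          step la d rec = go (sum la) (isOdd (sum la)) refl refl
            where
            F-even : isOdd (sum la) ≡ false → F la ≡ 𝕚 * S₀ la
            F-even e = trans (cong (_+ 𝕚 * S₀ la) (L-parity specOdd odd-O la εo-odd e)) (+-identityˡ _)
            go : ∀ n b → sum la ≡ n → isOdd n ≡ b → f′ la ≡ F la
            go zero b e eo = trans (f-zero 𝕚 𝕚² isOdd-suc la e) (sym (trans (F-even (cong isOdd e))
              (trans (cong (𝕚 *_) (S₀-empty la d e)) (*-identityʳ 𝕚))))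
            go (suc n) false e eo = trans (f-suc 𝕚 𝕚² isOdd-suc la n e) (trans (when-cong eo)
              (sym (trans (F-even (trans (cong isOdd e) eo)) (trans (cong (𝕚 *_) (S₀-nonempty la d n e)) (zeroʳ 𝕚)))))
            go (suc n) true e eo = leading la d rec (trans (Zf-suc 𝕚 𝕚² isOdd-suc la n d e) (trans (when-cong (cong not eo))
              (sym (trans (Z-tan-O la d) (trans (cong (𝕚 *_) (L-parity specAlt odd-A la εe-even (trans (cong isOdd e) eo))) (zeroʳ 𝕚))))))

      alt-odd : ∀ la {b} → Dec b la → isOdd (sum la) ≡ true → K (sum la) la (const true) ≡ L ε (qO la)
      alt-odd la d eo = trans (go (sum la) refl eo) (sym (L-ε-odd specOdd odd-O la eo))
        where
        go : ∀ n → sum la ≡ n → isOdd n ≡ true → K (sum la) la (const true) ≡ L εo (qO la)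
        go (suc n) e eo = begin
          K (sum la) la (const true)      ≡⟨ cong (λ b → when b (K (sum la) la (const true))) eo ⟨
          when (isOdd (suc n)) (K (sum la) la (const true)) ≡⟨ f-suc 𝕚 𝕚² isOdd-suc la n e ⟨
          f′ la                           ≡⟨ f≡F la d ⟩
          L εo (qO la) + 𝕚 * S₀ la        ≡⟨ cong (λ x → L εo (qO la) + 𝕚 * x) (S₀-nonempty la d n e) ⟩
          L εo (qO la) + 𝕚 * 0#           ≡⟨ solve 2 (λ x i → x :+ i :* :con 0ℚ := x) refl _ 𝕚 ⟩
          L εo (qO la)                    ∎

      -- Even sizes are read off from the strip sum of f, where each count appears with the factor
      -- 𝕚. The empty shape fits in as well, because `Zf-zero` gives 𝕚 · 1.
      alt-even : ∀ la {b} → Dec b la → isOdd (sum la) ≡ false → K (sum la) la (const true) ≡ L ε (qA la)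
      alt-even la d eo = trans (𝕚-cancel (trans (go (sum la) refl eo) (trans (Z-cong la d (λ μ dμ _ _ → f≡F μ dμ)) (Z-tan-O la d))))
          (sym (L-ε-even specAlt odd-A la eo))
        where
        go : ∀ n → sum la ≡ n → isOdd n ≡ false → 𝕚 * K (sum la) la (const true) ≡ Z f′ la
        go zero e _ = trans (cong (λ m → 𝕚 * K m la (const true)) e)
          (trans (cong (𝕚 *_) (number-empty 𝕚 𝕚² isOdd-suc la (const true) e)) (trans (*-identityʳ 𝕚) (sym (Zf-zero 𝕚 𝕚² isOdd-suc la d e))))
        go (suc n) e eo = sym (trans (Zf-suc 𝕚 𝕚² isOdd-suc la n d e) (when-cong (cong not eo)))

-- Algebraic independence of the power sums

module Eval (O : Ops) where
  open Ops O

  eval : ∀ {n} → (Fin n → Carrier) → Poly n → Carrier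
  eval ρ (con c) = ι c
  eval ρ (var i) = ρ i
  eval ρ (P ⊕ Q) = eval ρ P + eval ρ Q
  eval ρ (P ⊗ Q) = eval ρ P * eval ρ Q

  eval-cong : ∀ {n} {ρ σ : Fin n → Carrier} → (∀ i → ρ i ≡ σ i) → ∀ P → eval ρ P ≡ eval σ P
  eval-cong e (con c) = refl
  eval-cong e (var i) = e i
  eval-cong e (P ⊕ Q) = cong₂ _+_ (eval-cong e P) (eval-cong e Q)
  eval-cong e (P ⊗ Q) = cong₂ _*_ (eval-cong e P) (eval-cong e Q)

  sumFin : ∀ n → (Fin n → Carrier) → Carrier
  sumFin zero F = 0#
  sumFin (suc n) F = F zero + sumFin n (F ∘ suc)

  sumFin-cong : ∀ n {F G} → (∀ i → F i ≡ G i) → sumFin n F ≡ sumFin n G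
  sumFin-cong zero e = refl
  sumFin-cong (suc n) e = cong₂ _+_ (e zero) (sumFin-cong n (e ∘ suc))

  powers : ∀ {n} → (Fin n → Carrier) → ℕ → Carrier
  powers {n} x k = sumFin n (λ i → x i ^ k)

module EvalHom {O P : Ops} (H : Hom O P) where
  open Hom H
  private
    module O = Eval O
    module P = Eval P

  eval-hom : ∀ {n} (ρ : Fin n → Ops.Carrier O) F → φ (O.eval ρ F) ≡ P.eval (φ ∘ ρ) F
  eval-hom ρ (con c) = φ-ι c
  eval-hom ρ (var i) = refl
  eval-hom ρ (F ⊕ G) = trans (φ-+ _ _) (cong₂ (Ops._+_ P) (eval-hom ρ F) (eval-hom ρ G))
  eval-hom ρ (F ⊗ G) = trans (φ-* _ _) (cong₂ (Ops._*_ P) (eval-hom ρ F) (eval-hom ρ G))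

  sumFin-hom : ∀ n F → φ (O.sumFin n F) ≡ P.sumFin n (φ ∘ F)
  sumFin-hom zero F = φ-ι _
  sumFin-hom (suc n) F = trans (φ-+ _ _) (cong (Ops._+_ P _) (sumFin-hom n (F ∘ suc)))

  powers-hom : ∀ {n} (x : Fin n → Ops.Carrier O) k → φ (O.powers x k) ≡ P.powers (φ ∘ x) k
  powers-hom {n} x k = trans (sumFin-hom n _) (P.sumFin-cong n (λ i → HomS.φ-^ H (x i) k))

substP-eval : ∀ {n} spec (P : Poly n) → substP spec P ≡ Eval.eval PolyE-ops (λ i → spec (suc (toℕ i))) P
substP-eval spec (con c) = refl
substP-eval spec (var i) = refl
substP-eval spec (P ⊕ Q) = cong₂ addE (substP-eval spec P) (substP-eval spec Q)
substP-eval spec (P ⊗ Q) = cong₂ mulE (substP-eval spec P) (substP-eval spec Q)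

evalℚ-eval : ∀ {n} (ρ : Fin n → ℚ) P → evalℚ ρ P ≡ Eval.eval ℚ-ops ρ P
evalℚ-eval ρ (con c) = refl
evalℚ-eval ρ (var i) = refl
evalℚ-eval ρ (P ⊕ Q) = cong₂ ℚ._+_ (evalℚ-eval ρ P) (evalℚ-eval ρ Q)
evalℚ-eval ρ (P ⊗ Q) = cong₂ ℚ._*_ (evalℚ-eval ρ P) (evalℚ-eval ρ Q)

powerSum-powers : ∀ {n} (x : Fin n → ℚ) k → powerSum k n x ≡ Eval.powers ℚ-ops x k
powerSum-powers {n} x k = trans (cong ℚsum (map-tabulate (λ i → i) (λ i → powℚ (x i) k))) (go n x)
  where
  go : ∀ n (x : Fin n → ℚ) → ℚsum (tabulate (λ i → powℚ (x i) k)) ≡ Eval.powers ℚ-ops x k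
  go zero x = refl
  go (suc n) x = cong₂ ℚ._+_ (powℚ-^ (x zero) k) (go n (x ∘ suc))

kronecker : ∀ {n} → Fin n → Fin n → ℚ
kronecker zero zero = 1ℚ
kronecker zero (suc j) = 0ℚ
kronecker (suc i) zero = 0ℚ
kronecker (suc i) (suc j) = kronecker i j

∂ : ∀ {n} → Fin n → Poly n → Poly n
∂ k (con c) = con 0ℚ
∂ k (var j) = con (kronecker j k)
∂ k (P ⊕ Q) = ∂ k P ⊕ ∂ k Q
∂ k (P ⊗ Q) = (∂ k P ⊗ Q) ⊕ (P ⊗ ∂ k Q)

module EvalLaws (𝔸 : ℚAlgebra) where
  open ℚAlgebra 𝔸
  open Solver
  open Eval ops

  sumFin-zero : ∀ n {F} → (∀ k → F k ≡ 0#) → sumFin n F ≡ 0#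
  sumFin-zero zero e = refl
  sumFin-zero (suc n) e = trans (cong₂ _+_ (e zero) (sumFin-zero n (e ∘ suc))) (+-identityˡ _)

  sumFin-linear : ∀ n F G a b → sumFin n (λ k → a * F k + b * G k) ≡ a * sumFin n F + b * sumFin n G
  sumFin-linear zero F G a b = solve 2 (λ a b → :con 0ℚ := a :* :con 0ℚ :+ b :* :con 0ℚ) refl a b
  sumFin-linear (suc n) F G a b = trans (cong₂ _+_ refl (sumFin-linear n (F ∘ suc) (G ∘ suc) a b))
    (solve 6 (λ a b x y s t → (a :* x :+ b :* y) :+ (a :* s :+ b :* t) := a :* (x :+ s) :+ b :* (y :+ t)) refl a b (F zero) (G zero) _ _)

  sumFin-+ : ∀ n F G → sumFin n (λ k → F k + G k) ≡ sumFin n F + sumFin n G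
  sumFin-+ zero F G = sym (+-identityˡ _)
  sumFin-+ (suc n) F G = trans (cong₂ _+_ refl (sumFin-+ n (F ∘ suc) (G ∘ suc)))
    (solve 4 (λ x y s t → (x :+ y) :+ (s :+ t) := (x :+ s) :+ (y :+ t)) refl (F zero) (G zero) _ _)

  sumFin-* : ∀ n F a → sumFin n (λ k → a * F k) ≡ a * sumFin n F
  sumFin-* zero F a = sym (zeroʳ a)
  sumFin-* (suc n) F a = trans (cong₂ _+_ refl (sumFin-* n (F ∘ suc) a))
    (solve 3 (λ a x s → a :* x :+ a :* s := a :* (x :+ s)) refl a (F zero) _)

  sumFin-kronecker : ∀ n (F : Fin n → Carrier) j → sumFin n (λ k → F k * ι (kronecker j k)) ≡ F j
  sumFin-kronecker (suc n) F zero = trans (cong₂ _+_ (*-identityʳ (F zero)) (sumFin-zero n (λ k → zeroʳ (F (suc k))))) (+-identityʳ _)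
  sumFin-kronecker (suc n) F (suc j) = trans (cong₂ _+_ (zeroʳ (F zero)) (sumFin-kronecker n (F ∘ suc) j)) (+-identityˡ _)

  sum-of-sums : ∀ n (z f g : Fin n → Carrier) → sumFin n (λ k → z k * (f k + g k)) ≡ sumFin n (λ k → z k * f k) + sumFin n (λ k → z k * g k)
  sum-of-sums n z f g = trans (sumFin-cong n (λ k → solve 3 (λ a b c → a :* (b :+ c) := a :* b :+ a :* c) refl (z k) (f k) (g k)))
    (sumFin-+ n (λ k → z k * f k) (λ k → z k * g k))

  leibniz-sum : ∀ n (z f′ g′ : Fin n → Carrier) f g →
    sumFin n (λ k → z k * (f′ k * g + f * g′ k)) ≡ f * sumFin n (λ k → z k * g′ k) + sumFin n (λ k → z k * f′ k) * g
  leibniz-sum n z f′ g′ f g = trans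
    (sumFin-cong n (λ k → solve 5 (λ a b g f c → a :* (b :* g :+ f :* c) := f :* (a :* c) :+ g :* (a :* b)) refl (z k) (f′ k) g f (g′ k)))
    (trans (sumFin-linear n (λ k → z k * g′ k) (λ k → z k * f′ k) f g) (cong₂ _+_ refl (*-comm g _)))

  ev-tabulate : ∀ n r (c : Fin n → Carrier) → Univariate.ev 𝔸 r (tabulate c) ≡ sumFin n (λ k → r ^ toℕ k * c k)
  ev-tabulate zero r c = refl
  ev-tabulate (suc n) r c = cong₂ _+_ (*-comm (c zero) 1#)
    (trans (Univariate.L-scale 𝔸 (tabulate (c ∘ suc)) r) (trans (cong (r *_) (ev-tabulate n r (c ∘ suc)))
      (trans (sym (sumFin-* n (λ k → r ^ toℕ k * c (suc k)) r)) (sumFin-cong n (λ k → sym (*-assoc r (r ^ toℕ k) (c (suc k))))))))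

-- Derivatives through dual numbers

module Q = ℚAlgebra ℚ-algebra
module Dual = ℚAlgebra (quad-algebra 0ℚ)

private
  module EQ = Eval ℚ-ops
  module ED = Eval (quad-ops 0ℚ)
  module UQ = Univariate ℚ-algebra
  module LQ = EvalLaws ℚ-algebra
  module UD = Univariate (quad-algebra 0ℚ)

open Q using (_+_; _*_; _^_) renaming (_-_ to _−_)
open Q.Solver

directional : ∀ {n} → (Fin n → Quad 0ℚ) → Poly n → ℚ
directional {n} ρ F = EQ.sumFin n (λ k → im (ρ k) * EQ.eval (re ∘ ρ) (∂ k F))

-- First-order Taylor expansion, exact because θ² = 0: the θ-part is the derivative in the direction
-- of the θ-parts of ρ.
dual-eval : ∀ {n} (ρ : Fin n → Quad 0ℚ) F → ED.eval ρ F ≡ EQ.eval (re ∘ ρ) F +θ directional ρ F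
dual-eval {n} ρ (con c) = cong (c +θ_) (sym (LQ.sumFin-zero n (λ k → Q.zeroʳ (im (ρ k)))))
dual-eval {n} ρ (var j) = cong (re (ρ j) +θ_) (sym (LQ.sumFin-kronecker n (im ∘ ρ) j))
dual-eval {n} ρ (F ⊕ G) = trans (cong₂ Dual._+_ (dual-eval ρ F) (dual-eval ρ G)) (cong (EQ.eval (re ∘ ρ) (F ⊕ G) +θ_)
  (sym (LQ.sum-of-sums n (im ∘ ρ) (λ k → EQ.eval (re ∘ ρ) (∂ k F)) (λ k → EQ.eval (re ∘ ρ) (∂ k G)))))
dual-eval {n} ρ (F ⊗ G) = trans (cong₂ Dual._*_ (dual-eval ρ F) (dual-eval ρ G)) (cong₂ _+θ_
  (solve 4 (λ f g x y → f :* g :+ :con 0ℚ :* (x :* y) := f :* g) refl f g (directional ρ F) (directional ρ G))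
  (sym (LQ.leibniz-sum n (im ∘ ρ) (λ k → EQ.eval (re ∘ ρ) (∂ k F)) (λ k → EQ.eval (re ∘ ρ) (∂ k G)) f g)))
  where
  f = EQ.eval (re ∘ ρ) F
  g = EQ.eval (re ∘ ρ) G

dual-pow : ∀ a b k → Dual._^_ (a +θ b) (suc k) ≡ (a ^ suc k) +θ (natℚ (suc k) * a ^ k * b)
dual-pow a b zero = cong₂ _+θ_
  (solve 2 (λ a b → a :* :con 1ℚ :+ :con 0ℚ :* (b :* :con 0ℚ) := a :* :con 1ℚ) refl a b)
  (solve 2 (λ a b → a :* :con 0ℚ :+ b :* :con 1ℚ := :con 1ℚ :* :con 1ℚ :* b) refl a b)
dual-pow a b (suc k) = trans (cong ((a +θ b) Dual.*_) (dual-pow a b k)) (cong₂ _+θ_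
  (solve 3 (λ x b y → x :+ :con 0ℚ :* (b :* y) := x) refl (a * a ^ suc k) b _)
  (trans (solve 4 (λ a n p b → a :* (n :* p :* b) :+ b :* (a :* p) := (:con 1ℚ :+ n) :* (a :* p) :* b) refl a (natℚ (suc k)) (a ^ k) b)
    (cong (λ m → m * (a * a ^ k) * b) (sym (natℚ-suc (suc k))))))

natℚ≢0 : ∀ k → natℚ (suc k) ≢ 0ℚ
natℚ≢0 k ()

natℚ-injective : ∀ {m n} → natℚ m ≡ natℚ n → m ≡ n
natℚ-injective refl = refl

∂s : ∀ {n} → List (Fin n) → Poly n → Poly n
∂s [] F = F
∂s (k ∷ ks) F = ∂s ks (∂ k F)

∂s-⊕ : ∀ {n} ks (F G : Poly n) → ∂s ks (F ⊕ G) ≡ ∂s ks F ⊕ ∂s ks G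
∂s-⊕ [] F G = refl
∂s-⊕ (k ∷ ks) F G = ∂s-⊕ ks (∂ k F) (∂ k G)

-- A semantic form of "degree less than d". The degree of an expression would not do, since `∂` does
-- not lower it: the derivative of `con c ⊗ var j` still contains `con 0ℚ ⊗ var j`. At d = 0 all
-- further derivatives are required to vanish too, which lets the product rule be iterated.
Nilpotent : ∀ {n} → ℕ → Poly n → Set
Nilpotent zero F = ∀ ks y → EQ.eval y (∂s ks F) ≡ 0ℚ
Nilpotent (suc d) F = ∀ k → Nilpotent d (∂ k F)

module _ {n : ℕ} where
  nilpotent-con0 : ∀ ks y → EQ.eval y (∂s {n} ks (con 0ℚ)) ≡ 0ℚ
  nilpotent-con0 [] y = refl
  nilpotent-con0 (k ∷ ks) y = nilpotent-con0 ks y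

  nilpotent-suc : ∀ d {F : Poly n} → Nilpotent d F → Nilpotent (suc d) F
  nilpotent-suc zero z k ks y = z (k ∷ ks) y
  nilpotent-suc (suc d) z k = nilpotent-suc d (z k)

  nilpotent-raise : ∀ c d {F : Poly n} → Nilpotent d F → Nilpotent (c ℕ.+ d) F
  nilpotent-raise zero d z = z
  nilpotent-raise (suc c) d z = nilpotent-suc (c ℕ.+ d) (nilpotent-raise c d z)

  nilpotent-⊕ : ∀ d {F G : Poly n} → Nilpotent d F → Nilpotent d G → Nilpotent d (F ⊕ G)
  nilpotent-⊕ zero {F} {G} z w ks y = trans (cong (EQ.eval y) (∂s-⊕ ks F G)) (trans (cong₂ _+_ (z ks y) (w ks y)) refl)
  nilpotent-⊕ (suc d) z w k = nilpotent-⊕ d (z k) (w k)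

  nilpotent-⊗ˡ : ∀ {F} G → Nilpotent {n} 0 F → Nilpotent 0 (F ⊗ G)
  nilpotent-⊗ˡ {F} G z [] y = trans (cong (_* EQ.eval y G) (z [] y)) (Q.zeroˡ (EQ.eval y G))
  nilpotent-⊗ˡ {F} G z (k ∷ ks) y = trans (cong (EQ.eval y) (∂s-⊕ ks (∂ k F ⊗ G) (F ⊗ ∂ k G)))
    (trans (cong₂ _+_ (nilpotent-⊗ˡ G (λ ks → z (k ∷ ks)) ks y) (nilpotent-⊗ˡ (∂ k G) z ks y)) refl)

  nilpotent-⊗ʳ : ∀ F {G} → Nilpotent {n} 0 G → Nilpotent 0 (F ⊗ G)
  nilpotent-⊗ʳ F {G} z [] y = trans (cong (EQ.eval y F *_) (z [] y)) (Q.zeroʳ (EQ.eval y F))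
  nilpotent-⊗ʳ F {G} z (k ∷ ks) y = trans (cong (EQ.eval y) (∂s-⊕ ks (∂ k F ⊗ G) (F ⊗ ∂ k G)))
    (trans (cong₂ _+_ (nilpotent-⊗ʳ (∂ k F) z ks y) (nilpotent-⊗ʳ F (λ ks → z (k ∷ ks)) ks y)) refl)

  nilpotent-⊗ : ∀ a b {F G : Poly n} → Nilpotent a F → Nilpotent b G → Nilpotent (a ℕ.+ b) (F ⊗ G)
  nilpotent-⊗ zero b {F} {G} z w = subst (λ d → Nilpotent d (F ⊗ G)) (ℕₚ.+-identityʳ b) (nilpotent-raise b 0 (nilpotent-⊗ˡ G z))
  nilpotent-⊗ (suc a) zero {F} {G} z w = nilpotent-raise (suc a) 0 (nilpotent-⊗ʳ F w)
  nilpotent-⊗ (suc a) (suc b) {F} {G} z w k = nilpotent-⊕ (a ℕ.+ suc b)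
    (nilpotent-⊗ a (suc b) (z k) w)
    (subst (λ d → Nilpotent d (F ⊗ ∂ k G)) (sym (ℕₚ.+-suc a b)) (nilpotent-⊗ (suc a) b z (w k)))

  nilpotent : ∀ (F : Poly n) → ∃ λ d → Nilpotent d F
  nilpotent (con c) = 1 , λ _ → nilpotent-con0
  nilpotent (var j) = 2 , λ _ _ → nilpotent-con0
  nilpotent (F ⊕ G) with nilpotent F | nilpotent G
  ... | a , z | b , w = a ℕ.+ b , nilpotent-⊕ (a ℕ.+ b) (subst (λ d → Nilpotent d F) (ℕₚ.+-comm b a) (nilpotent-raise b a z)) (nilpotent-raise a b w)
  nilpotent (F ⊗ G) with nilpotent F | nilpotent G
  ... | a , z | b , w = a ℕ.+ b , nilpotent-⊗ a b z w

private
  All-emb : ∀ {p} → UQ.AllZero (UQ.emb p) → UD.AllZero (UD.emb p)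
  All-emb {p} z = Allₚ.map⁺ (All.map (λ e → cong (_+θ 0ℚ) e) (Allₚ.map⁻ z))

  im-L : ∀ u p → im (UD.L u (UD.emb p)) ≡ UQ.L (im ∘ u) (UQ.emb p)
  im-L u [] = refl
  im-L u (a ∷ p) = cong₂ _+_ (solve 3 (λ a x y → a :* y :+ :con 0ℚ :* x := a :* y) refl a (re (u 0)) (im (u 0))) (im-L (u ∘ suc) p)

  weighted : ℕ → List ℚ → List ℚ
  weighted j [] = []
  weighted j (b ∷ p) = natℚ (suc j) * b ∷ weighted (suc j) p

  L-weighted : ∀ j v p → UQ.L (λ k → natℚ (suc (j ℕ.+ k)) * v k) (UQ.emb p) ≡ UQ.L v (UQ.emb (weighted j p))
  L-weighted j v [] = refl
  L-weighted j v (b ∷ p) = cong₂ _+_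
    (trans (cong (λ m → b * (natℚ (suc m) * v 0)) (ℕₚ.+-identityʳ j)) (solve 3 (λ b n v → b :* (n :* v) := n :* b :* v) refl b (natℚ (suc j)) (v 0)))
    (trans (UQ.L-cong (UQ.emb p) (λ k → cong (λ m → natℚ (suc m) * v (suc k)) (ℕₚ.+-suc j k))) (L-weighted (suc j) (v ∘ suc) p))

  weighted-zero : ∀ j p → UQ.AllZero (UQ.emb (weighted j p)) → UQ.AllZero (UQ.emb p)
  weighted-zero j [] [] = []
  weighted-zero j (b ∷ p) (e ∷ es) = UQ.ι-cancel (natℚ≢0 j) e ∷ weighted-zero (suc j) p es

Injective : ∀ {n} → (Fin n → ℚ) → Set
Injective x = ∀ {i j} → x i ≡ x j → i ≡ j

atPowers : ∀ {n} → (Fin n → ℚ) → Poly n → ℚ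
atPowers x = EQ.eval (λ k → EQ.powers x (suc (toℕ k)))

module _ {n : ℕ} (F : Poly n) (vanishes : ∀ x → Injective x → atPowers x F ≡ 0ℚ) where

  private
    -- On the line x + s e_i the function vanishes except at the finitely many s where coordinate i
    -- may meet another. Hence `G`, a polynomial in s, is zero and can be evaluated at the dual
    -- number θ; the θ-part is the i-th partial derivative at x.
    module AtPoint (x : Fin n → ℚ) (inj : Injective x) (i : Fin n) where
      line : Fin n → PolyE
      line j = x j ∷ kronecker i j ∷ []

      G : PolyE
      G = Eval.eval PolyE-ops (λ k → Eval.powers PolyE-ops line (suc (toℕ k))) F

      moved : ℚ → Fin n → ℚ
      moved s j = x j + s * kronecker i j

      ev-G : ∀ s → UQ.ev s (UQ.emb G) ≡ atPowers (moved s) F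
      ev-G s = trans (EvalHom.eval-hom H _ F) (EQ.eval-cong (λ k → trans (EvalHom.powers-hom H line (suc (toℕ k)))
          (EQ.sumFin-cong n (λ j → cong (_^ suc (toℕ k)) (coordinate j)))) F)
        where
        H = Umbral.ev-hom ℚ-algebra s
        coordinate : ∀ j → UQ.ev s (UQ.emb (line j)) ≡ moved s j
        coordinate j = solve 3 (λ a s b → a :* :con 1ℚ :+ (b :* (s :* :con 1ℚ) :+ :con 0ℚ) := a :+ s :* b) refl (x j) s (kronecker i j)

      bad : List ℚ
      bad = tabulate (λ j → x j ℚ.- x i)

      diagonal : ∀ {n} (i : Fin n) → kronecker i i ≡ 1ℚ
      diagonal zero = refl
      diagonal (suc i) = diagonal i

      off-diagonal : ∀ {n} {i j : Fin n} → i ≢ j → kronecker i j ≡ 0ℚ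
      off-diagonal {i = zero} {zero} ne = ⊥-elim (ne refl)
      off-diagonal {i = zero} {suc j} ne = refl
      off-diagonal {i = suc i} {zero} ne = refl
      off-diagonal {i = suc i} {suc j} ne = off-diagonal (ne ∘ cong suc)

      moved-i : ∀ s → moved s i ≡ x i + s
      moved-i s = trans (cong (λ d → x i + s * d) (diagonal i)) (cong (x i +_) (Q.*-identityʳ s))

      moved-j : ∀ s {j} → i ≢ j → moved s j ≡ x j
      moved-j s {j} ne = trans (cong (λ d → x j + s * d) (off-diagonal ne)) (solve 2 (λ x s → x :+ s :* :con 0ℚ := x) refl (x j) s)

      collide : ∀ s {y} → x i + s ≡ y → s ≡ y ℚ.- x i
      collide s {y} e = trans (trans (sym (ℚₚ.+-identityʳ s)) (trans (cong (s +_) (sym (ℚₚ.+-inverseʳ (x i))))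
        (trans (sym (ℚₚ.+-assoc s (x i) (ℚ.- x i))) (cong (ℚ._- x i) (ℚₚ.+-comm s (x i)))))) (cong (ℚ._- x i) e)

      good : ∀ s → All (s ≢_) bad → Injective (moved s)
      good s ok {j} {l} e with i Fin.≟ j | i Fin.≟ l
      ... | yes refl | yes refl = refl
      ... | yes refl | no ne = ⊥-elim (Allₚ.tabulate⁻ ok l (collide s (trans (sym (moved-i s)) (trans e (moved-j s ne)))))
      ... | no ne | yes refl = ⊥-elim (Allₚ.tabulate⁻ ok j (collide s (trans (sym (moved-i s)) (trans (sym e) (moved-j s ne)))))
      ... | no ne | no ne′ = inj (trans (sym (moved-j s ne)) (trans e (moved-j s ne′)))

      G-zero : UQ.AllZero (UQ.emb G)
      G-zero = UQ.vanishing bad (UQ.emb G) (λ s ok → trans (ev-G s) (vanishes (moved s) (good s ok)))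

      θ : Quad 0ℚ
      θ = 0ℚ +θ 1ℚ

      p : Fin n → Quad 0ℚ
      p k = ED.powers (λ j → x j +θ kronecker i j) (suc (toℕ k))

      dual-zero : ED.eval p F ≡ Dual.0#
      dual-zero = trans (sym (trans (EvalHom.eval-hom H _ F) (ED.eval-cong (λ k → trans (EvalHom.powers-hom H line (suc (toℕ k)))
          (ED.sumFin-cong n (λ j → cong (λ z → Dual._^_ z (suc (toℕ k))) (coordinate j)))) F)))
          (UD.L-AllZero (λ k → Dual._^_ θ k) (All-emb G-zero))
        where
        H = Umbral.ev-hom (quad-algebra 0ℚ) θ
        coordinate : ∀ j → UD.ev θ (UD.emb (line j)) ≡ x j +θ kronecker i j
        coordinate j = cong₂ _+θ_
          (solve 2 (λ a b → (a :* :con 1ℚ :+ :con 0ℚ :* (:con 0ℚ :* :con 0ℚ)) :+ ((b :* :con 0ℚ :+ :con 0ℚ :* (:con 0ℚ :* :con 1ℚ)) :+ :con 0ℚ) := a) refl (x j) (kronecker i j))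
          (solve 2 (λ a b → (a :* :con 0ℚ :+ :con 0ℚ :* :con 1ℚ) :+ ((b :* :con 1ℚ :+ :con 0ℚ :* :con 0ℚ) :+ :con 0ℚ) := b) refl (x j) (kronecker i j))

      re-sumFin : ∀ m (f : Fin m → Quad 0ℚ) → re (ED.sumFin m f) ≡ EQ.sumFin m (re ∘ f)
      re-sumFin zero f = refl
      re-sumFin (suc m) f = cong (re (f zero) +_) (re-sumFin m (f ∘ suc))

      im-sumFin : ∀ m (f : Fin m → Quad 0ℚ) → im (ED.sumFin m f) ≡ EQ.sumFin m (im ∘ f)
      im-sumFin zero f = refl
      im-sumFin (suc m) f = cong (im (f zero) +_) (im-sumFin m (f ∘ suc))

      re-p : ∀ k → re (p k) ≡ EQ.powers x (suc (toℕ k))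
      re-p k = trans (re-sumFin n _) (EQ.sumFin-cong n (λ j → cong re (dual-pow (x j) (kronecker i j) (toℕ k))))

      im-p : ∀ k → im (p k) ≡ natℚ (suc (toℕ k)) * x i ^ toℕ k
      im-p k = trans (im-sumFin n _) (trans (EQ.sumFin-cong n (λ j → cong im (dual-pow (x j) (kronecker i j) (toℕ k))))
        (LQ.sumFin-kronecker n (λ j → natℚ (suc (toℕ k)) * x j ^ toℕ k) i))

      -- The chain rule Σ_k (k+1) x_i^k ∂_kF = 0, read as an equation for x_i. The coefficients are
      -- the same for every i, so n distinct coordinates are roots of one polynomial with n
      -- coefficients.
      root : UQ.ev (x i) (tabulate (λ k → natℚ (suc (toℕ k)) * atPowers x (∂ k F))) ≡ 0ℚ
      root = begin
        UQ.ev (x i) (tabulate (λ k → natℚ (suc (toℕ k)) * atPowers x (∂ k F)))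
          ≡⟨ LQ.ev-tabulate n (x i) (λ k → natℚ (suc (toℕ k)) * atPowers x (∂ k F)) ⟩
        EQ.sumFin n (λ k → x i ^ toℕ k * (natℚ (suc (toℕ k)) * atPowers x (∂ k F)))
          ≡⟨ EQ.sumFin-cong n (λ k → trans (solve 3 (λ a b c → a :* (b :* c) := b :* a :* c) refl (x i ^ toℕ k) (natℚ (suc (toℕ k))) (atPowers x (∂ k F)))
               (cong₂ _*_ (sym (im-p k)) (EQ.eval-cong (λ j → sym (re-p j)) (∂ k F)))) ⟩
        directional p F
          ≡⟨ cong im (dual-eval p F) ⟨
        im (ED.eval p F)
          ≡⟨ cong im dual-zero ⟩
        0ℚ ∎

  -- The gradient of F at the power sums of x is orthogonal to the rows (k x_i^{k−1})_k, which form
  -- an invertible Vandermonde-type matrix when the x_i are distinct.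
  gradient-vanishes : ∀ k x → Injective x → atPowers x (∂ k F) ≡ 0ℚ
  gradient-vanishes k x inj = UQ.ι-cancel (natℚ≢0 (toℕ k)) (Allₚ.tabulate⁻ zeros k)
    where
    zeros : UQ.AllZero (tabulate (λ k → natℚ (suc (toℕ k)) * atPowers x (∂ k F)))
    zeros = UQ.too-many-roots (tabulate x) _ (AllPairsₚ.tabulate⁺ (λ ne e → ne (inj e)))
      (ℕₚ.≤-reflexive (trans (length-tabulate _) (sym (length-tabulate x))))
      (Allₚ.tabulate⁺ (λ i → AtPoint.root x inj i))

-- Along the line from y₀ to y, the θ-part at s + θ is the derivative and vanishes for every
-- rational s. So all coefficients of positive degree are 0, and the values at s = 1 and s = 0
-- agree.
constant : ∀ {n} (F : Poly n) → (∀ k y → EQ.eval y (∂ k F) ≡ 0ℚ) → ∀ y₀ y → EQ.eval y F ≡ EQ.eval y₀ F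
constant {n} F e y₀ y = begin
  EQ.eval y F                ≡⟨ EQ.eval-cong (λ k → solve 2 (λ a b → b := a :+ :con 1ℚ :* (b :- a)) refl (y₀ k) (y k)) F ⟩
  EQ.eval (point 1ℚ) F       ≡⟨ ev-G 1ℚ ⟨
  UQ.ev 1ℚ (UQ.emb G)        ≡⟨ flat G (λ s → trans (sym (im-L _ G)) (trans (cong im (ev-dual s)) (slope s))) ⟩
  UQ.ev 0ℚ (UQ.emb G)        ≡⟨ ev-G 0ℚ ⟩
  EQ.eval (point 0ℚ) F       ≡⟨ EQ.eval-cong (λ k → solve 2 (λ a b → a :+ :con 0ℚ :* b := a) refl (y₀ k) (y k − y₀ k)) F ⟩
  EQ.eval y₀ F               ∎
  where
  line : Fin n → PolyE
  line k = y₀ k ∷ (y k − y₀ k) ∷ []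
  G : PolyE
  G = Eval.eval PolyE-ops line F
  point : ℚ → Fin n → ℚ
  point s k = y₀ k + s * (y k − y₀ k)
  ev-G : ∀ s → UQ.ev s (UQ.emb G) ≡ EQ.eval (point s) F
  ev-G s = trans (EvalHom.eval-hom (Umbral.ev-hom ℚ-algebra s) line F) (EQ.eval-cong (λ k →
    solve 3 (λ a s b → a :* :con 1ℚ :+ (b :* (s :* :con 1ℚ) :+ :con 0ℚ) := a :+ s :* b) refl (y₀ k) s (y k − y₀ k)) F)
  ρ : ℚ → Fin n → Quad 0ℚ
  ρ s k = UD.ev (s +θ 1ℚ) (UD.emb (line k))
  ev-dual : ∀ s → UD.ev (s +θ 1ℚ) (UD.emb G) ≡ ED.eval (ρ s) F
  ev-dual s = EvalHom.eval-hom (Umbral.ev-hom (quad-algebra 0ℚ) (s +θ 1ℚ)) line F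
  slope : ∀ s → im (ED.eval (ρ s) F) ≡ 0ℚ
  slope s = trans (cong im (dual-eval (ρ s) F)) (LQ.sumFin-zero n (λ k → trans (cong (im (ρ s k) *_) (e k (re ∘ ρ s))) (Q.zeroʳ (im (ρ s k)))))
  flat : ∀ p → (∀ s → UQ.L (λ k → im (Dual._^_ (s +θ 1ℚ) k)) (UQ.emb p) ≡ 0ℚ) → UQ.ev 1ℚ (UQ.emb p) ≡ UQ.ev 0ℚ (UQ.emb p)
  flat [] h = refl
  flat (a ∷ p) h = trans (UQ.ev-∷ 1ℚ a (UQ.emb p)) (trans (cong (λ z → a + 1ℚ * z) (trans (zero-ev 1ℚ) (sym (zero-ev 0ℚ))))
      (trans (cong (a +_) (trans (cong (1ℚ *_) (zero-ev 0ℚ)) (cong (0ℚ *_) (sym (zero-ev 0ℚ))))) (sym (UQ.ev-∷ 0ℚ a (UQ.emb p)))))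
    where
    zeros : UQ.AllZero (UQ.emb p)
    zeros = weighted-zero 0 p (UQ.vanishing [] (UQ.emb (weighted 0 p)) (λ s _ → begin
      UQ.ev s (UQ.emb (weighted 0 p))                        ≡⟨ L-weighted 0 (s ^_) p ⟨
      UQ.L (λ k → natℚ (suc k) * s ^ k) (UQ.emb p)           ≡⟨ UQ.L-cong (UQ.emb p) (λ k → trans (cong im (dual-pow s 1ℚ k)) (Q.*-identityʳ _)) ⟨
      UQ.L (λ k → im (Dual._^_ (s +θ 1ℚ) (suc k))) (UQ.emb p) ≡⟨ solve 2 (λ a x → x := a :* :con 0ℚ :+ x) refl a _ ⟩
      UQ.L (λ k → im (Dual._^_ (s +θ 1ℚ) k)) (UQ.emb (a ∷ p)) ≡⟨ h s ⟩
      0ℚ                                                     ∎))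
    zero-ev : ∀ s → UQ.ev s (UQ.emb p) ≡ 0ℚ
    zero-ev s = UQ.L-AllZero (s ^_) zeros

-- The hypothesis speaks of distinct coordinates only, because that is all `gradient-vanishes`
-- returns for the partial derivatives, to which the induction is applied.
algebraically-independent : ∀ {n} (F : Poly n) → (∀ x → Injective x → atPowers x F ≡ 0ℚ) → ∀ y → EQ.eval y F ≡ 0ℚ
algebraically-independent {n} F h = let d , z = nilpotent F in go d F z h
  where
  go : ∀ d F → Nilpotent d F → (∀ x → Injective x → atPowers x F ≡ 0ℚ) → ∀ y → EQ.eval y F ≡ 0ℚ
  go zero F z h y = z [] y
  go (suc d) F z h y = trans
    (constant F (λ k → go d (∂ k F) (z k) (gradient-vanishes F h k)) (λ k → EQ.powers x₀ (suc (toℕ k))) y)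
    (h x₀ (λ e → Finₚ.toℕ-injective (natℚ-injective e)))
    where
    -- Any point with distinct coordinates would do: F is constant, and its value is read off at the
    -- power sums of 0, 1, ..., n - 1, where it is 0.
    x₀ : Fin n → ℚ
    x₀ i = natℚ (toℕ i)

power-sums-determine : ∀ {n} (P P′ : Poly n) → (∀ x → atPowers x P ≡ atPowers x P′) → ∀ y → EQ.eval y P ≡ EQ.eval y P′
power-sums-determine P P′ h y = Q.x-y≡0⇒x≡y {EQ.eval y P} {EQ.eval y P′} (algebraically-independent (P ⊕ (con (ℚ.- 1ℚ) ⊗ P′))
  (λ x _ → trans (cong (_− atPowers x P′) (h x)) (Q.x-x≡0 (atPowers x P′))) y)

-- The polynomial that expresses s_λ, and independence of its choice

private
  ≤ᵇ-sound : ∀ {m n} → (m ≤ᵇ n) ≡ true → m ≤ n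
  ≤ᵇ-sound {m} {n} e with m ≤ᵇ n | ℕₚ.≤ᵇ-reflects-≤ m n
  ... | true | ofʸ p = p

  decreasing : ∀ la → weaklyDecreasing la ≡ true → Dec (hd la) la
  decreasing [] e = tt
  decreasing (a ∷ []) e = ℕₚ.≤-refl , tt
  decreasing (a ∷ b ∷ la) e = ℕₚ.≤-refl , Dec-hd (b ∷ la) (decreasing (b ∷ la) (proj₂ (∧-elim e))) (≤ᵇ-sound (proj₁ (∧-elim e)))

  positive : ∀ la → all (λ a → 1 ≤ᵇ a) la ≡ true → Positive la
  positive [] e = []
  positive (a ∷ la) e = ≤ᵇ-sound (proj₁ (∧-elim e)) ∷ positive la (proj₂ (∧-elim e))

Poly-ops : ℕ → Ops
Poly-ops v = record { Carrier = Poly v ; _+_ = _⊕_ ; _*_ = _⊗_ ; ι = con }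

eval-hom : ∀ {v} O (ρ : Fin v → Ops.Carrier O) → Hom (Poly-ops v) O
eval-hom O ρ = record { φ = Eval.eval O ρ ; φ-+ = λ _ _ → refl ; φ-* = λ _ _ → refl ; φ-ι = λ _ → refl }

vars : ∀ v → ℕ → Poly v
vars v zero = con 0ℚ
vars v (suc k) with k ℕ.<? v
... | yes k<v = var (fromℕ< k<v)
... | no _ = con 0ℚ

private
  module SQ = JacobiTrudi ℚ-ops
  module MQ = Umbral ℚ-algebra

-- Jacobi-Trudi carried out in the syntax of expressions. `S-local` confines the indices to 1, ...,
-- |λ|, where `vars` does yield the variables.
schurPoly : ∀ la → Poly (sum la)
schurPoly la = JacobiTrudi.S (Poly-ops (sum la)) (vars (sum la)) la

eval-vars : ∀ {v} (a : ℕ → ℚ) k → 1 ≤ k → k ≤ v → EQ.eval (λ i → a (suc (toℕ i))) (vars v k) ≡ a k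
eval-vars {v} a (suc k) _ k<v with k ℕ.<? v
... | yes p = cong (a ∘ suc) (Finₚ.toℕ-fromℕ< p)
... | no ¬p = ⊥-elim (¬p k<v)

eval-schurPoly : ∀ la → Positive la → (a : ℕ → ℚ) → EQ.eval (λ i → a (suc (toℕ i))) (schurPoly la) ≡ SQ.S a la
eval-schurPoly la pos a = trans (HomS.S-hom (eval-hom ℚ-ops (λ i → a (suc (toℕ i)))) (vars (sum la)) la)
  (SQ.S-local la pos (eval-vars a))

schurPoly-represents : ∀ la {b} → Dec b la → Positive la → Represents la (schurPoly la)
schurPoly-represents la d pos x = begin
  evalℚ (λ i → powerSum (suc (toℕ i)) (sum la) x) (schurPoly la)    ≡⟨ evalℚ-eval _ (schurPoly la) ⟩
  EQ.eval (λ i → powerSum (suc (toℕ i)) (sum la) x) (schurPoly la)  ≡⟨ eval-schurPoly la pos (λ k → powerSum k (sum la) x) ⟩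
  SQ.S (λ k → powerSum k (sum la) x) la                             ≡⟨ SchurQ.schur-S x la d ⟨
  schur la (sum la) x                                               ∎

module _ (la : List ℕ) {b : ℕ} (d : Dec b la) (pos : Positive la) (P : Poly (sum la)) (rep : Represents la P) where

  private
    at-powers : ∀ P → Represents la P → ∀ x → atPowers x P ≡ schur la (sum la) x
    at-powers P rep x = begin
      atPowers x P                                         ≡⟨ EQ.eval-cong (λ i → sym (powerSum-powers x (suc (toℕ i)))) P ⟩
      EQ.eval (λ i → powerSum (suc (toℕ i)) (sum la) x) P  ≡⟨ evalℚ-eval _ P ⟨
      evalℚ (λ i → powerSum (suc (toℕ i)) (sum la) x) P    ≡⟨ rep x ⟩
      schur la (sum la) x                                  ∎

    same : ∀ y → EQ.eval y P ≡ EQ.eval y (schurPoly la)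
    same = power-sums-determine P (schurPoly la) (λ x →
      trans (at-powers P rep x) (sym (at-powers (schurPoly la) (schurPoly-represents la d pos) x)))

  -- `P` and `schurPoly la` agree at every rational point, in particular at the specialized power
  -- sums with E = r. The two polynomials in E therefore agree at every r, and `transfer` carries
  -- this to the umbral functional.
  umbral-S : ∀ spec → umbral (substP spec P) ≡ umbral (S-E spec la)
  umbral-S spec = begin
    umbral (substP spec P)                            ≡⟨ MQ.ι-umbral (substP spec P) ⟩
    UQ.L (Euler.ε ℚ-algebra) (UQ.emb (substP spec P)) ≡⟨ UQ.transfer (UQ.emb (substP spec P)) (UQ.emb (S-E spec la)) (λ r → begin
        UQ.ev r (UQ.emb (substP spec P))                ≡⟨ cong (UQ.ev r ∘ UQ.emb) (substP-eval spec P) ⟩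
        UQ.ev r (UQ.emb (Eval.eval PolyE-ops (λ i → spec (suc (toℕ i))) P))
                                                        ≡⟨ EvalHom.eval-hom (MQ.ev-hom r) (λ i → spec (suc (toℕ i))) P ⟩
        EQ.eval (λ i → MQ.at r spec (suc (toℕ i))) P    ≡⟨ same _ ⟩
        EQ.eval (λ i → MQ.at r spec (suc (toℕ i))) (schurPoly la) ≡⟨ eval-schurPoly la pos (MQ.at r spec) ⟩
        SQ.S (MQ.at r spec) la                          ≡⟨ MQ.ev-S r spec la ⟨
        UQ.ev r (UQ.emb (S-E spec la))                  ∎) (Euler.ε ℚ-algebra) ⟩
    UQ.L (Euler.ε ℚ-algebra) (UQ.emb (S-E spec la))   ≡⟨ MQ.ι-umbral (S-E spec la) ⟨
    umbral (S-E spec la)                              ∎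

-- Descent from the Gaussian rationals and the theorem

private
  ℂ : ℚAlgebra
  ℂ = quad-algebra (ℚ.- 1ℚ)
  open ℚAlgebra ℂ using (ι)

  𝕚 : Quad (ℚ.- 1ℚ)
  𝕚 = 0ℚ +θ 1ℚ

  module M = Umbral ℂ
  module G = M.Gaussian 𝕚 refl

  alt-number : ∀ la → ι (ℕtoℚ (alt la)) ≡ SYT.K ℂ isOdd (sum la) la (const true)
  alt-number la = trans (M.ι-length (filterᵇ (isAlternating (sum la)) (SYTs la))) (SYT.number-filter ℂ isOdd la)

  ralt-number : ∀ la → ι (ℕtoℚ (ralt la)) ≡ SYT.K ℂ G.Ralt.w (sum la) la (const true)
  ralt-number la = trans (M.ι-length (filterᵇ (isReverseAlternating (sum la)) (SYTs la))) (SYT.number-filter ℂ G.Ralt.w la)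

  -- `ι` is injective, with left inverse `re`; so the identity obtained over the Gaussian rationals
  -- holds in ℚ.
  conclude : ∀ spec la {q N} → ι q ≡ N → N ≡ Univariate.L ℂ (Euler.ε ℂ) (Univariate.emb ℂ (S-E spec la)) → q ≡ umbral (S-E spec la)
  conclude spec la e e′ = cong re (trans e (trans e′ (sym (M.ι-umbral (S-E spec la)))))

alt-odd : ∀ la {b} → Dec b la → isOdd (sum la) ≡ true → ℕtoℚ (alt la) ≡ umbral (S-E specOdd la)
alt-odd la d e = conclude specOdd la (alt-number la) (G.Alt.alt-odd la d e)

alt-even : ∀ la {b} → Dec b la → isOdd (sum la) ≡ false → ℕtoℚ (alt la) ≡ umbral (S-E specAlt la)
alt-even la d e = conclude specAlt la (alt-number la) (G.Alt.alt-even la d e)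

ralt-odd : ∀ la {b} → Dec b la → isOdd (sum la) ≡ true → ℕtoℚ (ralt la) ≡ umbral (S-E specOdd la)
ralt-odd la d e = conclude specOdd la (ralt-number la) (G.Ralt.ralt-odd la d e)

ralt-even : ∀ la {b} → Dec b la → isOdd (sum la) ≡ false → ℕtoℚ (ralt la) ≡ umbral (S-E specRalt la)
ralt-even la d e = conclude specRalt la (ralt-number la) (G.Ralt.ralt-even la d e)

theorem4p2 : (n : ℕ) (la : List ℕ) → IsPartition la n →
    Σ (Poly (sum la)) (Represents la) ×
    ((P : Poly (sum la)) → Represents la P →
    (n % 2 ≡ 1 →
    (ℕtoℚ (alt la) ≡ umbral (substP specOdd P)) ×
    (ℕtoℚ (ralt la) ≡ umbral (substP specOdd P))) ×
    (n % 2 ≡ 0 →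
    (ℕtoℚ (alt la) ≡ umbral (substP specAlt P)) ×
    (ℕtoℚ (ralt la) ≡ umbral (substP specRalt P))))
theorem4p2 n la (refl , dec , parts) =
  (schurPoly la , schurPoly-represents la d pos) ,
  λ P rep →
    (λ odd → let e = cong (_≡ᵇ 1) odd in
      trans (alt-odd la d e) (sym (umbral-S la d pos P rep specOdd)) ,
      trans (ralt-odd la d e) (sym (umbral-S la d pos P rep specOdd))) ,
    (λ even → let e = cong (_≡ᵇ 1) even in
      trans (alt-even la d e) (sym (umbral-S la d pos P rep specAlt)) ,
      trans (ralt-even la d e) (sym (umbral-S la d pos P rep specRalt)))
  where
  d = decreasing la dec
  pos = positive la parts
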